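{- Let $\mathcal{K}$ be the class of all upper semicomputable functions $K(x,y)$ of two binary strings such that for every string $y$ and every $n$ there are at most $2^n$ different strings $x$ with $K(x,y)<n$, and such that $K(x,y0)\le K(x,y)$ and $K(x,y1)\le K(x,y)$ for every $x$ and $y$. (a) The function $\mathrm{C}(x\mid y*)$ belongs to $\mathcal{K}$. (b) There exists a minimal, up to an $O(1)$ additive term, function in $\mathcal{K}$ (that is, a function $K_0\in\mathcal{K}$ such that for every $K\in\mathcal{K}$ there is a constant $c$ with $K_0(x,y)\le K(x,y)+c$ for all $x,y$). (c) The function $\mathrm{C}(x\mid y*)$ is not minimal in $\mathcal{K}$: there exist a function $K\in\mathcal{K}$ and sequences of strings $x_n$ and $y_n$ such that $K(x_n,y_n)\le n$, but $\mathrm{C}(x_n\mid y_n*)\ge 2n-c$ for some $c$ and for every $n$. (d) The factor $2$ in (c) is optimal: if $K\in\mathcal{K}$, then $\mathrm{C}(x\mid y*)\le 2K(x,y)+c$ for some $c$ and for all $x$ and $y$.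
   Context: A natural-valued function $K(x,y)$ is upper semicomputable if it is the pointwise limit of a decreasing sequence of uniformly computable total functions; equivalently, the set $\{(n,x,y) : K(x,y)<n\}$ is computably enumerable. Here $y0$ and $y1$ denote the string $y$ with one bit appended. A description mode is a set $D$ of triples $(p,x,y)$ of binary strings such that: (1) $D$ is computably enumerable; (2) for every $p$ and $x$ there is at most one $y$ such that $(p,x,y)\in D$; (3) if $(p,x,y)\in D$ and $x$ is a prefix of $x'$, then $(p,x',y)\in D$. For a description mode $D$ let $\mathrm{C}_D(y\mid x*)=\min\{|p| : (p,x,y)\in D\}$ (object $y$, condition $x$). There exists an optimal description mode, i.e., a $D$ such that $\mathrm{C}_D\le \mathrm{C}_{D'}+O(1)$ for every description mode $D'$; fix such a $D$ and write $\mathrm{C}(y\mid x*)$ for $\mathrm{C}_D(y\mid x*)$. In the claim the object is $x$ and the condition is $y$, so the function used is $\mathrm{C}(x\mid y*)$. -}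

module Defs where

open import Data.Bool.Base using (Bool; true; false)
open import Data.Fin.Base using (Fin)
open import Data.Fin.Patterns using (0F; 1F; 2F; 3F)
open import Data.List.Base using (List; []; _∷_; _∷ʳ_; length)
open import Data.List.Relation.Binary.Prefix.Heterogeneous using (Prefix)
open import Data.List.Relation.Unary.All using (All)
open import Data.List.Relation.Unary.Unique.Propositional using (Unique)
open import Data.Nat.Base using (ℕ; zero; suc; pred; _+_; _∸_; _*_; _^_; _≤_; _<_)
open import Data.Nat.Properties
  using (suc-injective; *-cancelˡ-≡; even≢odd; ≤-antisym; ≤-refl; <-cmp;
         m∸n≡0⇒m≤n; n∸n≡0; m+n≡0⇒m≡0; m+n≡0⇒n≡0; pred[m∸n]≡m∸[1+n])
open import Data.Product.Base using (∃; _×_; _,_; proj₁; proj₂)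
open import Data.Vec.Base using (Vec; []; _∷_; lookup)
open import Data.Vec.Relation.Binary.Pointwise.Inductive using (Pointwise; []; _∷_)
open import Function.Bundles using (_⇔_; mk⇔)
open import Relation.Binary.Definitions using (tri<; tri≈; tri>)
open import Relation.Binary.PropositionalEquality
  using (_≡_; refl; sym; trans; cong; cong₂; subst)
open import Relation.Nullary.Negation.Core using (contradiction)

-- Partial recursive functions (Kleene).

data Rec : ℕ → Set where
  zer : ∀ {n} → Rec n
  inc : Rec 1
  prj : ∀ {n} → Fin n → Rec n
  cmp : ∀ {m n} → Rec m → Vec (Rec n) m → Rec n
  rec : ∀ {n} → Rec n → Rec (2 + n) → Rec (1 + n)
  min : ∀ {n} → Rec (1 + n) → Rec n

infix 4 _⟨_⟩↦_

-- f ⟨ xs ⟩↦ y : the partial function f is defined on xs, with value y.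

data _⟨_⟩↦_ : ∀ {n} → Rec n → Vec ℕ n → ℕ → Set where
  ↦zer : ∀ {n} {xs : Vec ℕ n} → zer ⟨ xs ⟩↦ 0
  ↦inc : ∀ {x} → inc ⟨ x ∷ [] ⟩↦ suc x
  ↦prj : ∀ {n} {xs : Vec ℕ n} (i : Fin n) → prj i ⟨ xs ⟩↦ lookup xs i
  ↦cmp : ∀ {m n} {f : Rec m} {gs : Vec (Rec n) m} {xs ys z} →
         Pointwise (λ g y → g ⟨ xs ⟩↦ y) gs ys → f ⟨ ys ⟩↦ z →
         cmp f gs ⟨ xs ⟩↦ z
  ↦rec-zero : ∀ {n} {g : Rec n} {h xs y} → g ⟨ xs ⟩↦ y → rec g h ⟨ 0 ∷ xs ⟩↦ y
  ↦rec-suc  : ∀ {n} {g : Rec n} {h k xs r y} →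
              rec g h ⟨ k ∷ xs ⟩↦ r → h ⟨ k ∷ r ∷ xs ⟩↦ y →
              rec g h ⟨ suc k ∷ xs ⟩↦ y
  ↦min : ∀ {n} {f : Rec (1 + n)} {xs y} →
         f ⟨ y ∷ xs ⟩↦ 0 → (∀ i → i < y → ∃ λ v → f ⟨ i ∷ xs ⟩↦ suc v) →
         min f ⟨ xs ⟩↦ y

String : Set
String = List Bool

-- Bijective base-2 numeration: a bijection between strings and ℕ.

code : String → ℕ
code []          = 0
code (false ∷ s) = 1 + 2 * code s
code (true ∷ s)  = 2 + 2 * code s

-- A set of triples is c.e. when it is the domain of a partial computable function.

ComputablyEnumerable : (String → String → String → Set) → Set
ComputablyEnumerable R =
  ∃ λ (f : Rec 3) → ∀ p x y →
    R p x y ⇔ (∃ λ v → f ⟨ code p ∷ code x ∷ code y ∷ [] ⟩↦ v)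

record UpperSemicomputable (K : String → String → ℕ) : Set where
  field
    approx     : ℕ → String → String → ℕ
    program    : Rec 3
    computes   : ∀ s x y → program ⟨ s ∷ code x ∷ code y ∷ [] ⟩↦ approx s x y
    decreasing : ∀ s x y → approx (suc s) x y ≤ approx s x y
    -- In ℕ, converging means being eventually constant.
    limit      : ∀ x y → ∃ λ N → ∀ s → N ≤ s → approx s x y ≡ K x y

record 𝒦 (K : String → String → ℕ) : Set where
  field
    upperSemicomputable : UpperSemicomputable K
    -- At most 2 ^ n different strings x satisfy K x y < n.
    few      : ∀ y n (xs : List String) → Unique xs → All (λ x → K x y < n) xs →
               length xs ≤ 2 ^ n
    monotone : ∀ x y b → K x (y ∷ʳ b) ≤ K x y

Minimal : (String → String → ℕ) → Set
Minimal K₀ = 𝒦 K₀ × (∀ K → 𝒦 K → ∃ λ c → ∀ x y → K₀ x y ≤ K x y + c)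

record DescriptionMode : Set₁ where
  field
    Describes  : String → String → String → Set
    enumerable : ComputablyEnumerable Describes
    functional : ∀ {p x y y′} → Describes p x y → Describes p x y′ → y ≡ y′
    extensible : ∀ {p x x′ y} → Describes p x y → Prefix _≡_ x x′ → Describes p x′ y

open DescriptionMode

-- IsComplexity D y x k : the minimum C_D(y | x*) exists and equals k.
-- When no p describes y given x, C_D(y | x*) is infinite and no such k exists.

IsComplexity : DescriptionMode → String → String → ℕ → Set
IsComplexity D y x k =
  (∃ λ p → Describes D p x y × length p ≡ k) ×
  (∀ p → Describes D p x y → k ≤ length p)

-- C_D ≤ C_D′ + O(1) for all D′; there is nothing to require where C_D′ is infinite.

Optimal : DescriptionMode → Set₁
Optimal D = ∀ D′ → ∃ λ c → ∀ y x k′ → IsComplexity D′ y x k′ →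
  ∃ λ k → IsComplexity D y x k × k ≤ k′ + c

-- To see that the complexity of an optimal mode is finite everywhere, compare it with
-- the mode in which every string describes itself.

deterministic : ∀ {n} {f : Rec n} {xs y z} → f ⟨ xs ⟩↦ y → f ⟨ xs ⟩↦ z → y ≡ z
deterministic* : ∀ {m n} {gs : Vec (Rec n) m} {xs ys zs} →
  Pointwise (λ g y → g ⟨ xs ⟩↦ y) gs ys → Pointwise (λ g y → g ⟨ xs ⟩↦ y) gs zs →
  ys ≡ zs

deterministic ↦zer ↦zer = refl
deterministic ↦inc ↦inc = refl
deterministic (↦prj i) (↦prj .i) = refl
deterministic (↦cmp gs f) (↦cmp gs′ f′) with refl ← deterministic* gs gs′ =
  deterministic f f′
deterministic (↦rec-zero g) (↦rec-zero g′) = deterministic g g′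
deterministic (↦rec-suc r h) (↦rec-suc r′ h′) with refl ← deterministic r r′ =
  deterministic h h′
deterministic (↦min {y = y} f below) (↦min {y = z} f′ below′) with <-cmp y z
... | tri≈ _ y≡z _ = y≡z
... | tri< y<z _ _ = contradiction (deterministic f (proj₂ (below′ y y<z))) λ ()
... | tri> _ _ z<y = contradiction (deterministic f′ (proj₂ (below z z<y))) λ ()

deterministic* [] [] = refl
deterministic* (g ∷ gs) (g′ ∷ gs′) =
  cong₂ _∷_ (deterministic g g′) (deterministic* gs gs′)

predᴿ : Rec 1
predᴿ = rec zer (prj 0F)

↦pred : ∀ n → predᴿ ⟨ n ∷ [] ⟩↦ pred n
↦pred zero    = ↦rec-zero ↦zer
↦pred (suc n) = ↦rec-suc (↦pred n) (↦prj 0F)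

addᴿ : Rec 2
addᴿ = rec (prj 0F) (cmp inc (prj 1F ∷ []))

↦add : ∀ m n → addᴿ ⟨ m ∷ n ∷ [] ⟩↦ m + n
↦add zero    n = ↦rec-zero (↦prj 0F)
↦add (suc m) n = ↦rec-suc (↦add m n) (↦cmp (↦prj 1F ∷ []) ↦inc)

-- The subtrahend is the first argument.
monusᴿ : Rec 2
monusᴿ = rec (prj 0F) (cmp predᴿ (prj 1F ∷ []))

↦monus : ∀ n m → monusᴿ ⟨ n ∷ m ∷ [] ⟩↦ m ∸ n
↦monus zero    m = ↦rec-zero (↦prj 0F)
↦monus (suc n) m = subst (monusᴿ ⟨ suc n ∷ m ∷ [] ⟩↦_) (pred[m∸n]≡m∸[1+n] m n)
  (↦rec-suc (↦monus n m) (↦cmp (↦prj 1F ∷ []) (↦pred (m ∸ n))))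

-- |a - c|, ignoring the other two arguments.
distᴿ : Rec 4
distᴿ = cmp addᴿ (cmp monusᴿ (prj 3F ∷ prj 1F ∷ []) ∷
                  cmp monusᴿ (prj 1F ∷ prj 3F ∷ []) ∷ [])

↦dist : ∀ i a b c → distᴿ ⟨ i ∷ a ∷ b ∷ c ∷ [] ⟩↦ (a ∸ c) + (c ∸ a)
↦dist i a b c = ↦cmp
  (↦cmp (↦prj 3F ∷ ↦prj 1F ∷ []) (↦monus c a) ∷
   ↦cmp (↦prj 1F ∷ ↦prj 3F ∷ []) (↦monus a c) ∷ [])
  (↦add (a ∸ c) (c ∸ a))

halts : ∀ a b → min distᴿ ⟨ a ∷ b ∷ a ∷ [] ⟩↦ 0
halts a b = ↦min
  (subst (distᴿ ⟨ 0 ∷ a ∷ b ∷ a ∷ [] ⟩↦_) (cong₂ _+_ (n∸n≡0 a) (n∸n≡0 a)) (↦dist 0 a b a))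
  λ _ ()

halts⇒≡ : ∀ {a b c v} → min distᴿ ⟨ a ∷ b ∷ c ∷ [] ⟩↦ v → a ≡ c
halts⇒≡ {a} {b} {c} (↦min {y = i} f _) = ≤-antisym
  (m∸n≡0⇒m≤n (m+n≡0⇒m≡0 (a ∸ c) dist≡0))
  (m∸n≡0⇒m≤n (m+n≡0⇒n≡0 (a ∸ c) dist≡0))
  where
  dist≡0 : (a ∸ c) + (c ∸ a) ≡ 0
  dist≡0 = deterministic (↦dist i a b c) f

code-injective : ∀ s t → code s ≡ code t → s ≡ t
code-injective []          []          _  = refl
code-injective []          (false ∷ t) ()
code-injective []          (true ∷ t)  ()
code-injective (false ∷ s) []          ()
code-injective (true ∷ s)  []          ()
code-injective (false ∷ s) (false ∷ t) eq =
  cong (false ∷_) (code-injective s t (*-cancelˡ-≡ (code s) (code t) 2 (suc-injective eq)))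
code-injective (true ∷ s)  (true ∷ t)  eq =
  cong (true ∷_) (code-injective s t
    (*-cancelˡ-≡ (code s) (code t) 2 (suc-injective (suc-injective eq))))
code-injective (false ∷ s) (true ∷ t)  eq =
  contradiction (suc-injective eq) (even≢odd (code s) (code t))
code-injective (true ∷ s)  (false ∷ t) eq =
  contradiction (sym (suc-injective eq)) (even≢odd (code t) (code s))

copy : DescriptionMode
copy = record
  { Describes  = λ p _ y → p ≡ y
  ; enumerable = min distᴿ , λ p x y → mk⇔
      (λ { refl → 0 , halts (code p) (code x) })
      (λ { (_ , h) → code-injective p y (halts⇒≡ h) })
  ; functional = λ p≡y p≡y′ → trans (sym p≡y) p≡y′
  ; extensible = λ p≡y _ → p≡y
  }

finite : ∀ D → Optimal D → ∀ y x → ∃ λ k → IsComplexity D y x k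
finite D opt y x with opt copy
... | _ , compare with compare y x (length y)
                         ((y , refl , refl) , λ { _ refl → ≤-refl })
... | k , isComplexity , _ = k , isComplexity

-- C D opt y x is C(y | x*).

C : ∀ D → Optimal D → String → String → ℕ
C D opt y x = proj₁ (finite D opt y x)

C-isComplexity : ∀ D (opt : Optimal D) y x → IsComplexity D y x (C D opt y x)
C-isComplexity D opt y x = proj₂ (finite D opt y x)

{-# OPTIONS --safe #-}
module Submission where

-- C(x|y*) is in the class because prefixes of the condition only help. A minimal function is
-- obtained by running all programs, accepting a claim K(x,y) ≤ n of the i-th program only while
-- the counting condition survives, and taking the minimum of the bounds n + i + 2.
--
-- Upper bound 2K: fix n and m. Once m strings with K(x,z) ≤ n are found at a node z, label them by
-- different numbers below 2 ^ (n + 1), so that strings common to all labelled nodes above a node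
-- y get there the same label; a string x with K(x,y) ≤ n of this kind is described at y by
-- (n, m, label). No two strings compete for a description at comparable nodes, since both are
-- labelled at a common extension. If m is the maximal number of strings above y, all strings
-- with K(x,y) ≤ n are of this kind.
--
-- Lower bound 2n: let A = 2 ^ a. In a tree of height A with a fresh string at every leaf, proceed
-- from the leaves to the root: when two children of a node hold different strings answered by
-- the same description, request one of these strings at the node. Its next description differs
-- from all earlier ones, each of which describes another string somewhere above. At the root
-- one string has A descriptions at its leaf, where it is alone; the next tree starts
-- at that leaf. At most 2A strings are requested along a path, but A trees force
-- A * A = 2 ^ (2 a) descriptions at one node, so not all of them are shorter than 2a.

open import Defs
open import Axiom.ExcludedMiddle using (ExcludedMiddle)
open import Data.Bool.Base using (Bool; true; false; if_then_else_; not; _∧_)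
open import Data.Empty using (⊥; ⊥-elim)
open import Data.Fin.Base using (Fin; toℕ; fromℕ<)
import Data.Fin.Base as Fin
open import Data.Fin.Patterns using (0F; 1F; 2F; 3F)
open import Data.Fin.Properties
  using (injective⇒≤; fromℕ<-injective; toℕ<n; toℕ-injective; pigeonhole)
open import Data.List.Base
  using (List; []; _∷_; _∷ʳ_; _++_; length; lookup; map; filter; foldl; foldr; replicate; reverse)
open import Data.List.Membership.Propositional using (_∈_; find; lose)
open import Data.List.Membership.Propositional.Properties
  using (∈-lookup; ∈-map⁺; ∈-map⁻; ∈-filter⁺; ∈-filter⁻)
open import Data.List.Properties
  using (reverse-foldr; reverse-involutive; unfold-reverse; length-map; length-++;
         ++-assoc; ++-identityʳ; ∷ʳ-++; ∷ʳ-injectiveʳ)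
open import Data.List.Relation.Binary.Prefix.Heterogeneous using (Prefix; []; _∷_)
open import Data.List.Relation.Unary.All as All using (All; []; _∷_; all?)
open import Data.List.Relation.Unary.All.Properties using (¬All⇒Any¬; All¬⇒¬Any)
import Data.List.Relation.Unary.All.Properties as AllProps
open import Data.List.Relation.Unary.AllPairs using ([]; _∷_)
open import Data.List.Relation.Unary.Any as Any using (Any; here; there)
open import Data.List.Relation.Unary.Any.Properties using (lookup-index)
open import Data.List.Relation.Unary.Unique.Propositional using (Unique)
open import Data.List.Relation.Unary.Unique.Propositional.Properties using (++⁺; map⁻)
open import Data.Nat.Base hiding (parity)
open import Data.Nat.Properties
open import Data.Product.Base using (∃; _×_; _,_; proj₁; proj₂; uncurry)
open import Data.Sum.Base using (_⊎_; inj₁; inj₂)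
open import Data.Vec.Base using (Vec; []; _∷_)
import Data.Vec.Base as Vec
open import Data.Vec.Relation.Binary.Pointwise.Inductive using (Pointwise; []; _∷_)
open import Function.Base using (_∘_; id; case_of_)
open import Function.Bundles using (mk⇔; Equivalence)
open import Level using (0ℓ)
open import Relation.Binary.Definitions using (tri<; tri≈; tri>)
open import Relation.Binary.PropositionalEquality
open import Relation.Nullary.Decidable.Core
  using (Dec; yes; no; does; map′; ¬?; _×-dec_; decidable-stable)
open import Relation.Nullary.Negation.Core using (¬_; contradiction)

-- Nothing can be retracted: a label or a description given at a node stays in force at all its
-- extensions. This is what costs the factor 2. For the upper bound, no finite stage reveals the
-- maximal `m`, so it is written down next to the label; both are at most 2 ^ (n + 1), which amounts
-- to 2n + O(1) bits. For the lower bound, a description spent on another string above a node is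
-- lost for the node itself, and every level of a tree loses one more.
--
-- The tree of the game branches infinitely, so that a finite supply of short descriptions forces
-- two children to share one; a prefix code embeds it in the binary tree. Games for different `a`
-- are played at incomparable conditions, hence their requests never add up along a path. In the
-- minimal function, the counts of all programs form a geometric sum that fills half of the allowed
-- number; default values take the other half.
--
-- All three constructions test candidates against a finite stage only, and every candidate recurs
-- forever, so it suffices to show that the right candidate is acceptable from some time on.

-- Cantor's pairing function

tri : ℕ → ℕ
tri zero    = 0
tri (suc n) = suc n + tri n

tri-mono : ∀ {m n} → m ≤ n → tri m ≤ tri n
tri-mono {n = n} z≤n = z≤n
tri-mono (s≤s m≤n) = +-mono-≤ (s≤s m≤n) (tri-mono m≤n)

-- The diagonal of Cantor's enumeration that contains `n`, i.e. the largest `w` with `tri w ≤ n`. It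
-- grows by 1 exactly when `suc n` is the next triangular number; truncated subtraction makes this
-- test primitive recursive.
diag : ℕ → ℕ
diag zero    = 0
diag (suc n) = diag n + (1 ∸ (tri (suc (diag n)) ∸ suc n))

diag-bounds : ∀ n → tri (diag n) ≤ n × n < tri (suc (diag n))
diag-bounds zero = z≤n , s≤s z≤n
diag-bounds (suc n) with diag-bounds n | tri (suc (diag n)) ≤? suc n
... | lo , hi | yes q rewrite m≤n⇒m∸n≡0 q | +-comm (diag n) 1 =
  q , s≤s (≤-trans hi (m≤n+m _ (suc (diag n))))
... | lo , hi | no ¬q
  rewrite m≤n⇒m∸n≡0 (m<n⇒0<n∸m (≰⇒> ¬q)) | +-identityʳ (diag n) =
  m≤n⇒m≤1+n lo , ≰⇒> ¬q

diag-unique : ∀ {n w} → tri w ≤ n → n < tri (suc w) → diag n ≡ w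
diag-unique {n} {w} lo hi with diag-bounds n
... | lo′ , hi′ = ≤-antisym
  (≮⇒≥ λ w<d → <⇒≱ hi (≤-trans (tri-mono w<d) lo′))
  (≮⇒≥ λ d<w → <⇒≱ hi′ (≤-trans (tri-mono d<w) lo))

diag-tri : ∀ a b → diag (tri (a + b) + a) ≡ a + b
diag-tri a b = diag-unique (m≤m+n _ a)
  (s≤s (subst (tri (a + b) + a ≤_) (+-comm (tri (a + b)) (a + b)) (+-monoʳ-≤ (tri (a + b)) (m≤m+n a b))))

triᴿ : Rec 1
triᴿ = rec zer (cmp addᴿ (cmp inc (prj 0F ∷ []) ∷ prj 1F ∷ []))

↦tri : ∀ n → triᴿ ⟨ n ∷ [] ⟩↦ tri n
↦tri zero    = ↦rec-zero ↦zer
↦tri (suc n) = ↦rec-suc (↦tri n)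
  (↦cmp (↦cmp (↦prj 0F ∷ []) ↦inc ∷ ↦prj 1F ∷ []) (↦add (suc n) (tri n)))

oneᴿ : ∀ {n} → Rec n
oneᴿ = cmp inc (zer ∷ [])

↦one : ∀ {n} {xs : Vec ℕ n} → oneᴿ ⟨ xs ⟩↦ 1
↦one = ↦cmp (↦zer ∷ []) ↦inc

diagᴿ : Rec 1
diagᴿ = rec zer (cmp addᴿ (prj 1F ∷
  cmp monusᴿ (cmp monusᴿ (cmp inc (prj 0F ∷ []) ∷ cmp triᴿ (cmp inc (prj 1F ∷ []) ∷ []) ∷ []) ∷
              oneᴿ ∷ []) ∷ []))

↦diag : ∀ n → diagᴿ ⟨ n ∷ [] ⟩↦ diag n
↦diag zero    = ↦rec-zero ↦zer
↦diag (suc n) = ↦rec-suc (↦diag n) (↦cmp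
  (↦prj 1F ∷
   ↦cmp (↦cmp (↦cmp (↦prj 0F ∷ []) ↦inc ∷ ↦cmp (↦cmp (↦prj 1F ∷ []) ↦inc ∷ []) (↦tri (suc (diag n))) ∷ [])
              (↦monus (suc n) _) ∷ ↦one ∷ [])
        (↦monus _ 1) ∷ [])
  (↦add _ _))

opaque
  pair : ℕ → ℕ → ℕ
  pair a b = tri (a + b) + a

  π₁ π₂ : ℕ → ℕ
  π₁ n = n ∸ tri (diag n)
  π₂ n = diag n ∸ π₁ n

  π₁-pair : ∀ a b → π₁ (pair a b) ≡ a
  π₁-pair a b rewrite diag-tri a b = m+n∸m≡n (tri (a + b)) a

  π₂-pair : ∀ a b → π₂ (pair a b) ≡ b
  π₂-pair a b rewrite π₁-pair a b | diag-tri a b = m+n∸m≡n a b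

  pair-π : ∀ n → pair (π₁ n) (π₂ n) ≡ n
  pair-π n with diag-bounds n
  ... | lo , hi = trans (cong (λ w → tri w + π₁ n) (m+[n∸m]≡n π₁≤)) (m+[n∸m]≡n lo)
    where
    π₁≤ : π₁ n ≤ diag n
    π₁≤ = m≤n+o⇒m∸n≤o n (tri (diag n))
      (≤-trans (s≤s⁻¹ hi) (≤-reflexive (+-comm (diag n) (tri (diag n)))))

  π₂≤ : ∀ n → π₂ n ≤ n
  π₂≤ n = ≤-trans (m∸n≤m (diag n) (π₁ n)) (≤-trans (n≤tri (diag n)) (proj₁ (diag-bounds n)))
    where
    n≤tri : ∀ n → n ≤ tri n
    n≤tri zero    = z≤n
    n≤tri (suc n) = m≤m+n (suc n) (tri n)

  pairᴿ : Rec 2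
  pairᴿ = cmp addᴿ (cmp triᴿ (addᴿ ∷ []) ∷ prj 0F ∷ [])

  ↦pair : ∀ a b → pairᴿ ⟨ a ∷ b ∷ [] ⟩↦ pair a b
  ↦pair a b = ↦cmp (↦cmp (↦add a b ∷ []) (↦tri _) ∷ ↦prj 0F ∷ []) (↦add _ _)

  π₁ᴿ π₂ᴿ : Rec 1
  π₁ᴿ = cmp monusᴿ (cmp triᴿ (diagᴿ ∷ []) ∷ prj 0F ∷ [])
  π₂ᴿ = cmp monusᴿ (π₁ᴿ ∷ diagᴿ ∷ [])

  ↦π₁ : ∀ n → π₁ᴿ ⟨ n ∷ [] ⟩↦ π₁ n
  ↦π₁ n = ↦cmp (↦cmp (↦diag n ∷ []) (↦tri _) ∷ ↦prj 0F ∷ []) (↦monus _ _)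

  ↦π₂ : ∀ n → π₂ᴿ ⟨ n ∷ [] ⟩↦ π₂ n
  ↦π₂ n = ↦cmp (↦π₁ n ∷ ↦diag n ∷ []) (↦monus _ _)

-- Two uses: the code of a list bounds its length, and a number with a prescribed first component
-- can be arbitrarily large.
n≤pair : ∀ a b → b ≤ pair a b
n≤pair a b = subst (_≤ pair a b) (π₂-pair a b) (π₂≤ (pair a b))

-- Computable functions on encoded data

infixl 6 _⊗_
infixr 4 _,ᶜ_

data Ty : Set where
  nat str : Ty
  _⊗_     : Ty → Ty → Ty
  list    : Ty → Ty

⟦_⟧ : Ty → Set
⟦ nat ⟧    = ℕ
⟦ str ⟧    = String
⟦ σ ⊗ τ ⟧  = ⟦ σ ⟧ × ⟦ τ ⟧
⟦ list τ ⟧ = List ⟦ τ ⟧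

enc  : ∀ τ → ⟦ τ ⟧ → ℕ
encs : ∀ τ → List ⟦ τ ⟧ → ℕ
enc nat      n       = n
enc str      s       = code s
enc (σ ⊗ τ)  (a , b) = pair (enc σ a) (enc τ b)
enc (list τ) xs      = encs τ xs
encs τ []       = 0
encs τ (x ∷ xs) = suc (pair (enc τ x) (encs τ xs))

nextStr : String → String
nextStr []          = false ∷ []
nextStr (false ∷ s) = true ∷ s
nextStr (true ∷ s)  = false ∷ nextStr s

code-nextStr : ∀ s → code (nextStr s) ≡ suc (code s)
code-nextStr []          = refl
code-nextStr (false ∷ s) = refl
code-nextStr (true ∷ s)  =
  cong suc (trans (cong (2 *_) (code-nextStr s)) (cong suc (+-suc (code s) (code s + 0))))

dec  : ∀ τ → ℕ → ⟦ τ ⟧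
decs : ∀ τ → ℕ → ℕ → List ⟦ τ ⟧
dec nat      n       = n
dec str      zero    = []
dec str      (suc n) = nextStr (dec str n)
dec (σ ⊗ τ)  n       = dec σ (π₁ n) , dec τ (π₂ n)
-- The code itself is enough fuel: every element lowers it, since a successor is removed and `π₂`
-- does not increase a number.
dec (list τ) n       = decs τ n n
decs τ zero       n       = []
decs τ (suc fuel) zero    = []
decs τ (suc fuel) (suc n) = dec τ (π₁ n) ∷ decs τ fuel (π₂ n)

enc-dec  : ∀ τ n → enc τ (dec τ n) ≡ n
encs-decs : ∀ τ fuel n → n ≤ fuel → encs τ (decs τ fuel n) ≡ n
enc-dec nat      n       = refl
enc-dec str      zero    = refl
enc-dec str      (suc n) = trans (code-nextStr (dec str n)) (cong suc (enc-dec str n))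
enc-dec (σ ⊗ τ)  n       = trans (cong₂ pair (enc-dec σ (π₁ n)) (enc-dec τ (π₂ n))) (pair-π n)
enc-dec (list τ) n       = encs-decs τ n n ≤-refl
encs-decs τ zero       zero    _   = refl
encs-decs τ (suc fuel) zero    _   = refl
encs-decs τ (suc fuel) (suc n) n≤f = cong suc
  (trans (cong₂ pair (enc-dec τ (π₁ n)) (encs-decs τ fuel (π₂ n) (≤-trans (π₂≤ n) (s≤s⁻¹ n≤f))))
         (pair-π n))

pair-injective : ∀ {a b c d} → pair a b ≡ pair c d → a ≡ c × b ≡ d
pair-injective {a} {b} {c} {d} eq =
  trans (sym (π₁-pair a b)) (trans (cong π₁ eq) (π₁-pair c d)) ,
  trans (sym (π₂-pair a b)) (trans (cong π₂ eq) (π₂-pair c d))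

enc-injective  : ∀ τ {a b} → enc τ a ≡ enc τ b → a ≡ b
encs-injective : ∀ τ xs ys → encs τ xs ≡ encs τ ys → xs ≡ ys
enc-injective nat      eq = eq
enc-injective str      eq = code-injective _ _ eq
enc-injective (σ ⊗ τ)  eq with pair-injective eq
... | p , q = cong₂ _,_ (enc-injective σ p) (enc-injective τ q)
enc-injective (list τ) eq = encs-injective τ _ _ eq
encs-injective τ []       []       _  = refl
encs-injective τ (x ∷ xs) (y ∷ ys) eq with pair-injective (suc-injective eq)
... | p , q = cong₂ _∷_ (enc-injective τ p) (encs-injective τ xs ys q)

dec-enc : ∀ τ a → dec τ (enc τ a) ≡ a
dec-enc τ a = enc-injective τ (enc-dec τ (enc τ a))

record Comp (σ τ : Ty) (f : ⟦ σ ⟧ → ⟦ τ ⟧) : Set where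
  constructor _,_
  field
    program  : Rec 1
    computes : ∀ a → program ⟨ enc σ a ∷ [] ⟩↦ enc τ (f a)

open Comp

private variable
  σ τ υ ω : Ty

Comp₂ : ∀ σ τ υ → (⟦ σ ⟧ → ⟦ τ ⟧ → ⟦ υ ⟧) → Set
Comp₂ σ τ υ f = Comp (σ ⊗ τ) υ (uncurry f)

opaque
  Comp-cong : ∀ {f g : ⟦ σ ⟧ → ⟦ τ ⟧} → (∀ a → f a ≡ g a) → Comp σ τ f → Comp σ τ g
  Comp-cong {σ} {τ} f≗g (r , ok) = r , λ a → subst (λ b → r ⟨ enc σ a ∷ [] ⟩↦ enc τ b) (f≗g a) (ok a)

opaque
  Comp-id : Comp σ σ id
  Comp-id = prj 0F , λ _ → ↦prj 0F

opaque
  app : ∀ {g : ⟦ τ ⟧ → ⟦ υ ⟧} {f : ⟦ σ ⟧ → ⟦ τ ⟧} →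
        Comp τ υ g → Comp σ τ f → Comp σ υ (λ a → g (f a))
  app {f = f} (r , ok) (r′ , ok′) = cmp r (r′ ∷ []) , λ a → ↦cmp (ok′ a ∷ []) (ok (f a))

opaque
  _,ᶜ_ : ∀ {f : ⟦ σ ⟧ → ⟦ τ ⟧} {g : ⟦ σ ⟧ → ⟦ υ ⟧} →
         Comp σ τ f → Comp σ υ g → Comp σ (τ ⊗ υ) (λ a → f a , g a)
  (r , ok) ,ᶜ (r′ , ok′) = cmp pairᴿ (r ∷ r′ ∷ []) , λ a → ↦cmp (ok a ∷ ok′ a ∷ []) (↦pair _ _)

app₂ : ∀ {h : ⟦ τ ⟧ → ⟦ υ ⟧ → ⟦ ω ⟧} {f : ⟦ σ ⟧ → ⟦ τ ⟧} {g : ⟦ σ ⟧ → ⟦ υ ⟧} →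
       Comp₂ τ υ ω h → Comp σ τ f → Comp σ υ g → Comp σ ω (λ a → h (f a) (g a))
app₂ h f g = app h (f ,ᶜ g)

unpairᴿ : ∀ (f : Rec 1) {π : ℕ → ℕ} (↦π : ∀ n → f ⟨ n ∷ [] ⟩↦ π n) {n m} → π n ≡ m →
          f ⟨ n ∷ [] ⟩↦ m
unpairᴿ f ↦π refl = ↦π _

opaque
  fst : Comp (σ ⊗ τ) σ proj₁
  fst = π₁ᴿ , λ _ → unpairᴿ π₁ᴿ ↦π₁ (π₁-pair _ _)

opaque
  snd : Comp (σ ⊗ τ) τ proj₂
  snd = π₂ᴿ , λ _ → unpairᴿ π₂ᴿ ↦π₂ (π₂-pair _ _)

opaque
  π₁ᶜ : Comp nat nat π₁
  π₁ᶜ = π₁ᴿ , ↦π₁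

opaque
  π₂ᶜ : Comp nat nat π₂
  π₂ᶜ = π₂ᴿ , ↦π₂

numeral : ∀ {n} → ℕ → Rec n
numeral zero    = zer
numeral (suc k) = cmp inc (numeral k ∷ [])

↦numeral : ∀ {n} {xs : Vec ℕ n} k → numeral k ⟨ xs ⟩↦ k
↦numeral zero    = ↦zer
↦numeral (suc k) = ↦cmp (↦numeral k ∷ []) ↦inc

opaque
  const : ∀ (b : ⟦ τ ⟧) → Comp σ τ (λ _ → b)
  const {τ} b = numeral (enc τ b) , λ _ → ↦numeral (enc τ b)

opaque
  encᶜ : Comp τ nat (enc τ)
  encᶜ = prj 0F , λ _ → ↦prj 0F

opaque
  -- Every number is a code, so encoding the decoded value returns the input and the identity
  -- program suffices.
  decᶜ : Comp nat τ (dec τ)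
  decᶜ {τ} = prj 0F , λ n → subst (prj 0F ⟨ n ∷ [] ⟩↦_) (sym (enc-dec τ n)) (↦prj 0F)

opaque
  pairᶜ : Comp₂ nat nat nat pair
  pairᶜ = prj 0F , λ _ → ↦prj 0F

opaque
  sucᶜ : Comp nat nat suc
  sucᶜ = inc , λ _ → ↦inc

opaque
  binary : ∀ {f : ℕ → ℕ → ℕ} (r : Rec 2) → (∀ m n → r ⟨ m ∷ n ∷ [] ⟩↦ f m n) → Comp₂ nat nat nat f
  binary r ↦r = cmp r (π₁ᴿ ∷ π₂ᴿ ∷ []) ,
    λ (m , n) → ↦cmp (unpairᴿ π₁ᴿ ↦π₁ (π₁-pair m n) ∷ unpairᴿ π₂ᴿ ↦π₂ (π₂-pair m n) ∷ []) (↦r m n)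

opaque
  +ᶜ : Comp₂ nat nat nat _+_
  +ᶜ = binary addᴿ ↦add

opaque
  ∸ᶜ : Comp₂ nat nat nat _∸_
  ∸ᶜ = app₂ (binary monusᴿ (λ n m → ↦monus n m)) snd fst

natrec : ∀ {A : Set} → A → (ℕ → A → A) → ℕ → A
natrec b s zero    = b
natrec b s (suc k) = s k (natrec b s k)

opaque
  natrecᶜ : ∀ {b : ⟦ σ ⟧ → ⟦ τ ⟧} {s : ⟦ σ ⟧ → ℕ → ⟦ τ ⟧ → ⟦ τ ⟧} {n : ⟦ σ ⟧ → ℕ} →
    Comp σ τ b →
    Comp (σ ⊗ nat ⊗ τ) τ (λ q → s (proj₁ (proj₁ q)) (proj₂ (proj₁ q)) (proj₂ q)) →
    Comp σ nat n → Comp σ τ (λ a → natrec (b a) (s a) (n a))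
  natrecᶜ {σ} {τ} {b} {s} {n} (rᵇ , okᵇ) (rˢ , okˢ) (rⁿ , okⁿ) =
    cmp loop (rⁿ ∷ prj 0F ∷ []) , λ a → ↦cmp (okⁿ a ∷ ↦prj 0F ∷ []) (↦loop a (n a))
    where
    loop : Rec 2
    loop = rec rᵇ (cmp rˢ (cmp pairᴿ (cmp pairᴿ (prj 2F ∷ prj 0F ∷ []) ∷ prj 1F ∷ []) ∷ []))
    ↦loop : ∀ a k → loop ⟨ k ∷ enc σ a ∷ [] ⟩↦ enc τ (natrec (b a) (s a) k)
    ↦loop a zero    = ↦rec-zero (okᵇ a)
    ↦loop a (suc k) = ↦rec-suc (↦loop a k) (↦cmp
      (↦cmp (↦cmp (↦prj 2F ∷ ↦prj 0F ∷ []) (↦pair _ _) ∷ ↦prj 1F ∷ []) (↦pair _ _) ∷ [])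
      (okˢ ((a , k) , natrec (b a) (s a) k)))

iterate : ∀ {A : Set} → (A → A) → ℕ → A → A
iterate f n a = natrec a (λ _ → f) n

iterate-suc : ∀ {A : Set} (f : A → A) n a → iterate f (suc n) a ≡ iterate f n (f a)
iterate-suc f zero    a = refl
iterate-suc f (suc n) a = cong f (iterate-suc f n a)

-- The second program runs only when the flag is 1, so it may rely on the case distinction.
branch : Rec 1 → Rec 1 → Rec 1 → Rec 1
branch flag z s = cmp (rec z (cmp s (prj 2F ∷ []))) (flag ∷ prj 0F ∷ [])

↦branch₀ : ∀ {flag z s x v} → flag ⟨ x ∷ [] ⟩↦ 0 → z ⟨ x ∷ [] ⟩↦ v →
           branch flag z s ⟨ x ∷ [] ⟩↦ v
↦branch₀ f z = ↦cmp (f ∷ ↦prj 0F ∷ []) (↦rec-zero z)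

↦branch₁ : ∀ {flag z s x v w} → flag ⟨ x ∷ [] ⟩↦ 1 → z ⟨ x ∷ [] ⟩↦ v → s ⟨ x ∷ [] ⟩↦ w →
           branch flag z s ⟨ x ∷ [] ⟩↦ w
↦branch₁ f z s = ↦cmp (f ∷ ↦prj 0F ∷ []) (↦rec-suc (↦rec-zero z) (↦cmp (↦prj 2F ∷ []) s))

signᴿ : Rec 1
signᴿ = rec zer oneᴿ

↦sign-suc : ∀ n → signᴿ ⟨ suc n ∷ [] ⟩↦ 1
↦sign-zero : signᴿ ⟨ 0 ∷ [] ⟩↦ 0
↦sign-zero = ↦rec-zero ↦zer
↦sign-suc zero    = ↦rec-suc ↦sign-zero ↦one
↦sign-suc (suc n) = ↦rec-suc (↦sign-suc n) ↦one

caseList : ∀ {A B : Set} → B → (A → List A → B) → List A → B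
caseList n c []       = n
caseList n c (x ∷ xs) = c x xs

opaque
  caseListᶜ : ∀ {n : ⟦ σ ⟧ → ⟦ τ ⟧} {c : ⟦ σ ⟧ → ⟦ υ ⟧ → List ⟦ υ ⟧ → ⟦ τ ⟧} {xs : ⟦ σ ⟧ → List ⟦ υ ⟧} →
    Comp σ τ n →
    Comp (σ ⊗ υ ⊗ list υ) τ (λ q → c (proj₁ (proj₁ q)) (proj₂ (proj₁ q)) (proj₂ q)) →
    Comp σ (list υ) xs → Comp σ τ (λ a → caseList (n a) (c a) (xs a))
  caseListᶜ {σ} {τ} {υ} {n} {c} {xs} (rⁿ , okⁿ) (rᶜ , okᶜ) (r , ok) =
    prog , ↦case
    where
    part : Rec 1 → Rec 1
    part π = cmp π (cmp predᴿ (r ∷ []) ∷ [])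
    prog : Rec 1
    prog = branch (cmp signᴿ (r ∷ [])) rⁿ
      (cmp rᶜ (cmp pairᴿ (cmp pairᴿ (prj 0F ∷ part π₁ᴿ ∷ []) ∷ part π₂ᴿ ∷ []) ∷ []))
    ↦case : ∀ a → prog ⟨ enc σ a ∷ [] ⟩↦ enc τ (caseList (n a) (c a) (xs a))
    ↦case a with xs a | ok a
    ... | []     | ↦xs = ↦branch₀ (↦cmp (↦xs ∷ []) ↦sign-zero) (okⁿ a)
    ... | y ∷ ys | ↦xs = ↦branch₁ (↦cmp (↦xs ∷ []) (↦sign-suc _)) (okⁿ a) (↦cmp
      (↦cmp (↦cmp (↦prj 0F ∷ ↦cmp (↦cmp (↦xs ∷ []) (↦pred _) ∷ []) (unpairᴿ π₁ᴿ ↦π₁ (π₁-pair _ _)) ∷ [])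
                  (↦pair _ _) ∷
             ↦cmp (↦cmp (↦xs ∷ []) (↦pred _) ∷ []) (unpairᴿ π₂ᴿ ↦π₂ (π₂-pair _ _)) ∷ [])
            (↦pair _ _) ∷ [])
      (okᶜ ((a , y) , ys)))

nil : Comp σ (list τ) (λ _ → [])
nil = const []

opaque
  consᶜ : Comp₂ τ (list τ) (list τ) _∷_
  consᶜ = inc , λ _ → ↦inc

length≤encs : ∀ τ xs → length xs ≤ encs τ xs
length≤encs τ []       = z≤n
length≤encs τ (x ∷ xs) = s≤s (≤-trans (length≤encs τ xs) (n≤pair _ _))

foldlStep : ∀ {A B : Set} → (B → A → B) → B × List A → B × List A
foldlStep f (b , xs) = caseList (b , []) (λ x r → f b x , r) xs

-- Steps on the empty list are idle, so any bound on the length, such as the code of the list, may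
-- serve as the number of iterations.
iterate-foldlStep : ∀ {A B : Set} (f : B → A → B) n b xs → length xs ≤ n →
                    iterate (foldlStep f) n (b , xs) ≡ (foldl f b xs , [])
iterate-foldlStep f zero    b []       _         = refl
iterate-foldlStep f (suc n) b []       _         =
  trans (iterate-suc (foldlStep f) n (b , [])) (iterate-foldlStep f n b [] z≤n)
iterate-foldlStep f (suc n) b (x ∷ xs) (s≤s l≤n) =
  trans (iterate-suc (foldlStep f) n (b , x ∷ xs)) (iterate-foldlStep f n (f b x) xs l≤n)

opaque
  foldlᶜ : ∀ {b : ⟦ σ ⟧ → ⟦ τ ⟧} {f : ⟦ σ ⟧ → ⟦ τ ⟧ → ⟦ υ ⟧ → ⟦ τ ⟧} {xs : ⟦ σ ⟧ → List ⟦ υ ⟧} →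
    Comp σ τ b →
    Comp (σ ⊗ τ ⊗ υ) τ (λ q → f (proj₁ (proj₁ q)) (proj₂ (proj₁ q)) (proj₂ q)) →
    Comp σ (list υ) xs → Comp σ τ (λ a → foldl (f a) (b a) (xs a))
  foldlᶜ {σ} {τ} {υ} {b} {f} {xs} bᶜ fᶜ xsᶜ = Comp-cong
    (λ a → cong proj₁ (iterate-foldlStep (f a) (encs υ (xs a)) (b a) (xs a) (length≤encs υ (xs a))))
    (app fst (natrecᶜ {s = λ a _ → foldlStep (f a)} (bᶜ ,ᶜ xsᶜ)
      (caseListᶜ {c = λ q x r → f (proj₁ (proj₁ q)) (proj₁ (proj₂ q)) x , r}
         (app fst snd ,ᶜ nil)
         (app fᶜ ((app fst (app fst (app fst fst)) ,ᶜ app fst (app snd (app fst fst))) ,ᶜ app snd fst) ,ᶜ snd)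
         (app snd snd))
      (app encᶜ xsᶜ)))

opaque
  reverseᶜ : Comp (list τ) (list τ) reverse
  reverseᶜ = foldlᶜ nil (app₂ consᶜ snd (app snd fst)) Comp-id

length-foldl : ∀ {A : Set} n (xs : List A) → foldl (λ k _ → suc k) n xs ≡ length xs + n
length-foldl n []       = refl
length-foldl n (x ∷ xs) = trans (length-foldl (suc n) xs) (+-suc (length xs) n)

opaque
  lengthᶜ : Comp (list τ) nat length
  lengthᶜ = Comp-cong (λ xs → trans (length-foldl 0 xs) (+-identityʳ (length xs)))
    (foldlᶜ (const 0) (app sucᶜ (app snd fst)) Comp-id)

opaque
  foldrᶜ : ∀ {b : ⟦ σ ⟧ → ⟦ τ ⟧} {f : ⟦ σ ⟧ → ⟦ υ ⟧ → ⟦ τ ⟧ → ⟦ τ ⟧} {xs : ⟦ σ ⟧ → List ⟦ υ ⟧} →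
    Comp σ τ b →
    Comp (σ ⊗ υ ⊗ τ) τ (λ q → f (proj₁ (proj₁ q)) (proj₂ (proj₁ q)) (proj₂ q)) →
    Comp σ (list υ) xs → Comp σ τ (λ a → foldr (f a) (b a) (xs a))
  foldrᶜ {b = b} {f} {xs} bᶜ fᶜ xsᶜ = Comp-cong
    (λ a → trans (sym (reverse-foldr (f a) (b a) (reverse (xs a))))
                 (cong (foldr (f a) (b a)) (reverse-involutive (xs a))))
    (foldlᶜ {f = λ a acc x → f a x acc} bᶜ
      (app fᶜ ((app fst fst ,ᶜ snd) ,ᶜ app snd fst)) (app reverseᶜ xsᶜ))

opaque
  *ᶜ : Comp₂ nat nat nat _*_
  *ᶜ = Comp-cong (λ (m , n) → lemma m n)
    (natrecᶜ {s = λ q _ r → proj₂ q + r} (const 0) (app₂ +ᶜ (app snd (app fst fst)) snd) fst)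
    where
    lemma : ∀ m n → natrec 0 (λ _ r → n + r) m ≡ m * n
    lemma zero    n = refl
    lemma (suc m) n = cong (n +_) (lemma m n)

opaque
  2^ᶜ : Comp nat nat (2 ^_)
  2^ᶜ = Comp-cong lemma (natrecᶜ {s = λ _ _ r → 2 * r} (const 1) (app₂ *ᶜ (const 2) snd) Comp-id)
    where
    lemma : ∀ n → natrec 1 (λ _ r → 2 * r) n ≡ 2 ^ n
    lemma zero    = refl
    lemma (suc n) = cong (2 *_) (lemma n)

b2n : Bool → ℕ
b2n false = 0
b2n true  = 1

-- Computable decidable predicates

record Dc (σ : Ty) (P : ⟦ σ ⟧ → Set) : Set where
  constructor _,_
  field
    decide   : ∀ a → Dec (P a)
    computed : Comp σ nat (λ a → b2n (does (decide a)))

open Dc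

Dc-⇔ : ∀ {P Q : ⟦ σ ⟧ → Set} → (∀ a → P a → Q a) → (∀ a → Q a → P a) → Dc σ P → Dc σ Q
Dc-⇔ to from (d , c) = (λ a → map′ (to a) (from a) (d a)) , c

Dc-∘ : ∀ {P : ⟦ τ ⟧ → Set} {f : ⟦ σ ⟧ → ⟦ τ ⟧} → Dc τ P → Comp σ τ f → Dc σ (λ a → P (f a))
Dc-∘ {f = f} (d , c) fᶜ = (λ a → d (f a)) , app c fᶜ

-- Two decisions of one proposition have the same outcome, so the program for one computes the
-- other. Functions written with `_≟_` become computable this way.
redecide : ∀ {P : ⟦ σ ⟧ → Set} → Dc σ P → (∀ a → Dec (P a)) → Dc σ P
redecide (d , c) d′ = d′ , Comp-cong (λ a → cong b2n (does-unique (d a) (d′ a))) c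
  where
  does-unique : ∀ {A : Set} (x y : Dec A) → does x ≡ does y
  does-unique (yes _) (yes _) = refl
  does-unique (no  _) (no  _) = refl
  does-unique (yes a) (no ¬a) = contradiction a ¬a
  does-unique (no ¬a) (yes a) = contradiction a ¬a

≡0ᵈ : ∀ {f : ⟦ σ ⟧ → ℕ} → Comp σ nat f → Dc σ (λ a → f a ≡ 0)
≡0ᵈ {f = f} fᶜ = (λ a → f a ≟ 0) , Comp-cong (λ a → lemma (f a)) (app₂ ∸ᶜ (const 1) fᶜ)
  where
  lemma : ∀ n → 1 ∸ n ≡ b2n (does (n ≟ 0))
  lemma zero    = refl
  lemma (suc n) = 0∸n≡0 n

opaque
  ≤ᵈ : ∀ {f g : ⟦ σ ⟧ → ℕ} → Comp σ nat f → Comp σ nat g → Dc σ (λ a → f a ≤ g a)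
  ≤ᵈ fᶜ gᶜ = Dc-⇔ (λ _ → m∸n≡0⇒m≤n) (λ _ → m≤n⇒m∸n≡0) (≡0ᵈ (app₂ ∸ᶜ fᶜ gᶜ))

opaque
  ifᶜ : ∀ {P : ⟦ σ ⟧ → Set} {f g : ⟦ σ ⟧ → ⟦ τ ⟧} (P? : Dc σ P) → Comp σ τ f → Comp σ τ g →
        Comp σ τ (λ a → if does (decide P? a) then f a else g a)
  ifᶜ {f = f} {g} (d , c) fᶜ gᶜ = Comp-cong (λ a → lemma (does (d a)) (f a) (g a))
    (natrecᶜ {s = λ a _ _ → f a} gᶜ (app fᶜ (app fst fst)) c)
    where
    lemma : ∀ {A : Set} b (x y : A) → natrec y (λ _ _ → x) (b2n b) ≡ (if b then x else y)
    lemma true  x y = refl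
    lemma false x y = refl

infixr 3 _×ᵈ_
infixr 4 _→ᵈ_

opaque
  ¬ᵈ : ∀ {P : ⟦ σ ⟧ → Set} → Dc σ P → Dc σ (λ a → ¬ P a)
  ¬ᵈ P?@(d , c) = (λ a → ¬? (d a)) , Comp-cong (λ a → lemma (does (d a))) (app₂ ∸ᶜ (const 1) c)
    where
    lemma : ∀ b → 1 ∸ b2n b ≡ b2n (not b)
    lemma true  = refl
    lemma false = refl

opaque
  _×ᵈ_ : ∀ {P Q : ⟦ σ ⟧ → Set} → Dc σ P → Dc σ Q → Dc σ (λ a → P a × Q a)
  P?@(d , c) ×ᵈ (d′ , c′) = (λ a → d a ×-dec d′ a) ,
    Comp-cong (λ a → lemma (does (d a)) (does (d′ a))) (ifᶜ P? c′ (const 0))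
    where
    lemma : ∀ b b′ → (if b then b2n b′ else 0) ≡ b2n (b ∧ b′)
    lemma true  b′ = refl
    lemma false b′ = refl

opaque
  _→ᵈ_ : ∀ {P Q : ⟦ σ ⟧ → Set} → Dc σ P → Dc σ Q → Dc σ (λ a → P a → Q a)
  P? →ᵈ Q? = Dc-⇔ (λ a f p → decidable-stable (decide Q? a) (λ ¬q → f (p , ¬q)))
    (λ _ f (p , ¬q) → ¬q (f p)) (¬ᵈ (P? ×ᵈ ¬ᵈ Q?))

opaque
  _⊎ᵈ_ : ∀ {P Q : ⟦ σ ⟧ → Set} → Dc σ P → Dc σ Q → Dc σ (λ a → P a ⊎ Q a)
  P? ⊎ᵈ Q? = Dc-⇔
    (λ a f → case decide P? a of λ { (yes p) → inj₁ p ; (no ¬p) → inj₂ (f ¬p) })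
    (λ _ → λ { (inj₁ p) ¬p → contradiction p ¬p ; (inj₂ q) _ → q })
    (¬ᵈ P? →ᵈ Q?)

opaque
  ≡ᵈ : ∀ {f g : ⟦ σ ⟧ → ⟦ τ ⟧} → Comp σ τ f → Comp σ τ g → Dc σ (λ a → f a ≡ g a)
  ≡ᵈ {τ = τ} fᶜ gᶜ = Dc-⇔ (λ _ (p , q) → enc-injective τ (≤-antisym p q))
    (λ _ eq → ≤-reflexive (cong (enc τ) eq) , ≤-reflexive (cong (enc τ) (sym eq)))
    (≤ᵈ (app encᶜ fᶜ) (app encᶜ gᶜ) ×ᵈ ≤ᵈ (app encᶜ gᶜ) (app encᶜ fᶜ))

opaque
  Allᵈ : ∀ {P : ⟦ σ ⟧ → ⟦ τ ⟧ → Set} {xs : ⟦ σ ⟧ → List ⟦ τ ⟧} →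
    Dc (σ ⊗ τ) (λ q → P (proj₁ q) (proj₂ q)) → Comp σ (list τ) xs →
    Dc σ (λ a → All (P a) (xs a))
  Allᵈ {σ} {τ} {P} {xs} P?@(d , c) xsᶜ = (λ a → all? (λ x → d (a , x)) (xs a)) ,
    Comp-cong (λ a → lemma a (xs a)) (foldrᶜ {f = f} (const 1)
      (ifᶜ (Dc-∘ P? fst) snd (const 0)) xsᶜ)
    where
    f : ⟦ σ ⟧ → ⟦ τ ⟧ → ℕ → ℕ
    f a x r = if does (d (a , x)) then r else 0
    lemma : ∀ a ys → foldr (f a) 1 ys ≡ b2n (does (all? (λ x → d (a , x)) ys))
    lemma a []       = refl
    lemma a (y ∷ ys) with does (d (a , y))
    ... | true  = lemma a ys
    ... | false = refl

opaque
  Anyᵈ : ∀ {P : ⟦ σ ⟧ → ⟦ τ ⟧ → Set} {xs : ⟦ σ ⟧ → List ⟦ τ ⟧} →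
    Dc (σ ⊗ τ) (λ q → P (proj₁ q) (proj₂ q)) → Comp σ (list τ) xs →
    Dc σ (λ a → Any (P a) (xs a))
  Anyᵈ {xs = xs} P? xsᶜ = Dc-⇔
    (λ a ¬all → Any.map (λ {x} → decidable-stable (decide P? (a , x)))
      (¬All⇒Any¬ (λ x → ¬? (decide P? (a , x))) (xs a) ¬all))
    (λ a any all¬ → All¬⇒¬Any all¬ any)
    (¬ᵈ (Allᵈ (¬ᵈ P?) xsᶜ))

-- One step of prefix matching. A mismatch or an exhausted second list leads to `(x ∷ xs′ , [])`,
-- which is a fixed point; so the first list gets empty only if the match succeeds.
strip : ∀ {A : Set} → (∀ (x y : A) → Dec (x ≡ y)) → List A × List A → List A × List A
strip _≟ᴬ_ (xs , ys) = caseList ([] , ys)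
  (λ x xs′ → caseList (x ∷ xs′ , [])
    (λ y ys′ → if does (x ≟ᴬ y) then (xs′ , ys′) else (x ∷ xs′ , [])) ys) xs

module _ {A : Set} (_≟ᴬ_ : ∀ (x y : A) → Dec (x ≡ y)) where
  private
    strip-stuck : ∀ n (x : A) xs → proj₁ (iterate (strip _≟ᴬ_) n (x ∷ xs , [])) ≡ x ∷ xs
    strip-stuck zero    x xs = refl
    strip-stuck (suc n) x xs =
      trans (cong proj₁ (iterate-suc (strip _≟ᴬ_) n _)) (strip-stuck n x xs)

  strip⇒Prefix : ∀ xs ys → proj₁ (iterate (strip _≟ᴬ_) (length xs) (xs , ys)) ≡ [] →
                 Prefix _≡_ xs ys
  strip⇒Prefix []       ys _  = []
  strip⇒Prefix (x ∷ xs) ys eq with trans (cong proj₁ (sym (iterate-suc (strip _≟ᴬ_) (length xs) (x ∷ xs , ys)))) eq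
  strip⇒Prefix (x ∷ xs) []       eq | eq′ with () ← trans (sym (strip-stuck (length xs) x xs)) eq′
  strip⇒Prefix (x ∷ xs) (y ∷ ys) eq | eq′ with x ≟ᴬ y
  ... | yes x≡y = x≡y ∷ strip⇒Prefix xs ys eq′
  ... | no _ with () ← trans (sym (strip-stuck (length xs) x xs)) eq′

  Prefix⇒strip : ∀ {xs ys} → Prefix _≡_ xs ys →
                 proj₁ (iterate (strip _≟ᴬ_) (length xs) (xs , ys)) ≡ []
  Prefix⇒strip []                            = refl
  Prefix⇒strip (_∷_ {a = x} {as = xs} {ys} refl p) =
    trans (cong proj₁ (iterate-suc (strip _≟ᴬ_) (length xs) (x ∷ xs , x ∷ ys))) step
    where
    step : proj₁ (iterate (strip _≟ᴬ_) (length xs) (strip _≟ᴬ_ (x ∷ xs , x ∷ ys))) ≡ []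
    step with x ≟ᴬ x
    ... | yes _   = Prefix⇒strip p
    ... | no  x≢x = contradiction refl x≢x

opaque
  Prefixᵈ : ∀ {f g : ⟦ σ ⟧ → List ⟦ τ ⟧} → Comp σ (list τ) f → Comp σ (list τ) g →
            Dc σ (λ a → Prefix _≡_ (f a) (g a))
  Prefixᵈ {σ} {τ} {f} {g} fᶜ gᶜ = Dc-⇔ (λ a → strip⇒Prefix _≟ᵗ_ (f a) (g a)) (λ a → Prefix⇒strip _≟ᵗ_)
    (≡ᵈ {f = λ a → proj₁ (iterate (strip _≟ᵗ_) (length (f a)) (f a , g a))}
      (app fst (natrecᶜ {s = λ _ _ → strip _≟ᵗ_} (fᶜ ,ᶜ gᶜ) (app stripᶜ snd) (app lengthᶜ fᶜ)))
      nil)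
    where
    eqᵈ : Dc (τ ⊗ τ) (λ q → proj₁ q ≡ proj₂ q)
    eqᵈ = ≡ᵈ fst snd
    _≟ᵗ_ : (x y : ⟦ τ ⟧) → Dec (x ≡ y)
    x ≟ᵗ y = decide eqᵈ (x , y)
    stripᶜ : Comp (list τ ⊗ list τ) (list τ ⊗ list τ) (strip _≟ᵗ_)
    stripᶜ = caseListᶜ
      {c = λ (xs , ys) x xs′ → caseList (x ∷ xs′ , [])
        (λ y ys′ → if does (x ≟ᵗ y) then (xs′ , ys′) else (x ∷ xs′ , [])) ys}
      (nil ,ᶜ snd)
      (caseListᶜ {c = λ ((_ , x) , xs′) y ys′ → if does (x ≟ᵗ y) then (xs′ , ys′) else (x ∷ xs′ , [])}
        (app₂ consᶜ (app snd fst) snd ,ᶜ nil)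
        (ifᶜ (Dc-∘ eqᵈ (app snd (app fst (app fst fst)) ,ᶜ app snd fst))
          (app snd (app fst fst) ,ᶜ snd)
          (app₂ consᶜ (app snd (app fst (app fst fst))) (app snd (app fst fst)) ,ᶜ nil))
        (app snd (app fst fst)))
      fst

-- Strings

parity half : ℕ → ℕ
parity n = natrec 0 (λ _ r → 1 ∸ r) n
half n   = natrec 0 (λ k r → r + parity k) n

parity-2* : ∀ n b → parity (b2n b + 2 * n) ≡ b2n b
parity-2* n b = go b
  where
  even : ∀ n → parity (2 * n) ≡ 0
  even zero    = refl
  even (suc n) rewrite +-suc n (n + 0) = cong (λ p → 1 ∸ (1 ∸ p)) (even n)
  go : ∀ b → parity (b2n b + 2 * n) ≡ b2n b
  go false = even n
  go true  = cong (1 ∸_) (even n)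

half-2* : ∀ n b → half (b2n b + 2 * n) ≡ n
half-2* n b = go b
  where
  even : ∀ n → half (2 * n) ≡ n
  even zero    = refl
  even (suc n) rewrite +-suc n (n + 0) =
    trans (cong₂ (λ h p → h + p + (1 ∸ p)) (even n) (parity-2* n false))
          (trans (cong (_+ 1) (+-identityʳ n)) (+-comm n 1))
  go : ∀ b → half (b2n b + 2 * n) ≡ n
  go false = even n
  go true  = trans (cong₂ _+_ (even n) (parity-2* n false)) (+-identityʳ n)

opaque
  parityᶜ : Comp nat nat parity
  parityᶜ = natrecᶜ (const 0) (app₂ ∸ᶜ (const 1) snd) Comp-id

opaque
  halfᶜ : Comp nat nat half
  halfᶜ = natrecᶜ (const 0) (app₂ +ᶜ snd (app parityᶜ (app snd fst))) Comp-id

code-∷ : ∀ b s → code (b ∷ s) ≡ suc (b2n b + 2 * code s)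
code-∷ false s = refl
code-∷ true  s = refl

length≤code : ∀ s → length s ≤ code s
length≤code []      = z≤n
length≤code (b ∷ s) rewrite code-∷ b s =
  s≤s (≤-trans (≤-trans (length≤code s) (m≤m+n (code s) (code s + 0))) (m≤n+m _ (b2n b)))

-- The digits of bijective base 2 are 1 and 2, so the first bit of a nonzero code `c` is the parity
-- of `c - 1`, and the rest of the string has the half as its code.
digitsStep : List ℕ × ℕ → List ℕ × ℕ
digitsStep (ds , c) = if does (c ≟ 0) then (ds , c) else (parity (pred c) ∷ ds , half (pred c))

digitsStep-code : ∀ n ds s → length s ≤ n →
                  iterate digitsStep n (ds , code s) ≡ (reverse (map b2n s) ++ ds , 0)
digitsStep-code zero    ds []      _ = refl
digitsStep-code (suc n) ds []      _ =
  trans (iterate-suc digitsStep n (ds , 0)) (digitsStep-code n ds [] z≤n)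
digitsStep-code (suc n) ds (b ∷ s) (s≤s l≤n) = begin
  iterate digitsStep (suc n) (ds , code (b ∷ s))     ≡⟨ iterate-suc digitsStep n _ ⟩
  iterate digitsStep n (digitsStep (ds , code (b ∷ s))) ≡⟨ cong (iterate digitsStep n ∘ digitsStep ∘ (ds ,_)) (code-∷ b s) ⟩
  iterate digitsStep n (parity (b2n b + 2 * code s) ∷ ds , half (b2n b + 2 * code s))
    ≡⟨ cong₂ (λ p h → iterate digitsStep n (p ∷ ds , h)) (parity-2* (code s) b) (half-2* (code s) b) ⟩
  iterate digitsStep n (b2n b ∷ ds , code s)         ≡⟨ digitsStep-code n (b2n b ∷ ds) s l≤n ⟩
  (reverse (map b2n s) ++ b2n b ∷ ds , 0)            ≡⟨ cong (_, 0) (++-assoc (reverse (map b2n s)) (b2n b ∷ []) ds) ⟨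
  ((reverse (map b2n s) ++ b2n b ∷ []) ++ ds , 0)    ≡⟨ cong (λ r → r ++ ds , 0) (unfold-reverse (b2n b) (map b2n s)) ⟨
  (reverse (b2n b ∷ map b2n s) ++ ds , 0)            ∎
  where open ≡-Reasoning

opaque
  predᶜ : Comp nat nat pred
  predᶜ = predᴿ , ↦pred

opaque
  digitsᶜ : Comp str (list nat) (map b2n)
  digitsᶜ = Comp-cong
    (λ s → trans (cong (reverse ∘ proj₁) (digitsStep-code (code s) [] s (length≤code s)))
      (trans (cong reverse (++-identityʳ (reverse (map b2n s)))) (reverse-involutive (map b2n s))))
    (app reverseᶜ (app fst (natrecᶜ {s = λ _ _ → digitsStep} (nil ,ᶜ encᶜ)
      (ifᶜ (≡0ᵈ (app snd snd)) snd
        (app₂ consᶜ (app parityᶜ (app predᶜ (app snd snd))) (app fst snd) ,ᶜ app halfᶜ (app predᶜ (app snd snd))))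
      encᶜ)))

opaque
  strLengthᶜ : Comp str nat length
  strLengthᶜ = Comp-cong (length-map b2n) (app lengthᶜ digitsᶜ)

b2n-injective : ∀ {a b} → b2n a ≡ b2n b → a ≡ b
b2n-injective {false} {false} _ = refl
b2n-injective {true}  {true}  _ = refl

opaque
  strPrefixᵈ : ∀ {f g : ⟦ σ ⟧ → String} → Comp σ str f → Comp σ str g →
               Dc σ (λ a → Prefix _≡_ (f a) (g a))
  strPrefixᵈ fᶜ gᶜ = Dc-⇔ (λ _ → unmap _ _) (λ _ → map⁺) (Prefixᵈ (app digitsᶜ fᶜ) (app digitsᶜ gᶜ))
    where
    unmap : ∀ s t → Prefix _≡_ (map b2n s) (map b2n t) → Prefix _≡_ s t
    unmap []      t       []       = []
    unmap (_ ∷ s) (_ ∷ t) (eq ∷ p) = b2n-injective eq ∷ unmap s t p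
    map⁺ : ∀ {s t} → Prefix _≡_ s t → Prefix _≡_ (map b2n s) (map b2n t)
    map⁺ []         = []
    map⁺ (refl ∷ p) = refl ∷ map⁺ p

opaque
  str-∷ᶜ : ∀ b → Comp str str (b ∷_)
  str-∷ᶜ b with app sucᶜ (app₂ +ᶜ (const (b2n b)) (app₂ *ᶜ (const 2) (encᶜ {τ = str})))
  ... | r , ok = r , λ s → subst (r ⟨ code s ∷ [] ⟩↦_) (sym (code-∷ b s)) (ok s)

-- A prefix code for lists of numbers.
block : ℕ → String → String
block j s = replicate j false ++ true ∷ s

blocks : List ℕ → String
blocks = foldr block []

opaque
  blocksᶜ : Comp (list nat) str blocks
  blocksᶜ = foldrᶜ {f = λ _ → block} (const []) (Comp-cong (λ (( _ , j) , s) → lemma j s)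
    (natrecᶜ {s = λ _ _ → false ∷_} (app (str-∷ᶜ true) snd) (app (str-∷ᶜ false) snd) (app snd fst))) Comp-id
    where
    lemma : ∀ j s → natrec (true ∷ s) (λ _ → false ∷_) j ≡ block j s
    lemma zero    s = refl
    lemma (suc j) s = cong (false ∷_) (lemma j s)

-- Two blocks at the beginning of the same `s` end at the same `true`, hence are equal and can be
-- removed. Comparability thus passes from binary strings to the nodes of an infinitely branching
-- tree.
blocks-comparable : ∀ v w {s} → Prefix _≡_ (blocks v) s → Prefix _≡_ (blocks w) s →
                    length v ≤ length w → Prefix _≡_ v w
blocks-comparable []      w       _ _ _         = []
blocks-comparable (i ∷ v) (j ∷ w) p q (s≤s v≤w) = go i j p q
  where
  go : ∀ k l {s} → Prefix _≡_ (block k (blocks v)) s → Prefix _≡_ (block l (blocks w)) s →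
       Prefix _≡_ (k ∷ v) (l ∷ w)
  go zero    zero    (_ ∷ p)    (_ ∷ q)  = refl ∷ blocks-comparable v w p q v≤w
  go zero    (suc l) (refl ∷ _) (() ∷ _)
  go (suc k) zero    (refl ∷ _) (() ∷ _)
  go (suc k) (suc l) (_ ∷ p)    (_ ∷ q)  with go k l p q
  ... | refl ∷ r = refl ∷ r

blocks-mono : ∀ {v w} → Prefix _≡_ v w → Prefix _≡_ (blocks v) (blocks w)
blocks-mono []                 = []
blocks-mono (_∷_ {a = j} refl p) = go j
  where
  go : ∀ k → Prefix _≡_ (block k _) (block k _)
  go zero    = refl ∷ blocks-mono p
  go (suc k) = refl ∷ go k

-- Programs of several arguments and unbounded search

args₃ : ∀ {f : ℕ → String → String → ℕ} → Comp (nat ⊗ str ⊗ str) nat (λ ((s , x) , y) → f s x y) →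
        ∃ λ (r : Rec 3) → ∀ s x y → r ⟨ s ∷ code x ∷ code y ∷ [] ⟩↦ f s x y
args₃ (r , ok) = cmp r (cmp pairᴿ (cmp pairᴿ (prj 0F ∷ prj 1F ∷ []) ∷ prj 2F ∷ []) ∷ []) ,
  λ s x y → ↦cmp (↦cmp (↦cmp (↦prj 0F ∷ ↦prj 1F ∷ []) (↦pair _ _) ∷ ↦prj 2F ∷ []) (↦pair _ _) ∷ []) (ok ((s , x) , y))

-- Minimisation has to exhibit positive values below its result, so the scan goes upwards from 0 and
-- records them; `k` only guarantees that it ends.
search : ∀ {n} {f : Rec (1 + n)} {xs : Vec ℕ n} {g : ℕ → ℕ} → (∀ i → f ⟨ i ∷ xs ⟩↦ g i) →
         ∀ k → g k ≡ 0 → ∃ λ v → min f ⟨ xs ⟩↦ v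
search {f = f} {xs} {g} ↦g k gk≡0 = go k 0 (λ _ ()) (trans (cong g (+-identityʳ k)) gk≡0)
  where
  go : ∀ j i → (∀ l → l < i → ∃ λ v → f ⟨ l ∷ xs ⟩↦ suc v) → g (j + i) ≡ 0 → ∃ λ v → min f ⟨ xs ⟩↦ v
  go j i below eq with g i in gi
  ... | zero  = i , ↦min (subst (f ⟨ i ∷ xs ⟩↦_) gi (↦g i)) below
  go zero    i below eq | suc v with () ← trans (sym gi) eq
  go (suc j) i below eq | suc v = go j (suc i) below′ (trans (cong g (+-suc j i)) eq)
    where
    below′ : ∀ l → l < suc i → ∃ λ v → f ⟨ l ∷ xs ⟩↦ suc v
    below′ l l<1+i with l ≟ i
    ... | yes refl = v , subst (f ⟨ i ∷ xs ⟩↦_) gi (↦g i)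
    ... | no  l≢i  = below l (≤∧≢⇒< (s≤s⁻¹ l<1+i) l≢i)

-- The search for a witness `t` of the decidable relation is a partial function with the required
-- domain.
dc-enumerable : ∀ {Q : ℕ → String → String → String → Set} →
  Dc (nat ⊗ str ⊗ str ⊗ str) (λ (((t , p) , x) , y) → Q t p x y) →
  ComputablyEnumerable (λ p x y → ∃ λ t → Q t p x y)
dc-enumerable {Q} (Q? , r , ok) = min f , λ p x y → mk⇔
  (λ (t , q) → search (↦f p x y) t (χ≡0 q))
  (λ { (t , ↦min e _) → t , χ≡0⁻ (deterministic (↦f p x y t) e) })
  where
  χ : Bool → ℕ
  χ b = 1 ∸ b2n b
  χ≡0 : ∀ {t p x y} → Q t p x y → χ (does (Q? (((t , p) , x) , y))) ≡ 0
  χ≡0 {t} {p} {x} {y} q with Q? (((t , p) , x) , y)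
  ... | yes _ = refl
  ... | no ¬q = contradiction q ¬q
  χ≡0⁻ : ∀ {t p x y} → χ (does (Q? (((t , p) , x) , y))) ≡ 0 → Q t p x y
  χ≡0⁻ {t} {p} {x} {y} eq with Q? (((t , p) , x) , y)
  ... | yes q = q
  ... | no _ with () ← eq
  tuple : Rec 4
  tuple = cmp pairᴿ (cmp pairᴿ (cmp pairᴿ (prj 0F ∷ prj 1F ∷ []) ∷ prj 2F ∷ []) ∷ prj 3F ∷ [])
  f : Rec 4
  f = cmp monusᴿ (cmp r (tuple ∷ []) ∷ oneᴿ ∷ [])
  ↦f : ∀ p x y t → f ⟨ t ∷ code p ∷ code x ∷ code y ∷ [] ⟩↦ χ (does (Q? (((t , p) , x) , y)))
  ↦f p x y t = ↦cmp (↦cmp (↦cmp (↦cmp (↦cmp (↦prj 0F ∷ ↦prj 1F ∷ []) (↦pair _ _) ∷ ↦prj 2F ∷ [])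
    (↦pair _ _) ∷ ↦prj 3F ∷ []) (↦pair _ _) ∷ []) (ok (((t , p) , x) , y)) ∷ ↦one ∷ []) (↦monus _ _)

-- A universal machine

-- A state is a stack of instructions and a value; an instruction pairs a tag with an argument.
State : Ty
State = list nat ⊗ nat

-- Tags 0, 1, 2, 3, 7 and 9 stand for the constructors of Rec, tags 0 and 4 for those of vectors
-- of programs; the tags 5, 6, 8 and 10 are the continuations that these push.
exec : ℕ → ℕ → List ℕ → ℕ → ⟦ State ⟧
exec t a k v =
  if does (t ≟ 0) then (k , 0) else
  if does (t ≟ 1) then (k , suc (π₁ v)) else
  if does (t ≟ 2) then (k , π₁ (iterate π₂ a v)) else
  if does (t ≟ 3) then (π₂ a ∷ π₁ a ∷ k , v) else
  if does (t ≟ 4) then (π₁ a ∷ pair 5 (pair (π₂ a) v) ∷ k , v) else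
  if does (t ≟ 5) then (π₁ a ∷ pair 6 v ∷ k , π₂ a) else
  if does (t ≟ 6) then (k , pair a v) else
  if does (t ≟ 7) then
    (if does (π₁ v ≟ 0) then (π₁ a ∷ k , π₂ v)
     else (pair 7 a ∷ pair 8 (pair (π₂ a) (pair (pred (π₁ v)) (π₂ v))) ∷ k ,
           pair (pred (π₁ v)) (π₂ v))) else
  if does (t ≟ 8) then (π₁ a ∷ k , pair (π₁ (π₂ a)) (pair v (π₂ (π₂ a)))) else
  if does (t ≟ 9) then (a ∷ pair 10 (pair a (pair 0 v)) ∷ k , pair 0 v) else
  -- Tag 10 receives a value of the minimised function: on 0 the stored argument is the result,
  -- otherwise the next argument is tried.
  (if does (v ≟ 0) then (k , π₁ (π₂ a))
   else (π₁ a ∷ pair 10 (pair (π₁ a) (pair (suc (π₁ (π₂ a))) (π₂ (π₂ a)))) ∷ k ,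
         pair (suc (π₁ (π₂ a))) (π₂ (π₂ a))))

step : ⟦ State ⟧ → ⟦ State ⟧
step (k , v) = caseList ([] , v) (λ c k′ → exec (π₁ c) (π₂ c) k′ v) k

opaque
  stepᶜ : Comp State State step
  stepᶜ = caseListᶜ {c = λ (_ , v) c k → exec (π₁ c) (π₂ c) k v} (nil ,ᶜ snd)
    (tag 0 (k ,ᶜ const 0)
    (tag 1 (k ,ᶜ app sucᶜ (fstᵃ v))
    (tag 2 (k ,ᶜ fstᵃ (natrecᶜ {s = λ _ _ → π₂} v (sndᵃ snd) a))
    (tag 3 (sndᵃ a ∷ᶜ fstᵃ a ∷ᶜ k ,ᶜ v)
    (tag 4 (fstᵃ a ∷ᶜ pr (const 5) (pr (sndᵃ a) v) ∷ᶜ k ,ᶜ v)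
    (tag 5 (fstᵃ a ∷ᶜ pr (const 6) v ∷ᶜ k ,ᶜ sndᵃ a)
    (tag 6 (k ,ᶜ pr a v)
    (tag 7 (ifᶜ (≡0ᵈ (fstᵃ v)) (fstᵃ a ∷ᶜ k ,ᶜ sndᵃ v)
      (pr (const 7) a ∷ᶜ pr (const 8) (pr (sndᵃ a) v⁻) ∷ᶜ k ,ᶜ v⁻))
    (tag 8 (fstᵃ a ∷ᶜ k ,ᶜ pr (fstᵃ (sndᵃ a)) (pr v (sndᵃ (sndᵃ a))))
    (tag 9 (a ∷ᶜ pr (const 10) (pr a (pr (const 0) v)) ∷ᶜ k ,ᶜ pr (const 0) v)
    (ifᶜ (≡0ᵈ v) (k ,ᶜ fstᵃ (sndᵃ a))
      (fstᵃ a ∷ᶜ pr (const 10) (pr (fstᵃ a) a⁺) ∷ᶜ k ,ᶜ a⁺)))))))))))) fst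
    where
    infixr 5 _∷ᶜ_
    Env : Ty
    Env = State ⊗ nat ⊗ list nat
    fstᵃ : ∀ {σ} {f : ⟦ σ ⟧ → ℕ} → Comp σ nat f → Comp σ nat (λ q → π₁ (f q))
    fstᵃ = app π₁ᶜ
    sndᵃ : ∀ {σ} {f : ⟦ σ ⟧ → ℕ} → Comp σ nat f → Comp σ nat (λ q → π₂ (f q))
    sndᵃ = app π₂ᶜ
    pr : ∀ {f g : ⟦ Env ⟧ → ℕ} → Comp Env nat f → Comp Env nat g → Comp Env nat (λ q → pair (f q) (g q))
    pr = app₂ pairᶜ
    _∷ᶜ_ : ∀ {f : ⟦ Env ⟧ → ℕ} {g} → Comp Env nat f → Comp Env (list nat) g →
           Comp Env (list nat) (λ q → f q ∷ g q)
    _∷ᶜ_ = app₂ consᶜ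
    k : Comp Env (list nat) proj₂
    k = snd
    v : Comp Env nat (λ q → proj₂ (proj₁ (proj₁ q)))
    v = app snd (app fst fst)
    t : Comp Env nat (λ q → π₁ (proj₂ (proj₁ q)))
    t = fstᵃ (app snd fst)
    a : Comp Env nat (λ q → π₂ (proj₂ (proj₁ q)))
    a = sndᵃ (app snd fst)
    v⁻ : Comp Env nat (λ q → pair (pred (π₁ (proj₂ (proj₁ (proj₁ q))))) (π₂ (proj₂ (proj₁ (proj₁ q)))))
    v⁻ = pr (app predᶜ (fstᵃ v)) (sndᵃ v)
    a⁺ : Comp Env nat (λ q → let i,xs = π₂ (π₂ (proj₂ (proj₁ q))) in pair (suc (π₁ i,xs)) (π₂ i,xs))
    a⁺ = pr (app sucᶜ (fstᵃ (sndᵃ a))) (sndᵃ (sndᵃ a))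
    tag : ∀ n {f g : ⟦ Env ⟧ → ⟦ State ⟧} → Comp Env State f → Comp Env State g →
          Comp Env State (λ q → if does (π₁ (proj₂ (proj₁ q)) ≟ n) then f q else g q)
    tag n = ifᶜ (redecide (≡ᵈ {τ = nat} t (const n)) (λ q → π₁ (proj₂ (proj₁ q)) ≟ n))

⌜_⌝  : ∀ {n} → Rec n → ℕ
⌜_⌝* : ∀ {m n} → Vec (Rec n) m → ℕ
⌜ zer ⌝      = pair 0 0
⌜ inc ⌝      = pair 1 0
⌜ prj i ⌝    = pair 2 (toℕ i)
⌜ cmp f gs ⌝ = pair 3 (pair ⌜ f ⌝ ⌜ gs ⌝*)
⌜ rec g h ⌝  = pair 7 (pair ⌜ g ⌝ ⌜ h ⌝)
⌜ min f ⌝    = pair 9 ⌜ f ⌝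
⌜ [] ⌝*      = pair 0 0
⌜ g ∷ gs ⌝*  = pair 4 (pair ⌜ g ⌝ ⌜ gs ⌝*)

encVec : ∀ {n} → Vec ℕ n → ℕ
encVec []       = 0
encVec (x ∷ xs) = pair x (encVec xs)

searching : ∀ {n} → Rec (suc n) → ℕ → Vec ℕ n → ℕ
searching f i xs = pair 10 (pair ⌜ f ⌝ (pair i (encVec xs)))

step-instr : ∀ t a k v → step (pair t a ∷ k , v) ≡ exec t a k v
step-instr t a k v = cong₂ (λ t a → exec t a k v) (π₁-pair t a) (π₂-pair t a)

step-zer : ∀ a k v → step (pair 0 a ∷ k , v) ≡ (k , 0)
step-zer a k v = step-instr 0 a k v

step-inc : ∀ a k x v → step (pair 1 a ∷ k , pair x v) ≡ (k , suc x)
step-inc a k x v = trans (step-instr 1 a k (pair x v)) (cong (λ y → k , suc y) (π₁-pair x v))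

encVec-lookup : ∀ {n} (i : Fin n) xs → π₁ (iterate π₂ (toℕ i) (encVec xs)) ≡ Vec.lookup xs i
encVec-lookup Fin.zero    (x ∷ xs) = π₁-pair x (encVec xs)
encVec-lookup (Fin.suc i) (x ∷ xs) = trans
  (cong π₁ (trans (iterate-suc π₂ (toℕ i) (pair x (encVec xs)))
                  (cong (iterate π₂ (toℕ i)) (π₂-pair x (encVec xs)))))
  (encVec-lookup i xs)

step-prj : ∀ {n} (i : Fin n) k xs → step (pair 2 (toℕ i) ∷ k , encVec xs) ≡ (k , Vec.lookup xs i)
step-prj i k xs = trans (step-instr 2 (toℕ i) k (encVec xs)) (cong (k ,_) (encVec-lookup i xs))

step-cmp : ∀ f g k v → step (pair 3 (pair f g) ∷ k , v) ≡ (g ∷ f ∷ k , v)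
step-cmp f g k v = trans (step-instr 3 (pair f g) k v)
  (cong₂ (λ f g → g ∷ f ∷ k , v) (π₁-pair f g) (π₂-pair f g))

step-cons : ∀ g gs k v → step (pair 4 (pair g gs) ∷ k , v) ≡ (g ∷ pair 5 (pair gs v) ∷ k , v)
step-cons g gs k v = trans (step-instr 4 (pair g gs) k v)
  (cong₂ (λ g gs → g ∷ pair 5 (pair gs v) ∷ k , v) (π₁-pair g gs) (π₂-pair g gs))

step-rest : ∀ gs v k r → step (pair 5 (pair gs v) ∷ k , r) ≡ (gs ∷ pair 6 r ∷ k , v)
step-rest gs v k r = trans (step-instr 5 (pair gs v) k r)
  (cong₂ (λ gs v → gs ∷ pair 6 r ∷ k , v) (π₁-pair gs v) (π₂-pair gs v))

step-join : ∀ r k v → step (pair 6 r ∷ k , v) ≡ (k , pair r v)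
step-join r k v = step-instr 6 r k v

step-rec-zero : ∀ g h k v → step (pair 7 (pair g h) ∷ k , pair 0 v) ≡ (g ∷ k , v)
step-rec-zero g h k v rewrite step-instr 7 (pair g h) k (pair 0 v) | π₁-pair 0 v | π₂-pair 0 v | π₁-pair g h = refl

step-rec-suc : ∀ g h n k v → step (pair 7 (pair g h) ∷ k , pair (suc n) v) ≡
               (pair 7 (pair g h) ∷ pair 8 (pair h (pair n v)) ∷ k , pair n v)
step-rec-suc g h n k v
  rewrite step-instr 7 (pair g h) k (pair (suc n) v)
        | π₁-pair (suc n) v
        | π₂-pair (suc n) v
        | π₂-pair g h = refl

step-rec-step : ∀ h n v k r → step (pair 8 (pair h (pair n v)) ∷ k , r) ≡ (h ∷ k , pair n (pair r v))
step-rec-step h n v k r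
  rewrite step-instr 8 (pair h (pair n v)) k r
        | π₁-pair h (pair n v)
        | π₂-pair h (pair n v)
        | π₁-pair n v
        | π₂-pair n v = refl

step-min : ∀ {n} (f : Rec (suc n)) k xs →
           step (⌜ min f ⌝ ∷ k , encVec xs) ≡ (⌜ f ⌝ ∷ searching f 0 xs ∷ k , pair 0 (encVec xs))
step-min f k xs = step-instr 9 ⌜ f ⌝ k (encVec xs)

step-found : ∀ {n} (f : Rec (suc n)) i k xs → step (searching f i xs ∷ k , 0) ≡ (k , i)
step-found f i k xs
  rewrite step-instr 10 (pair ⌜ f ⌝ (pair i (encVec xs))) k 0
        | π₂-pair ⌜ f ⌝ (pair i (encVec xs))
        | π₁-pair i (encVec xs) = refl

step-next : ∀ {n} (f : Rec (suc n)) i k xs r → step (searching f i xs ∷ k , suc r) ≡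
            (⌜ f ⌝ ∷ searching f (suc i) xs ∷ k , pair (suc i) (encVec xs))
step-next f i k xs r
  rewrite step-instr 10 (pair ⌜ f ⌝ (pair i (encVec xs))) k (suc r)
        | π₁-pair ⌜ f ⌝ (pair i (encVec xs))
        | π₂-pair ⌜ f ⌝ (pair i (encVec xs))
        | π₁-pair i (encVec xs)
        | π₂-pair i (encVec xs) = refl

infix 4 _↠_

_↠_ : ⟦ State ⟧ → ⟦ State ⟧ → Set
s ↠ t = ∃ λ n → iterate step n s ≡ t

infixr 2 _⟶⟨_⟩_ _↠⟨_⟩_
infix 3 _⟶∎

_⟶⟨_⟩_ : ∀ s {t u} → step s ≡ t → t ↠ u → s ↠ u
s ⟶⟨ refl ⟩ (n , eq) = suc n , trans (iterate-suc step n s) eq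

_↠⟨_⟩_ : ∀ s {t u} → s ↠ t → t ↠ u → s ↠ u
s ↠⟨ n , refl ⟩ t↠u = go n t↠u
  where
  go : ∀ n {u} → iterate step n s ↠ u → s ↠ u
  go zero    t↠u = t↠u
  go (suc n) t↠u = go n (_ ⟶⟨ refl ⟩ t↠u)

_⟶∎ : ∀ s → s ↠ s
s ⟶∎ = 0 , refl

complete  : ∀ {n} {f : Rec n} {xs y} → f ⟨ xs ⟩↦ y → ∀ k → (⌜ f ⌝ ∷ k , encVec xs) ↠ (k , y)
complete* : ∀ {m n} {gs : Vec (Rec n) m} {xs ys} → Pointwise (λ g y → g ⟨ xs ⟩↦ y) gs ys →
            ∀ k → (⌜ gs ⌝* ∷ k , encVec xs) ↠ (k , encVec ys)
complete ↦zer k = _ ⟶⟨ step-zer _ k _ ⟩ _ ⟶∎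
complete ↦inc k = _ ⟶⟨ step-inc _ k _ _ ⟩ _ ⟶∎
complete (↦prj {xs = xs} i) k = _ ⟶⟨ step-prj i k xs ⟩ _ ⟶∎
complete {f = cmp f gs} (↦cmp d e) k =
  _ ⟶⟨ step-cmp ⌜ f ⌝ ⌜ gs ⌝* k _ ⟩ _ ↠⟨ complete* d (⌜ f ⌝ ∷ k) ⟩ complete e k
complete {f = rec g h} (↦rec-zero d) k = _ ⟶⟨ step-rec-zero ⌜ g ⌝ ⌜ h ⌝ k _ ⟩ complete d k
complete {f = rec g h} (↦rec-suc {xs = xs} d e) k =
  _ ⟶⟨ step-rec-suc ⌜ g ⌝ ⌜ h ⌝ _ k (encVec xs) ⟩
  _ ↠⟨ complete d (pair 8 (pair ⌜ h ⌝ (pair _ (encVec xs))) ∷ k) ⟩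
  _ ⟶⟨ step-rec-step ⌜ h ⌝ _ (encVec xs) k _ ⟩ complete e k
complete {f = min f} (↦min {xs = xs} {y = y} d below) k = _ ⟶⟨ step-min f k xs ⟩ from y 0 (+-identityʳ y)
  where
  from : ∀ j i → j + i ≡ y → (⌜ f ⌝ ∷ searching f i xs ∷ k , pair i (encVec xs)) ↠ (k , y)
  from zero    i refl = _ ↠⟨ complete d (searching f i xs ∷ k) ⟩ _ ⟶⟨ step-found f i k xs ⟩ _ ⟶∎
  from (suc j) i eq with below i (≤-trans (s≤s (m≤n+m i j)) (≤-reflexive eq))
  ... | v , e = _ ↠⟨ complete e (searching f i xs ∷ k) ⟩ _ ⟶⟨ step-next f i k xs v ⟩
                from j (suc i) (trans (+-suc j i) eq)
complete* [] k = _ ⟶⟨ step-zer _ k _ ⟩ _ ⟶∎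
complete* {gs = g ∷ gs} {xs = xs} (_∷_ {y = y} d ds) k =
  _ ⟶⟨ step-cons ⌜ g ⌝ ⌜ gs ⌝* k (encVec xs) ⟩
  _ ↠⟨ complete d (pair 5 (pair ⌜ gs ⌝* (encVec xs)) ∷ k) ⟩
  _ ⟶⟨ step-rest ⌜ gs ⌝* (encVec xs) k _ ⟩ _ ↠⟨ complete* ds (pair 6 y ∷ k) ⟩
  _ ⟶⟨ step-join y k _ ⟩ _ ⟶∎

record HaltsIn (n : ℕ) (s : ⟦ State ⟧) (w : ℕ) : Set where
  constructor halted
  field
    final : iterate step n s ≡ ([] , w)

halts-step : ∀ {n c k v s w} → step (c ∷ k , v) ≡ s → HaltsIn n (c ∷ k , v) w →
             ∃ λ m → n ≡ suc m × HaltsIn m s w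
halts-step {suc n} refl (halted eq) = n , refl , halted (trans (sym (iterate-suc step n _)) eq)

-- The continuation `k` is arbitrary, so that each subcomputation can be cut off the front of a
-- halting run. What remains is strictly shorter, which lets the recursion descend on `fuel`, a
-- bound for the number of steps.
sound  : ∀ {n} fuel (f : Rec n) xs k {l w} → l ≤ fuel → HaltsIn l (⌜ f ⌝ ∷ k , encVec xs) w →
         ∃ λ y → f ⟨ xs ⟩↦ y × ∃ λ m → m < l × HaltsIn m (k , y) w
sound* : ∀ {m n} fuel (gs : Vec (Rec n) m) xs k {l w} → l ≤ fuel →
         HaltsIn l (⌜ gs ⌝* ∷ k , encVec xs) w →
         ∃ λ (ys : Vec ℕ m) → Pointwise (λ g y → g ⟨ xs ⟩↦ y) gs ys × ∃ λ j → j < l × HaltsIn j (k , encVec ys) w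
sound-min : ∀ {n} fuel (f : Rec (suc n)) xs k i {l w} → l ≤ fuel →
            (∀ j → j < i → ∃ λ v → f ⟨ j ∷ xs ⟩↦ suc v) →
            HaltsIn l (⌜ f ⌝ ∷ searching f i xs ∷ k , pair i (encVec xs)) w →
            ∃ λ y → min f ⟨ xs ⟩↦ y × ∃ λ m → m < l × HaltsIn m (k , y) w

sound fuel zer xs k l≤ halts with halts-step (step-zer _ k _) halts
... | m , refl , halts₁ = _ , ↦zer , m , ≤-refl , halts₁
sound fuel inc (x ∷ []) k l≤ halts with halts-step (step-inc _ k x _) halts
... | m , refl , halts₁ = _ , ↦inc , m , ≤-refl , halts₁
sound fuel (prj i) xs k l≤ halts with halts-step (step-prj i k xs) halts
... | m , refl , halts₁ = _ , ↦prj i , m , ≤-refl , halts₁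
sound fuel (cmp f gs) xs k l≤ halts with halts-step (step-cmp ⌜ f ⌝ ⌜ gs ⌝* k _) halts
sound (suc fuel) (cmp f gs) xs k (s≤s l≤) halts | m , refl , halts₁
  with sound* fuel gs xs (⌜ f ⌝ ∷ k) l≤ halts₁
... | ys , ds , m₁ , m₁< , halts₂ with sound fuel f ys k (≤-trans (<⇒≤ m₁<) l≤) halts₂
... | y , d , m₂ , m₂< , halts₃ = y , ↦cmp ds d , m₂ , m<n⇒m<1+n (<-trans m₂< m₁<) , halts₃
sound fuel (rec g h) (zero ∷ xs) k l≤ halts with halts-step (step-rec-zero ⌜ g ⌝ ⌜ h ⌝ k _) halts
sound (suc fuel) (rec g h) (zero ∷ xs) k (s≤s l≤) halts | m , refl , halts₁
  with sound fuel g xs k l≤ halts₁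
... | y , d , m₁ , m₁< , halts₂ = y , ↦rec-zero d , m₁ , m<n⇒m<1+n m₁< , halts₂
sound fuel (rec g h) (suc x ∷ xs) k l≤ halts with halts-step (step-rec-suc ⌜ g ⌝ ⌜ h ⌝ x k (encVec xs)) halts
sound (suc fuel) (rec g h) (suc x ∷ xs) k (s≤s l≤) halts | m , refl , halts₁
  with sound fuel (rec g h) (x ∷ xs) _ l≤ halts₁
... | r , d , m₁ , m₁< , halts₂ with halts-step (step-rec-step ⌜ h ⌝ x (encVec xs) k r) halts₂
... | m₂ , refl , halts₃ with sound fuel h (x ∷ r ∷ xs) k (≤-trans (<⇒≤ (<⇒≤ m₁<)) l≤) halts₃
... | y , e , m₃ , m₃< , halts₄ = y , ↦rec-suc d e , m₃ , m<n⇒m<1+n (<-trans (m<n⇒m<1+n m₃<) m₁<) , halts₄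
sound fuel (min f) xs k l≤ halts with halts-step (step-min f k xs) halts
sound (suc fuel) (min f) xs k (s≤s l≤) halts | m , refl , halts₁
  with sound-min fuel f xs k 0 l≤ (λ _ ()) halts₁
... | y , d , m₁ , m₁< , halts₂ = y , d , m₁ , m<n⇒m<1+n m₁< , halts₂

sound* fuel [] xs k l≤ halts with halts-step (step-zer _ k _) halts
... | m , refl , halts₁ = [] , [] , m , ≤-refl , halts₁
sound* fuel (g ∷ gs) xs k l≤ halts with halts-step (step-cons ⌜ g ⌝ ⌜ gs ⌝* k (encVec xs)) halts
sound* (suc fuel) (g ∷ gs) xs k (s≤s l≤) halts | m , refl , halts₁
  with sound fuel g xs _ l≤ halts₁
... | y , d , m₁ , m₁< , halts₂ with halts-step (step-rest ⌜ gs ⌝* (encVec xs) k y) halts₂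
... | m₂ , refl , halts₃ with sound* fuel gs xs _ (≤-trans (<⇒≤ (<⇒≤ m₁<)) l≤) halts₃
... | ys , ds , m₃ , m₃< , halts₄ with halts-step (step-join y k (encVec ys)) halts₄
... | m₄ , refl , halts₅ = y ∷ ys , d ∷ ds , m₄ ,
  m<n⇒m<1+n (<-trans (m<n⇒m<1+n (<⇒≤ m₃<)) m₁<) , halts₅

sound-min fuel f xs k i l≤ below halts with sound fuel f (i ∷ xs) _ l≤ halts
... | zero , d , m , m< , halts₁ with halts-step (step-found f i k xs) halts₁
... | m₁ , refl , halts₂ = i , ↦min d below , m₁ , <⇒≤ m< , halts₂
sound-min zero f xs k i z≤n below halts | suc r , d , m , () , halts₁
sound-min (suc fuel) f xs k i l≤ below halts | suc r , d , m , m< , halts₁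
  with halts-step (step-next f i k xs r) halts₁
... | m₁ , refl , halts₂ with sound-min fuel f xs k (suc i) (≤-trans (<⇒≤ (n<1+n m₁)) (s≤s⁻¹ (≤-trans m< l≤))) below′ halts₂
  where
  below′ : ∀ j → j < suc i → ∃ λ v → f ⟨ j ∷ xs ⟩↦ suc v
  below′ j j<1+i with j ≟ i
  ... | yes refl = r , d
  ... | no j≢i = below j (≤∧≢⇒< (s≤s⁻¹ j<1+i) j≢i)
... | y , e , m₂ , m₂< , halts₃ = y , e , m₂ , <-trans m₂< (<⇒≤ m<) , halts₃

halts-stays : ∀ {m n s w} → m ≤ n → HaltsIn m s w → HaltsIn n s w
halts-stays {n = n} m≤n halts = go (≤⇒≤′ m≤n) halts
  where
  go : ∀ {m n s w} → m ≤′ n → HaltsIn m s w → HaltsIn n s w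
  go ≤′-refl       h = h
  -- A state with an empty stack is a fixed point of `step`.
  go (≤′-step m≤n) h = halted (cong step (HaltsIn.final (go m≤n h)))

run : ℕ → ℕ → ℕ → ⟦ State ⟧
run e a s = iterate step s (e ∷ [] , a)

opaque
  runᶜ : Comp (nat ⊗ nat ⊗ nat) State (λ ((e , a) , s) → run e a s)
  runᶜ = natrecᶜ {s = λ _ _ → step} (app₂ consᶜ (app fst fst) nil ,ᶜ app snd fst) (app stepᶜ snd) snd

run-complete : ∀ {n} {f : Rec n} {xs y} → f ⟨ xs ⟩↦ y →
               ∃ λ s → ∀ t → s ≤ t → run ⌜ f ⌝ (encVec xs) t ≡ ([] , y)
run-complete d with complete d []
... | s , eq = s , λ t s≤t → HaltsIn.final (halts-stays s≤t (halted eq))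

run-sound : ∀ {n} (f : Rec n) xs s → proj₁ (run ⌜ f ⌝ (encVec xs) s) ≡ [] → ∃ λ y → f ⟨ xs ⟩↦ y
run-sound f xs s eq with sound s f xs [] ≤-refl (halted (cong (_, proj₂ (run ⌜ f ⌝ (encVec xs) s)) eq))
... | y , d , _ = y , d

run-stays : ∀ e a {s t} → s ≤ t → proj₁ (run e a s) ≡ [] → run e a t ≡ run e a s
run-stays e a {s} s≤t eq = trans (HaltsIn.final (halts-stays s≤t (halted final))) (sym final)
  where
  final : run e a s ≡ ([] , proj₂ (run e a s))
  final = cong (_, proj₂ (run e a s)) eq

enc₃ : ℕ → String → String → ℕ
enc₃ n x y = encVec (n ∷ code x ∷ code y ∷ [])

enc₃ᶜ : ∀ {f : ⟦ σ ⟧ → ℕ} {g h : ⟦ σ ⟧ → String} → Comp σ nat f → Comp σ str g → Comp σ str h →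
        Comp σ nat (λ a → enc₃ (f a) (g a) (h a))
enc₃ᶜ f g h = app₂ pairᶜ f (app₂ pairᶜ (app encᶜ g) (app₂ pairᶜ (app encᶜ h) (const 0)))

-- Classical minima and counting

module _ (em : ExcludedMiddle 0ℓ) where

  least : ∀ (P : ℕ → Set) {n} → P n → ∃ λ m → P m × ∀ j → P j → m ≤ j
  least P {n} pn = go n n pn ≤-refl
    where
    go : ∀ fuel n → P n → n ≤ fuel → ∃ λ m → P m × ∀ j → P j → m ≤ j
    go fuel n pn n≤ with em {∃ λ j → P j × j < n}
    go fuel       n pn n≤ | no ¬p = n , pn , λ j pj → ≮⇒≥ λ j<n → ¬p (j , pj , j<n)
    go zero       _ pn z≤n | yes (j , pj , ())
    go (suc fuel) n pn n≤ | yes (j , pj , j<n) = go fuel j pj (s≤s⁻¹ (≤-trans j<n n≤))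

  -- The least upper bound satisfies `P`; otherwise its predecessor would be an upper bound as well.
  greatest : ∀ (P : ℕ → Set) b → (∀ n → P n → n ≤ b) → ∀ {n} → P n → ∃ λ m → P m × ∀ j → P j → j ≤ m
  greatest P b ≤b pn with least (λ k → ∀ n → P n → n ≤ k) ≤b
  ... | m , ≤m , m-least with em {P m}
  ... | yes pm = m , pm , ≤m
  ... | no ¬pm = contradiction (m-least (pred m) λ n pn → <⇒≤pred (≤∧≢⇒< (≤m n pn) λ { refl → ¬pm pn }))
                   (<⇒≱ (pred< (≤∧≢⇒< (≤m _ pn) λ { refl → ¬pm pn })))
    where
    pred< : ∀ {m n} → n < m → pred m < m
    pred< (s≤s _) = ≤-refl

AtMost : {A : Set} → ℕ → (A → Set) → Set
AtMost b P = ∀ xs → Unique xs → All P xs → length xs ≤ b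

unique-lookup : ∀ {A : Set} {xs : List A} → Unique xs → ∀ i j → lookup xs i ≡ lookup xs j → i ≡ j
unique-lookup {xs = _ ∷ _} u        Fin.zero    Fin.zero    _  = refl
unique-lookup {xs = _ ∷ _} (x∉ ∷ u) Fin.zero    (Fin.suc j) eq = contradiction eq (All.lookup x∉ (∈-lookup j))
unique-lookup {xs = _ ∷ _} (x∉ ∷ u) (Fin.suc i) Fin.zero    eq = contradiction (sym eq) (All.lookup x∉ (∈-lookup i))
unique-lookup {xs = _ ∷ _} (x∉ ∷ u) (Fin.suc i) (Fin.suc j) eq = cong Fin.suc (unique-lookup u i j eq)

-- A relation and not a function, since a string may have several indices, for instance several
-- descriptions; the pigeonhole principle only asks that an index determine its element.
atMost-index : ∀ {A : Set} {P : A → Set} {b} (R : A → ℕ → Set) →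
  (∀ {x} → P x → ∃ λ i → i < b × R x i) → (∀ {x x′ i} → R x i → R x′ i → x ≡ x′) → AtMost b P
atMost-index {P = P} {b} R index inj xs unique all = injective⇒≤ λ {i} {j} eq →
  unique-lookup unique i j (inj (R-ix i)
    (subst (R (lookup xs j)) (sym (fromℕ<-injective (ix i) (ix j) (ix< i) (ix< j) eq)) (R-ix j)))
  where
  P-lookup : (i : Fin (length xs)) → P (lookup xs i)
  P-lookup i = All.lookup all (∈-lookup i)
  ix : Fin (length xs) → ℕ
  ix i = proj₁ (index (P-lookup i))
  ix< : ∀ i → ix i < b
  ix< i = proj₁ (proj₂ (index (P-lookup i)))
  R-ix : ∀ i → R (lookup xs i) (ix i)
  R-ix i = proj₂ (proj₂ (index (P-lookup i)))

atMost-mono : ∀ {A : Set} {P Q : A → Set} {b c} → b ≤ c → (∀ {x} → P x → Q x) → AtMost b Q → AtMost c P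
atMost-mono b≤c P⇒Q most xs u all = ≤-trans (most xs u (All.map P⇒Q all)) b≤c

split-unique : ∀ {A : Set} {P Q : A → Set} {xs} → Unique xs → All (λ x → P x ⊎ Q x) xs →
  ∃ λ ys → ∃ λ zs → (Unique ys × All P ys) × (Unique zs × All Q zs) ×
    length ys + length zs ≡ length xs × (∀ {R : A → Set} → All R xs → All R ys × All R zs)
split-unique [] [] = [] , [] , ([] , []) , ([] , []) , refl , λ _ → [] , []
split-unique (x∉ ∷ u) (inj₁ p ∷ all) with split-unique u all
... | ys , zs , (uy , py) , (uz , pz) , len , sub =
  _ ∷ ys , zs , (proj₁ (sub x∉) ∷ uy , p ∷ py) , (uz , pz) , cong suc len ,
  λ { (r ∷ rs) → r ∷ proj₁ (sub rs) , proj₂ (sub rs) }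
split-unique (x∉ ∷ u) (inj₂ q ∷ all) with split-unique u all
... | ys , zs , (uy , py) , (uz , pz) , len , sub =
  ys , _ ∷ zs , (uy , py) , (proj₂ (sub x∉) ∷ uz , q ∷ pz) ,
  trans (+-suc (length ys) (length zs)) (cong suc len) ,
  λ { (r ∷ rs) → proj₁ (sub rs) , r ∷ proj₂ (sub rs) }

atMost-⊎ : ∀ {A : Set} {P Q : A → Set} {b c} → AtMost b P → AtMost c Q → AtMost (b + c) (λ x → P x ⊎ Q x)
atMost-⊎ {b = b} {c} P-most Q-most xs u all with split-unique u all
... | ys , zs , (uy , py) , (uz , pz) , len , _ =
  subst (_≤ b + c) len (+-mono-≤ (P-most ys uy py) (Q-most zs uz pz))

2+code≤ : ∀ s → 2 + code s ≤ 2 ^ suc (length s)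
2+code≤ []      = ≤-refl
2+code≤ (b ∷ s) = ≤-trans (bound b) (≤-trans (≤-reflexive eq) (*-monoʳ-≤ 2 (2+code≤ s)))
  where
  eq : 4 + 2 * code s ≡ 2 * (2 + code s)
  eq = sym (*-distribˡ-+ 2 2 (code s))
  bound : ∀ b → 2 + code (b ∷ s) ≤ 4 + 2 * code s
  bound false = n≤1+n _
  bound true  = ≤-refl

2^length≤ : ∀ s → 2 ^ length s ≤ suc (code s)
2^length≤ []      = ≤-refl
2^length≤ (b ∷ s) = ≤-trans (*-monoʳ-≤ 2 (2^length≤ s)) (≤-trans (≤-reflexive eq) (bound b))
  where
  eq : 2 * suc (code s) ≡ 2 + 2 * code s
  eq = *-distribˡ-+ 2 1 (code s)
  bound : ∀ b → 2 + 2 * code s ≤ suc (code (b ∷ s))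
  bound false = ≤-refl
  bound true  = n≤1+n _

-- `code` lists the strings in the order of their lengths, and 2 ^ k - 1 of them are shorter than
-- `k`.
short-code : ∀ {k} s → length s < k → code s < pred (2 ^ k)
short-code {k} s l<k = <⇒≤pred (≤-trans (2+code≤ s) (^-monoʳ-≤ 2 l<k))

prefix-refl : ∀ {A : Set} (xs : List A) → Prefix _≡_ xs xs
prefix-refl []       = []
prefix-refl (x ∷ xs) = refl ∷ prefix-refl xs

prefix-trans : ∀ {A : Set} {xs ys zs : List A} → Prefix _≡_ xs ys → Prefix _≡_ ys zs → Prefix _≡_ xs zs
prefix-trans []         q          = []
prefix-trans (refl ∷ p) (refl ∷ q) = refl ∷ prefix-trans p q

prefix-++ : ∀ {A : Set} (xs ys : List A) → Prefix _≡_ xs (xs ++ ys)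
prefix-++ []       ys = []
prefix-++ (x ∷ xs) ys = refl ∷ prefix-++ xs ys

prefix⁻ : ∀ {A : Set} {xs ys : List A} → Prefix _≡_ xs ys → ∃ λ zs → ys ≡ xs ++ zs
prefix⁻ {ys = ys} [] = ys , refl
prefix⁻ (refl ∷ p) with prefix⁻ p
... | zs , refl = zs , refl

prefix-comparable : ∀ {A : Set} {xs ys zs : List A} → Prefix _≡_ xs zs → Prefix _≡_ ys zs →
                    length xs ≤ length ys → Prefix _≡_ xs ys
prefix-comparable []         q          _         = []
prefix-comparable (refl ∷ p) (refl ∷ q) (s≤s len) = refl ∷ prefix-comparable p q len

module _ {K : String → String → ℕ} (K-mono : ∀ x y b → K x (y ∷ʳ b) ≤ K x y) where
  prefix-antitone : ∀ x {y z} → Prefix _≡_ y z → K x z ≤ K x y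
  prefix-antitone x {y} p with prefix⁻ p
  ... | zs , refl = go y zs
    where
    go : ∀ y zs → K x (y ++ zs) ≤ K x y
    go y []       = ≤-reflexive (cong (K x) (++-identityʳ y))
    go y (b ∷ zs) = subst (λ w → K x w ≤ K x y) (∷ʳ-++ y b zs) (≤-trans (go (y ∷ʳ b) zs) (K-mono x y b))

-- Upper semicomputable functions as minima

opaque
  ⊓ᶜ : Comp₂ nat nat nat _⊓_
  ⊓ᶜ = Comp-cong (λ (m , n) → lemma m n) (app₂ ∸ᶜ fst (app₂ ∸ᶜ fst snd))
    where
    lemma : ∀ m n → m ∸ (m ∸ n) ≡ m ⊓ n
    lemma m n with ≤-total m n
    ... | inj₁ m≤n rewrite m≤n⇒m∸n≡0 m≤n = sym (m≤n⇒m⊓n≡m m≤n)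
    ... | inj₂ n≤m = trans (m∸[m∸n]≡n n≤m) (sym (m≥n⇒m⊓n≡n n≤m))

IsMin : (ℕ → String → String → ℕ) → (String → String → ℕ) → Set
IsMin q K = ∀ x y → (∀ t → K x y ≤ q t x y) × ∃ λ t → q t x y ≡ K x y

-- The approximation is the running minimum of `q 0` to `q s`, which is constant from the stage at
-- which the minimum is attained.
min-upperSemicomputable : ∀ {q K} → Comp (nat ⊗ str ⊗ str) nat (λ ((t , x) , y) → q t x y) →
                          IsMin q K → UpperSemicomputable K
min-upperSemicomputable {q} {K} qᶜ isMin = record
  { approx     = approx
  ; program    = proj₁ prog
  ; computes   = proj₂ prog
  ; decreasing = λ s x y → m⊓n≤n (q (suc s) x y) (approx s x y)
  ; limit      = λ x y → proj₁ (proj₂ (isMin x y)) , λ s t≤s → ≤-antisym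
      (≤-trans (approx≤ x y t≤s) (≤-reflexive (proj₂ (proj₂ (isMin x y)))))
      (≤approx x y s)
  }
  where
  approx : ℕ → String → String → ℕ
  approx s x y = natrec (q 0 x y) (λ k r → q (suc k) x y ⊓ r) s
  prog : ∃ λ (r : Rec 3) → ∀ s x y → r ⟨ s ∷ code x ∷ code y ∷ [] ⟩↦ approx s x y
  prog = args₃ (natrecᶜ {s = λ ((_ , x) , y) k r → q (suc k) x y ⊓ r}
    (app qᶜ ((const 0 ,ᶜ app snd fst) ,ᶜ snd))
    (app₂ ⊓ᶜ (app qᶜ ((app sucᶜ (app snd fst) ,ᶜ app snd (app fst (app fst fst))) ,ᶜ app snd (app fst fst))) snd)
    (app fst fst))
  approx≤ : ∀ x y {t s} → t ≤ s → approx s x y ≤ q t x y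
  approx≤ x y {s = zero}  z≤n = ≤-refl
  approx≤ x y {t} {suc s} t≤ with t ≟ suc s
  ... | yes refl = m⊓n≤m _ _
  ... | no  t≢   = ≤-trans (m⊓n≤n (q (suc s) x y) _) (approx≤ x y (s≤s⁻¹ (≤∧≢⇒< t≤ t≢)))
  ≤approx : ∀ x y s → K x y ≤ approx s x y
  ≤approx x y zero    = proj₁ (isMin x y) 0
  ≤approx x y (suc s) = ⊓-glb (proj₁ (isMin x y) (suc s)) (≤approx x y s)

module _ {K} (usc : UpperSemicomputable K) where
  open UpperSemicomputable usc

  approx-antitone : ∀ x y {s t} → s ≤ t → approx t x y ≤ approx s x y
  approx-antitone x y s≤t = go (≤⇒≤′ s≤t)
    where
    go : ∀ {s t} → s ≤′ t → approx t x y ≤ approx s x y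
    go ≤′-refl             = ≤-refl
    go (≤′-step {n} s≤t) = ≤-trans (decreasing n x y) (go s≤t)

  K≤approx : ∀ s x y → K x y ≤ approx s x y
  K≤approx s x y with limit x y
  ... | N , eq = subst (_≤ approx s x y) (eq (N ⊔ s) (m≤m⊔n N s)) (approx-antitone x y (m≤n⊔m N s))

module _ (em : ExcludedMiddle 0ℓ) (q : ℕ → String → String → ℕ) where
  private
    minimum : ∀ x y → ∃ λ m → (∃ λ t → q t x y ≡ m) × ∀ j → (∃ λ t → q t x y ≡ j) → m ≤ j
    minimum x y = least em (λ m → ∃ λ t → q t x y ≡ m) (0 , refl)

  infimum : String → String → ℕ
  infimum x y = proj₁ (minimum x y)

  infimum-isMin : IsMin q infimum
  infimum-isMin x y = (λ t → proj₂ (proj₂ (minimum x y)) _ (t , refl)) , proj₁ (proj₂ (minimum x y))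

isMin-mono : ∀ {q K} → IsMin q K → (∀ t x y b → q t x (y ∷ʳ b) ≤ q t x y) →
             ∀ x y b → K x (y ∷ʳ b) ≤ K x y
isMin-mono isMin q-mono x y b with proj₂ (isMin x y)
... | t , eq = ≤-trans (proj₁ (isMin x (y ∷ʳ b)) t) (≤-trans (q-mono t x y b) (≤-reflexive eq))

prefix-∷ʳ : ∀ {A : Set} {xs ys : List A} {b} → Prefix _≡_ xs ys → Prefix _≡_ xs (ys ∷ʳ b)
prefix-∷ʳ p = prefix-trans p (prefix-++ _ _)

-- Enumeration processes: candidates arrive one at a time, each infinitely often, and are
-- accepted or rejected for good.

module Process (κ ε : Ty) (Ok : ⟦ κ ⟧ → ℕ → List ⟦ ε ⟧ → ⟦ ε ⟧ → Set)
  (ok : Dc (κ ⊗ nat ⊗ list ε ⊗ ε) (λ (((c , t) , es) , e) → Ok c t es e)) where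

  candidate : ℕ → ⟦ ε ⟧
  candidate t = dec ε (π₁ t)

  accept : ⟦ κ ⟧ → ℕ → List ⟦ ε ⟧ → List ⟦ ε ⟧
  accept c t es =
    if does (decide ok (((c , t) , es) , candidate t)) then candidate t ∷ es else es

  accepted : ⟦ κ ⟧ → ℕ → List ⟦ ε ⟧
  accepted c = natrec [] (accept c)

  opaque
    acceptedᶜ : Comp₂ κ nat (list ε) accepted
    acceptedᶜ = natrecᶜ {s = λ (c , _) → accept c} nil
      (ifᶜ (Dc-∘ ok (((app fst (app fst fst) ,ᶜ app snd fst) ,ᶜ snd) ,ᶜ cand))
        (app₂ consᶜ cand snd) snd)
      snd
      where
      cand : Comp (κ ⊗ nat ⊗ nat ⊗ list ε) ε (λ q → candidate (proj₂ (proj₁ q)))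
      cand = app decᶜ (app π₁ᶜ (app snd fst))

  accepted-suc : ∀ c t → accepted c (suc t) ≡ accepted c t ⊎
    Ok c t (accepted c t) (candidate t) × accepted c (suc t) ≡ candidate t ∷ accepted c t
  accepted-suc c t with decide ok (((c , t) , accepted c t) , candidate t)
  ... | yes o = inj₂ (o , refl)
  ... | no _  = inj₁ refl

  accepted-induction : ∀ c (Inv : ℕ → List ⟦ ε ⟧ → Set) → Inv 0 [] →
    (∀ t es → Inv t es → Inv (suc t) es) →
    (∀ t es e → Inv t es → Ok c t es e → Inv (suc t) (e ∷ es)) →
    ∀ t → Inv t (accepted c t)
  accepted-induction c Inv base skip extend zero    = base
  accepted-induction c Inv base skip extend (suc t)
    with accepted-suc c t | accepted-induction c Inv base skip extend t
  ... | inj₁ eq       | inv rewrite eq = skip t _ inv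
  ... | inj₂ (o , eq) | inv rewrite eq = extend t _ _ inv o

  accepted-mono : ∀ c {t u e} → t ≤ u → e ∈ accepted c t → e ∈ accepted c u
  accepted-mono c t≤u = go (≤⇒≤′ t≤u)
    where
    go : ∀ {t u e} → t ≤′ u → e ∈ accepted c t → e ∈ accepted c u
    go ≤′-refl e∈ = e∈
    go {e = e} (≤′-step {u} t≤u) e∈ with accepted-suc c u
    ... | inj₁ eq       = subst (e ∈_) (sym eq) (go t≤u e∈)
    ... | inj₂ (_ , eq) = subst (e ∈_) (sym eq) (there (go t≤u e∈))

  accepted-now : ∀ c t → Ok c t (accepted c t) (candidate t) → candidate t ∈ accepted c (suc t)
  accepted-now c t o with decide ok (((c , t) , accepted c t) , candidate t)
  ... | yes _ = here refl
  ... | no ¬o = contradiction o ¬o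

  -- The second component of the time t is idle, so every candidate returns arbitrarily late.
  eventually : ∀ c e T → (∀ t → T ≤ t → Ok c t (accepted c t) e) → ∃ λ t → e ∈ accepted c t
  eventually c e T always = suc t , subst (_∈ accepted c (suc t)) t↦e
    (accepted-now c t (subst (Ok c t (accepted c t)) (sym t↦e) (always t (n≤pair (enc ε e) T))))
    where
    t = pair (enc ε e) T
    t↦e : candidate t ≡ e
    t↦e = trans (cong (dec ε) (π₁-pair (enc ε e) T)) (dec-enc ε e)

-- Stages of a description mode; complexity belongs to the class

open DescriptionMode

module _ (D : DescriptionMode) where
  private
    f : Rec 3
    f = proj₁ (enumerable D)

  -- Decidable stages of the enumeration of `D`, which tests can consult in place of `Describes`.
  Seen : ℕ → String → String → String → Set
  Seen t p x y = proj₁ (run ⌜ f ⌝ (enc₃ (code p) x y) t) ≡ []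

  seenᵈ : ∀ {t : ⟦ σ ⟧ → ℕ} {p x y} → Comp σ nat t → Comp σ str p → Comp σ str x → Comp σ str y →
          Dc σ (λ a → Seen (t a) (p a) (x a) (y a))
  seenᵈ t p x y = ≡ᵈ (app fst (app runᶜ ((const ⌜ f ⌝ ,ᶜ enc₃ᶜ (app encᶜ p) x y) ,ᶜ t))) nil

  seen-sound : ∀ {t p x y} → Seen t p x y → Describes D p x y
  seen-sound {t} {p} {x} {y} seen = Equivalence.from (proj₂ (enumerable D) p x y) (run-sound f _ t seen)

  seen-complete : ∀ {p x y} → Describes D p x y → ∃ λ s → ∀ t → s ≤ t → Seen t p x y
  seen-complete {p} {x} {y} d with run-complete (proj₂ (Equivalence.to (proj₂ (enumerable D) p x y) d))
  ... | s , eq = s , λ t s≤t → cong proj₁ (eq t s≤t)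

module _ (D : DescriptionMode) (opt : Optimal D) where

  C-describes : ∀ x y → ∃ λ p → Describes D p y x × length p ≡ C D opt x y
  C-describes x y = proj₁ (C-isComplexity D opt x y)

  C-minimal : ∀ {p x y} → Describes D p y x → C D opt x y ≤ length p
  C-minimal {p} {x} {y} = proj₂ (C-isComplexity D opt x y) p

  -- `Optimal` compares shortest descriptions only. Excluded middle provides a shortest one in `D′`,
  -- and an arbitrary `p` is no shorter.
  optimal-bound : ExcludedMiddle 0ℓ → ∀ D′ → ∃ λ c → ∀ p x y → Describes D′ p y x → C D opt x y ≤ length p + c
  optimal-bound em D′ with opt D′
  ... | c , compare = c , bound
    where
    bound : ∀ p x y → Describes D′ p y x → C D opt x y ≤ length p + c
    bound p x y d with least em (λ m → ∃ λ p → Describes D′ p y x × length p ≡ m) (p , d , refl)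
    ... | m , shortest , m-least with compare x y m (shortest , λ p′ d′ → m-least _ (p′ , d′ , refl))
    ... | k , ((p₀ , d₀ , refl) , _) , k≤ =
      ≤-trans (C-minimal d₀) (≤-trans k≤ (+-monoˡ-≤ c (m-least _ (p , d , refl))))

  C∈𝒦 : ExcludedMiddle 0ℓ → 𝒦 (C D opt)
  C∈𝒦 em = record
    { upperSemicomputable = min-upperSemicomputable qᶜ isMin
    ; few      = few
    ; monotone = λ x y b → case C-describes x y of λ where
        (p , d , eq) → ≤-trans (C-minimal (extensible D d (prefix-++ y (b ∷ [])))) (≤-reflexive eq)
    }
    where
    -- Comparison with `copy` gives the bound `length x + c`, the estimate for as long as no
    -- description has been seen.
    c = proj₁ (optimal-bound em copy)

    seen : Dc (nat ⊗ str ⊗ str) (λ ((u , x) , y) → Seen D (π₂ u) (dec str (π₁ u)) y x)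
    seen = seenᵈ D (app π₂ᶜ u) (app decᶜ (app π₁ᶜ u)) snd (app snd fst)
      where
      u : Comp (nat ⊗ str ⊗ str) nat (λ q → proj₁ (proj₁ q))
      u = app fst fst

    -- The stage `u` encodes a possible description together with a time for its enumeration.
    q : ℕ → String → String → ℕ
    q u x y = if does (decide seen ((u , x) , y)) then length (dec str (π₁ u)) else length x + c

    qᶜ : Comp (nat ⊗ str ⊗ str) nat (λ ((u , x) , y) → q u x y)
    qᶜ = ifᶜ seen (app strLengthᶜ (app decᶜ (app π₁ᶜ (app fst fst))))
                  (app₂ +ᶜ (app strLengthᶜ (app snd fst)) (const c))

    isMin : IsMin q (C D opt)
    isMin x y = below , attained
      where
      below : ∀ u → C D opt x y ≤ q u x y
      below u with decide seen ((u , x) , y)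
      ... | yes s = C-minimal {dec str (π₁ u)} (seen-sound D {t = π₂ u} {dec str (π₁ u)} s)
      ... | no _  = proj₂ (optimal-bound em copy) x x y refl
      attained : ∃ λ u → q u x y ≡ C D opt x y
      attained with C-describes x y
      ... | p , d , eq with seen-complete D d
      ... | s , seen-at = u , q≡
        where
        u = pair (code p) s
        p≡ : dec str (π₁ u) ≡ p
        p≡ = trans (cong (dec str) (π₁-pair (code p) s)) (dec-enc str p)
        q≡ : q u x y ≡ C D opt x y
        q≡ with decide seen ((u , x) , y)
        ... | yes _ = trans (cong length p≡) eq
        ... | no ¬s = contradiction
          (subst (λ p → Seen D (π₂ u) p y x) (sym p≡) (seen-at (π₂ u) (≤-reflexive (sym (π₂-pair (code p) s))))) ¬s

    few : ∀ y n → AtMost (2 ^ n) (λ x → C D opt x y < n)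
    few y n = atMost-mono (pred[n]≤n) (λ lt → lt) (atMost-index {b = pred (2 ^ n)}
      (λ x i → ∃ λ p → Describes D p y x × code p ≡ i)
      (λ {x} lt → case C-describes x y of λ where
        (p , d , eq) → code p , short-code p (subst (_< n) (sym eq) lt) , p , d , refl)
      (λ { (p , d , eq) (p′ , d′ , eq′) → functional D d
           (subst (λ p → Describes D p y _) (code-injective p′ p (trans eq′ (sym eq))) d′) }))

-- Computable operations on lists and prefixes

module _ {f : ⟦ τ ⟧ → ⟦ υ ⟧} where
  opaque
    mapᶜ : ∀ {xs : ⟦ σ ⟧ → List ⟦ τ ⟧} → Comp τ υ f → Comp σ (list τ) xs →
           Comp σ (list υ) (λ a → map f (xs a))
    mapᶜ {xs = xs} fᶜ xsᶜ = Comp-cong (λ a → lemma (xs a))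
      (foldrᶜ {f = λ _ x r → f x ∷ r} nil (app₂ consᶜ (app fᶜ (app snd fst)) snd) xsᶜ)
      where
      lemma : ∀ ys → foldr (λ x r → f x ∷ r) [] ys ≡ map f ys
      lemma []       = refl
      lemma (y ∷ ys) = cong (f y ∷_) (lemma ys)

∈ᵈ : ∀ {x : ⟦ σ ⟧ → ⟦ τ ⟧} {xs} → Comp σ τ x → Comp σ (list τ) xs → Dc σ (λ a → x a ∈ xs a)
∈ᵈ xᶜ xsᶜ = Anyᵈ (≡ᵈ (app xᶜ fst) snd) xsᶜ

module _ {τ : Ty} where
  private
    _∈?_ : (x : ⟦ τ ⟧) (xs : List ⟦ τ ⟧) → Dec (x ∈ xs)
    x ∈? xs = decide (∈ᵈ {σ = τ ⊗ list τ} fst snd) (x , xs)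

    insert : ⟦ τ ⟧ → List ⟦ τ ⟧ → List ⟦ τ ⟧
    insert x xs = if does (x ∈? xs) then xs else x ∷ xs

  dedup : List ⟦ τ ⟧ → List ⟦ τ ⟧
  dedup = foldr insert []

  opaque
    dedupᶜ : Comp (list τ) (list τ) dedup
    dedupᶜ = foldrᶜ {f = λ _ → insert} nil
      (ifᶜ (Dc-∘ (∈ᵈ {σ = τ ⊗ list τ} fst snd) (app snd fst ,ᶜ snd)) snd (app₂ consᶜ (app snd fst) snd))
      Comp-id

  dedup-unique : ∀ xs → Unique (dedup xs)
  dedup-unique []       = []
  dedup-unique (x ∷ xs) with x ∈? dedup xs
  ... | yes _ = dedup-unique xs
  ... | no x∉ = All.tabulate (λ { y∈ refl → x∉ y∈ }) ∷ dedup-unique xs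

  ∈-dedup : ∀ {x} xs → x ∈ xs → x ∈ dedup xs
  ∈-dedup (y ∷ xs) x∈ with y ∈? dedup xs
  ∈-dedup (y ∷ xs) (here refl) | yes y∈ = y∈
  ∈-dedup (y ∷ xs) (there x∈)  | yes y∈ = ∈-dedup xs x∈
  ∈-dedup (y ∷ xs) (here refl) | no _   = here refl
  ∈-dedup (y ∷ xs) (there x∈)  | no _   = there (∈-dedup xs x∈)

  dedup-∈ : ∀ {x} xs → x ∈ dedup xs → x ∈ xs
  dedup-∈ (y ∷ xs) x∈ with y ∈? dedup xs
  dedup-∈ (y ∷ xs) x∈          | yes _ = there (dedup-∈ xs x∈)
  dedup-∈ (y ∷ xs) (here refl) | no _  = here refl
  dedup-∈ (y ∷ xs) (there x∈)  | no _  = there (dedup-∈ xs x∈)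

  private
    length-dedup : ∀ xs → length (dedup xs) ≤ length xs
    length-dedup []       = z≤n
    length-dedup (x ∷ xs) with x ∈? dedup xs
    ... | yes _ = m≤n⇒m≤1+n (length-dedup xs)
    ... | no _  = s≤s (length-dedup xs)

    full⇒unique : ∀ xs → length xs ≤ length (dedup xs) → Unique xs
    full⇒unique []       _ = []
    full⇒unique (x ∷ xs) l with x ∈? dedup xs
    ... | yes _ = contradiction (≤-trans l (length-dedup xs)) (<⇒≱ ≤-refl)
    ... | no x∉ = All.tabulate (λ { y∈ refl → x∉ (∈-dedup xs y∈) }) ∷ full⇒unique xs (s≤s⁻¹ l)

    unique⇒full : ∀ {xs} → Unique xs → length xs ≤ length (dedup xs)
    unique⇒full [] = z≤n
    unique⇒full {x ∷ xs} (x∉ ∷ u) with x ∈? dedup xs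
    ... | yes x∈ = contradiction refl (All.lookup x∉ (dedup-∈ xs x∈))
    ... | no _   = s≤s (unique⇒full u)

  opaque
    -- The test is whether removing repetitions keeps the length.
    uniqueᵈ : ∀ {xs : ⟦ σ ⟧ → List ⟦ τ ⟧} → Comp σ (list τ) xs → Dc σ (λ a → Unique (xs a))
    uniqueᵈ xsᶜ = Dc-⇔ (λ _ → full⇒unique _) (λ _ → unique⇒full)
      (≤ᵈ (app lengthᶜ xsᶜ) (app lengthᶜ (app dedupᶜ xsᶜ)))

prefixes : String → List String
prefixes []      = [] ∷ []
prefixes (b ∷ s) = [] ∷ map (b ∷_) (prefixes s)

∈-prefixes : ∀ {s t} → Prefix _≡_ s t → s ∈ prefixes t
∈-prefixes {t = []}    []         = here refl
∈-prefixes {t = _ ∷ _} []         = here refl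
∈-prefixes {t = b ∷ _} (refl ∷ p) = there (∈-map⁺ (b ∷_) (∈-prefixes p))

prefixes-∈ : ∀ {s} t → s ∈ prefixes t → Prefix _≡_ s t
prefixes-∈ []      (here refl) = []
prefixes-∈ (b ∷ t) (here refl) = []
prefixes-∈ (b ∷ t) (there s∈) with ∈-map⁻ (b ∷_) s∈
... | s , s∈′ , refl = refl ∷ prefixes-∈ t s∈′

opaque
  prefixesᶜ : Comp str (list str) prefixes
  prefixesᶜ = Comp-cong lemma (foldrᶜ {f = λ _ → extend} (const ([] ∷ []))
    (ifᶜ (≡0ᵈ (app snd fst)) (app₂ consᶜ (const []) (mapᶜ (str-∷ᶜ false) snd))
                             (app₂ consᶜ (const []) (mapᶜ (str-∷ᶜ true) snd)))
    digitsᶜ)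
    where
    extend : ℕ → List String → List String
    extend d ss = if does (d ≟ 0) then [] ∷ map (false ∷_) ss else [] ∷ map (true ∷_) ss
    lemma : ∀ s → foldr extend ([] ∷ []) (map b2n s) ≡ prefixes s
    lemma []          = refl
    lemma (false ∷ s) = cong (λ r → [] ∷ map (false ∷_) r) (lemma s)
    lemma (true ∷ s)  = cong (λ r → [] ∷ map (true ∷_) r) (lemma s)

opaque
  comp₃ : ∀ {f : ℕ → String → String → ℕ} (r : Rec 3) →
          (∀ s x y → r ⟨ s ∷ code x ∷ code y ∷ [] ⟩↦ f s x y) →
          Comp (nat ⊗ str ⊗ str) nat (λ ((s , x) , y) → f s x y)
  comp₃ r ok = cmp r (program π⁰ ∷ program π¹ ∷ program π² ∷ []) ,
    λ a@((s , x) , y) → ↦cmp (computes π⁰ a ∷ computes π¹ a ∷ computes π² a ∷ []) (ok s x y)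
    where
    π⁰ : Comp (nat ⊗ str ⊗ str) nat (λ q → proj₁ (proj₁ q))
    π⁰ = app fst fst
    π¹ : Comp (nat ⊗ str ⊗ str) str (λ q → proj₂ (proj₁ q))
    π¹ = app snd fst
    π² : Comp (nat ⊗ str ⊗ str) str proj₂
    π² = snd

approxᶜ : ∀ {K} (usc : UpperSemicomputable K) →
          Comp (nat ⊗ str ⊗ str) nat (λ ((s , x) , y) → UpperSemicomputable.approx usc s x y)
approxᶜ usc = comp₃ (UpperSemicomputable.program usc) (UpperSemicomputable.computes usc)

wk : ∀ {f : ⟦ σ ⟧ → ⟦ τ ⟧} → Comp σ τ f → Comp (σ ⊗ υ) τ (λ q → f (proj₁ q))
wk fᶜ = app fᶜ fst

-- Labels and their numbering

unique-map⁻ : ∀ {A B : Set} {f : A → B} {xs a b} → Unique (map f xs) → a ∈ xs → b ∈ xs → f a ≡ f b → a ≡ b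
unique-map⁻ (x∉ ∷ u) (here refl) (here refl) _  = refl
unique-map⁻ (x∉ ∷ u) (here refl) (there b∈)  eq = contradiction eq (All.lookup x∉ (∈-map⁺ _ b∈))
unique-map⁻ (x∉ ∷ u) (there a∈)  (here refl) eq = contradiction (sym eq) (All.lookup x∉ (∈-map⁺ _ a∈))
unique-map⁻ (x∉ ∷ u) (there a∈)  (there b∈)  eq = unique-map⁻ u a∈ b∈ eq

quotient-< : ∀ {B m m′ i} i′ → m < m′ → i < B → m * B + i < m′ * B + i′
quotient-< {B} {m} {m′} i′ m<m′ i<B = ≤-trans
  (≤-trans (+-monoʳ-< (m * B) i<B) (≤-reflexive (+-comm (m * B) B)))
  (≤-trans (*-monoˡ-≤ B m<m′) (m≤m+n (m′ * B) i′))

quotient-unique : ∀ {B m m′ i i′} → i < B → i′ < B → m * B + i ≡ m′ * B + i′ → m ≡ m′ × i ≡ i′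
quotient-unique {B} {m} {m′} {i} {i′} i<B i′<B eq with <-cmp m m′
... | tri≈ _ refl _ = refl , +-cancelˡ-≡ (m * B) i i′ eq
... | tri< m<m′ _ _ = contradiction eq (<⇒≢ (quotient-< i′ m<m′ i<B))
... | tri> _ _ m′<m = contradiction (sym eq) (<⇒≢ (quotient-< i m′<m i′<B))

label<2^ : ∀ {n i} → i < 2 ^ suc n → i < 2 ^ (2 + n)
label<2^ {n} i< = <-trans i< (^-monoʳ-< 2 ≤-refl {suc n} ≤-refl)

4*-square : ∀ n → 2 * (2 ^ (2 + n) * 2 ^ (2 + n)) ≡ 2 ^ (5 + 2 * n)
4*-square n = cong (2 *_) (trans (sym (^-distribˡ-+-* 2 (2 + n) (2 + n))) (cong (2 ^_) exponent))
  where
  exponent : (2 + n) + (2 + n) ≡ 4 + 2 * n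
  exponent = cong (2 +_) (trans (+-suc n (suc n)) (cong suc (trans (+-suc n n)
    (cong (λ k → suc (n + k)) (sym (+-identityʳ n))))))

length-dec : ∀ {k} l → k < 2 ^ l → length (dec str k) ≤ l
length-dec {k} l k<2^l = ≮⇒≥ λ long → <⇒≱ (≤-<-trans k<2^l (^-monoʳ-< 2 ≤-refl long))
  (≤-trans (2^length≤ (dec str k)) (≤-reflexive (cong suc (enc-dec str k))))

opaque
  -- A pair of labels; the summand B * B makes n recoverable.
  colour : ℕ → ℕ → ℕ → ℕ
  colour n m i = let B = 2 ^ (2 + n) in B * B + (m * B + i)

  colourᶜ : ∀ {n m i : ⟦ σ ⟧ → ℕ} → Comp σ nat n → Comp σ nat m → Comp σ nat i →
            Comp σ nat (λ a → colour (n a) (m a) (i a))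
  colourᶜ {σ} {n} n? m? i? = app₂ +ᶜ (app₂ *ᶜ B B) (app₂ +ᶜ (app₂ *ᶜ m? B) i?)
    where
    B : Comp σ nat (λ a → 2 ^ (2 + n a))
    B = app 2^ᶜ (app sucᶜ (app sucᶜ n?))

  -- `m` may be equal to 2 ^ (n + 1), hence the base 2 ^ (n + 2). Two digits in this base and the
  -- summand `B * B` stay below `2 * (B * B)`, which has the exponent 2 * (2 + n) + 1.
  colour-upper : ∀ {n m i} → m ≤ 2 ^ suc n → i < 2 ^ suc n → colour n m i < 2 ^ (5 + 2 * n)
  colour-upper {n} {m} {i} m≤ i< = subst (colour n m i <_) (4*-square n)
    (+-mono-≤-< {B * B} ≤-refl (subst (m * B + i <_) (sym (+-identityʳ (B * B)))
      (≤-trans (≤-trans (+-monoʳ-< (m * B) (label<2^ {n} i<)) (≤-reflexive (+-comm (m * B) B)))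
               (*-monoˡ-≤ B (≤-trans (s≤s m≤) (^-monoʳ-< 2 ≤-refl {suc n} ≤-refl))))))
    where
    B : ℕ
    B = 2 ^ (2 + n)

  -- The colours for `n` lie between `B * B` and `2 * (B * B)`. A greater `n` at least doubles `B`,
  -- so these ranges are disjoint.
  colour-< : ∀ {n n′ m i m′ i′} → m ≤ 2 ^ suc n → i < 2 ^ suc n → n < n′ → colour n m i < colour n′ m′ i′
  colour-< {n} {n′} {m} {i} m≤ i< n<n′ = <-≤-trans
    (subst (colour n m i <_) (sym (4*-square n)) (colour-upper {n} m≤ i<)) (≤-trans (≤-trans
    (≤-reflexive (sym (*-assoc 2 (2 ^ (2 + n)) (2 ^ (2 + n)))))
    (*-mono-≤ (^-monoʳ-≤ 2 (s≤s (s≤s n<n′))) (^-monoʳ-≤ 2 (s≤s (s≤s (<⇒≤ n<n′)))))) (m≤m+n _ _))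

  colour-injective : ∀ {n m i n′ m′ i′} → m ≤ 2 ^ suc n → i < 2 ^ suc n → m′ ≤ 2 ^ suc n′ → i′ < 2 ^ suc n′ →
                     colour n m i ≡ colour n′ m′ i′ → n ≡ n′ × m ≡ m′ × i ≡ i′
  colour-injective {n} {m} {i} {n′} {m′} {i′} m≤ i< m′≤ i′< eq with <-cmp n n′
  ... | tri≈ _ refl _ = refl , quotient-unique (label<2^ {n} i<) (label<2^ {n} i′<)
    (+-cancelˡ-≡ (2 ^ (2 + n) * 2 ^ (2 + n)) _ _ eq)
  ... | tri< n<n′ _ _ = contradiction eq (<⇒≢ (colour-< {n} {n′} {m} {i} {m′} {i′} m≤ i< n<n′))
  ... | tri> _ _ n′<n = contradiction (sym eq) (<⇒≢ (colour-< {n′} {n} {m′} {i′} {m} {i} m′≤ i′< n′<n))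

module _ (em : ExcludedMiddle 0ℓ) where

  fresh : ∀ {N} (is : List ℕ) → length is < N → ∃ λ i → i < N × ¬ i ∈ is
  fresh {N} is short with em {∃ λ i → i < N × ¬ i ∈ is}
  ... | yes f = f
  ... | no ¬f = contradiction (injective⇒≤ {f = λ i → Any.index (all i)} inj) (<⇒≱ short)
    where
    all : (i : Fin N) → toℕ i ∈ is
    all i with em {toℕ i ∈ is}
    ... | yes i∈ = i∈
    ... | no i∉  = contradiction (toℕ i , toℕ<n i , i∉) ¬f
    inj : ∀ {i j} → Any.index (all i) ≡ Any.index (all j) → i ≡ j
    inj {i} {j} eq = toℕ-injective
      (trans (lookup-index (all i)) (trans (cong (lookup is) eq) (sym (lookup-index (all j)))))

  -- A finite maximum of times; it replaces facts that each hold eventually by a single stage.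
  common : ∀ {A : Set} (P : A → ℕ → Set) → (∀ {a s t} → s ≤ t → P a s → P a t) →
           ∀ xs → All (λ a → ∃ (P a)) xs → ∃ λ t → All (λ a → P a t) xs
  common P mono []       []              = 0 , []
  common P mono (x ∷ xs) ((s , p) ∷ all) with common P mono xs all
  ... | t , ps = s ⊔ t , mono (m≤m⊔n s t) p ∷ All.map (mono (m≤n⊔m s t)) ps

  Labels : Set
  Labels = List (String × ℕ)

  -- Greedy choice: as long as fewer than `N` labels are in use, one is free.
  extend-labels : ∀ {N} (G : Labels) zs → Unique (map proj₁ G) → Unique (map proj₂ G) →
    All (λ g → proj₂ g < N) G → Unique zs → All (λ z → ¬ z ∈ map proj₁ G) zs →
    length G + length zs ≤ N →
    ∃ λ (G′ : Labels) → length G′ ≡ length G + length zs × Unique (map proj₁ G′) × Unique (map proj₂ G′) ×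
      All (λ g → proj₂ g < N) G′ × (∀ {g} → g ∈ G′ → g ∈ G ⊎ proj₁ g ∈ zs)
  extend-labels G [] u₁ u₂ G<N _ _ _ = G , sym (+-identityʳ (length G)) , u₁ , u₂ , G<N , inj₁
  extend-labels {N} G (z ∷ zs) u₁ u₂ G<N (z∉ ∷ uz) (z∉G ∷ zs∉G) len≤
    with fresh {N} (map proj₂ G) (≤-trans (s≤s (≤-reflexive (length-map proj₂ G)))
           (≤-trans (≤-trans (s≤s (m≤m+n (length G) (length zs))) (≤-reflexive (sym (+-suc (length G) (length zs))))) len≤))
  ... | i , i<N , i∉ with extend-labels ((z , i) ∷ G) zs
          (All.tabulate (λ { w∈ refl → z∉G w∈ }) ∷ u₁) (All.tabulate (λ { j∈ refl → i∉ j∈ }) ∷ u₂) (i<N ∷ G<N) uz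
          (All.tabulate λ { w∈ (here refl) → All.lookup z∉ w∈ refl
                          ; w∈ (there w∈G) → All.lookup zs∉G w∈ w∈G })
          (≤-trans (≤-reflexive (sym (+-suc (length G) (length zs)))) len≤)
  ... | G′ , len , u₁′ , u₂′ , G′<N , from =
    G′ , trans len (sym (+-suc (length G) (length zs))) , u₁′ , u₂′ , G′<N , λ g∈ → case from g∈ of λ where
      (inj₁ (here refl)) → inj₂ (here refl)
      (inj₁ (there g∈G)) → inj₁ g∈G
      (inj₂ g∈zs)        → inj₂ (there g∈zs)

-- Colouring the strings of bounded complexity

module Colouring (em : ExcludedMiddle 0ℓ) (K : String → String → ℕ) (K∈𝒦 : 𝒦 K) where
  open 𝒦 K∈𝒦
  open UpperSemicomputable upperSemicomputable using (approx; limit)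

  private
    label entry : Ty
    label = str ⊗ nat
    entry = str ⊗ list label

  Above : String → ⟦ entry ⟧ → Set
  Above y e = Prefix _≡_ y (proj₁ e)

  Has : List ⟦ entry ⟧ → String → String × ℕ → Set
  Has es y g = All (λ e → Above y e → g ∈ proj₂ e) es

  Covers : List ⟦ entry ⟧ → String → String → Set
  Covers es y x = All (λ e → Above y e → x ∈ map proj₁ (proj₂ e)) es

  -- An entry (z , G) labels m strings x with K x z ≤ n. Strings common to all entries above a
  -- prefix y of z keep their common label, and those already coloured at y must occur in G.
  Ok : ℕ × ℕ → ℕ → List ⟦ entry ⟧ → ⟦ entry ⟧ → Set
  Ok (n , m) t es (z , G) =
    length G ≡ m ×
    All (λ g → approx t (proj₁ g) z ≤ n × proj₂ g < 2 ^ suc n) G ×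
    Unique (map proj₁ G) × Unique (map proj₂ G) ×
    All (λ y → All (λ g → Covers es y (proj₁ g) → Has es y g) G) (prefixes z) ×
    All (λ y → All (λ e → Above y e →
      All (λ g → approx t (proj₁ g) y ≤ n → Has es y g → g ∈ G) (proj₂ e)) es) (prefixes z)

  private
    aboveᵈ : ∀ {y : ⟦ σ ⟧ → String} {e} → Comp σ str y → Comp σ entry e → Dc σ (λ a → Above (y a) (e a))
    aboveᵈ y e = strPrefixᵈ y (app fst e)

    hasᵈ : ∀ {es y g} → Comp σ (list entry) es → Comp σ str y → Comp σ label g →
           Dc σ (λ a → Has (es a) (y a) (g a))
    hasᵈ es y g = Allᵈ (aboveᵈ (wk y) snd →ᵈ ∈ᵈ (wk g) (app snd snd)) es

    coversᵈ : ∀ {es y x} → Comp σ (list entry) es → Comp σ str y → Comp σ str x →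
              Dc σ (λ a → Covers (es a) (y a) (x a))
    coversᵈ es y x = Allᵈ (aboveᵈ (wk y) snd →ᵈ ∈ᵈ (wk x) (mapᶜ fst (app snd snd))) es

    approx≤ᵈ : ∀ {t x y n} → Comp σ nat t → Comp σ str x → Comp σ str y → Comp σ nat n →
               Dc σ (λ a → approx (t a) (x a) (y a) ≤ n a)
    approx≤ᵈ t x y n = ≤ᵈ (app (approxᶜ upperSemicomputable) ((t ,ᶜ x) ,ᶜ y)) n

    Env : Ty
    Env = nat ⊗ nat ⊗ nat ⊗ list entry ⊗ entry

    opaque
      okᵈ : Dc Env (λ (((c , t) , es) , e) → Ok c t es e)
      okᵈ =
        ≡ᵈ (app lengthᶜ G) m ×ᵈ
        Allᵈ (approx≤ᵈ (wk t) (app fst snd) (wk z) (wk n) ×ᵈ ≤ᵈ (app sucᶜ (app snd snd)) (app 2^ᶜ (app sucᶜ (wk n)))) G ×ᵈ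
        uniqueᵈ (mapᶜ fst G) ×ᵈ uniqueᵈ (mapᶜ snd G) ×ᵈ
        Allᵈ (Allᵈ (coversᵈ (wk (wk es)) (wk snd) (app fst snd) →ᵈ hasᵈ (wk (wk es)) (wk snd) snd) (wk G))
             (app prefixesᶜ z) ×ᵈ
        Allᵈ (Allᵈ (aboveᵈ (wk snd) snd →ᵈ
          Allᵈ (approx≤ᵈ (wk (wk (wk t))) (app fst snd) (wk (wk snd)) (wk (wk (wk n))) →ᵈ
                hasᵈ (wk (wk (wk es))) (wk (wk snd)) snd →ᵈ ∈ᵈ snd (wk (wk (wk G))))
               (app snd snd)) (wk es))
             (app prefixesᶜ z)
        where
        n : Comp Env nat (λ q → proj₁ (proj₁ (proj₁ (proj₁ q))))
        n = app fst (app fst (app fst fst))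
        m : Comp Env nat (λ q → proj₂ (proj₁ (proj₁ (proj₁ q))))
        m = app snd (app fst (app fst fst))
        t : Comp Env nat (λ q → proj₂ (proj₁ (proj₁ q)))
        t = app snd (app fst fst)
        es : Comp Env (list entry) (λ q → proj₂ (proj₁ q))
        es = app snd fst
        z : Comp Env str (λ q → proj₁ (proj₂ q))
        z = app fst snd
        G : Comp Env (list label) (λ q → proj₂ (proj₂ q))
        G = app snd snd

  open Process (nat ⊗ nat) entry Ok okᵈ public

  -- `Has` is vacuous when no entry lies above `y`, hence the second condition. The first one makes
  -- the pair subject to the last clause of `Ok`.
  Coloured : ℕ × ℕ → ℕ → String → String × ℕ → Set
  Coloured c@(n , m) t y g =
    approx t (proj₁ g) y ≤ n × Any (Above y) (accepted c t) × Has (accepted c t) y g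

  private
    colouredᵈ : ∀ {c t y g} → Comp σ (nat ⊗ nat) c → Comp σ nat t → Comp σ str y → Comp σ label g →
                Dc σ (λ a → Coloured (c a) (t a) (y a) (g a))
    colouredᵈ c t y g = approx≤ᵈ t (app fst g) y (app fst c) ×ᵈ
      Anyᵈ (aboveᵈ (wk y) snd) (app₂ acceptedᶜ c t) ×ᵈ hasᵈ (app₂ acceptedᶜ c t) y g

  module _ (c : ℕ × ℕ) where
    private
      n = proj₁ c
      m = proj₂ c

    -- The last clause of `Ok` obliges a new entry above `y` to contain the coloured pair; it finds
    -- this pair in the old entry above `y`.
    coloured-suc : ∀ {t y g} → Coloured c t y g → Coloured c (suc t) y g
    coloured-suc {t} {y} {g} (≤n , above , has) with accepted-suc c t
    ... | inj₁ eq rewrite eq = ≤-trans (approx-antitone upperSemicomputable _ y (n≤1+n t)) ≤n , above , has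
    ... | inj₂ ((_ , _ , _ , _ , _ , inherit) , eq) rewrite eq =
      ≤-trans (approx-antitone upperSemicomputable _ y (n≤1+n t)) ≤n , there above , new ∷ has
      where
      new : Above y (candidate t) → g ∈ proj₂ (candidate t)
      new y⊑z with find above
      ... | e , e∈ , y⊑e = All.lookup (All.lookup (All.lookup inherit (∈-prefixes y⊑z)) e∈ y⊑e)
                             (All.lookup has e∈ y⊑e) ≤n has

    coloured-mono : ∀ {s t y g} → s ≤ t → Coloured c s y g → Coloured c t y g
    coloured-mono s≤t = go (≤⇒≤′ s≤t)
      where
      go : ∀ {s t y g} → s ≤′ t → Coloured c s y g → Coloured c t y g
      go ≤′-refl        col = col
      go (≤′-step s≤t) col = coloured-suc (go s≤t col)

    Sound : ⟦ entry ⟧ → Set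
    Sound (z , G) = length G ≡ m × All (λ g → K (proj₁ g) z ≤ n × proj₂ g < 2 ^ suc n) G ×
      Unique (map proj₁ G) × Unique (map proj₂ G)

    -- Turns membership in all entries above `y` into one label for all of them. A new entry
    -- preserves this by the fifth clause of `Ok`: it gives a string common to the old entries the
    -- label that they agree on.
    Coherent : List ⟦ entry ⟧ → Set
    Coherent es = ∀ y x → Any (Above y) es → Covers es y x → ∃ λ i → Has es y (x , i)

    opaque
      invariant : ∀ t → All Sound (accepted c t) × Coherent (accepted c t)
      invariant = accepted-induction c (λ _ es → All Sound es × Coherent es)
        ([] , λ y x ()) (λ _ _ inv → inv) extend
        where
        extend : ∀ t es e → All Sound es × Coherent es → Ok c t es e → All Sound (e ∷ es) × Coherent (e ∷ es)
        extend t es (z , G) (sound , coherent) (len , small , u₁ , u₂ , agree , _) =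
          (len , All.map (λ (a , b) → ≤-trans (K≤approx upperSemicomputable t _ z) a , b) small , u₁ , u₂) ∷ sound ,
          coherent′
          where
          coherent′ : Coherent ((z , G) ∷ es)
          coherent′ y x any (x∈ ∷ covers) with em {Prefix _≡_ y z}
          ... | yes y⊑z with ∈-map⁻ proj₁ (x∈ y⊑z)
          ... | (_ , i) , g∈ , refl =
            i , (λ _ → g∈) ∷ All.lookup (All.lookup agree (∈-prefixes y⊑z)) g∈ covers
          coherent′ y x (here y⊑z)  (x∈ ∷ covers) | no y⋢z = contradiction y⊑z y⋢z
          coherent′ y x (there any) (x∈ ∷ covers) | no y⋢z with coherent y x any covers
          ... | i , has = i , (λ y⊑z → contradiction y⊑z y⋢z) ∷ has

    sound-entry : ∀ {t e} → e ∈ accepted c t → Sound e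
    sound-entry {t} e∈ = All.lookup (proj₁ (invariant t)) e∈

    -- At a later time both pairs occur in an entry above `z`, which is above `y` too, and the
    -- labels within an entry are distinct.
    coloured-functional : ∀ {t y x w i} → Coloured c t y (x , i) → ∀ {s z} → Coloured c s z (w , i) →
                          Prefix _≡_ y z → x ≡ w
    coloured-functional {t} col {s} col′ y⊑z with coloured-mono (m≤m⊔n t s) col | coloured-mono (m≤n⊔m t s) col′
    ... | _ , _ , has | _ , above , has′ with find above
    ... | e , e∈ , z⊑e = cong proj₁ (unique-map⁻ (proj₂ (proj₂ (proj₂ (sound-entry {t ⊔ s} e∈))))
      (All.lookup has e∈ (prefix-trans y⊑z z⊑e)) (All.lookup has′ e∈ z⊑e) refl)

    coloured-label< : ∀ {t y g} → Coloured c t y g → proj₂ g < 2 ^ suc n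
    coloured-label< {t} (_ , above , has) with find above
    ... | e , e∈ , y⊑e = proj₂ (All.lookup (proj₁ (proj₂ (sound-entry {t} e∈))) (All.lookup has e∈ y⊑e))

    -- The labels that a new entry at z has to respect.
    Forced : List ⟦ entry ⟧ → String → String → ℕ → Set
    Forced es z u i = ∃ λ y → Prefix _≡_ y z × Any (Above y) es × Has es y (u , i)

    -- The two prefixes of `z` are comparable, and an entry above the longer one is above both.
    forced-entry : ∀ {es z u i w j} → Forced es z u i → Forced es z w j →
                   ∃ λ e → e ∈ es × (u , i) ∈ proj₂ e × (w , j) ∈ proj₂ e
    forced-entry (y , y⊑z , above , has) (y′ , y′⊑z , above′ , has′) with ≤-total (length y) (length y′)
    ... | inj₁ y≤y′ with find above′
    ... | e , e∈ , y′⊑e = e , e∈ ,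
      All.lookup has e∈ (prefix-trans (prefix-comparable y⊑z y′⊑z y≤y′) y′⊑e) , All.lookup has′ e∈ y′⊑e
    forced-entry (y , y⊑z , above , has) (y′ , y′⊑z , above′ , has′) | inj₂ y′≤y with find above
    ... | e , e∈ , y⊑e = e , e∈ ,
      All.lookup has e∈ y⊑e , All.lookup has′ e∈ (prefix-trans (prefix-comparable y′⊑z y⊑z y′≤y) y⊑e)

    module _ (t : ℕ) {z : String} where
      private
        Forcedₜ = Forced (accepted c t) z

      forced-injective : ∀ {u w i} → Forcedₜ u i → Forcedₜ w i → u ≡ w
      forced-injective f f′ with forced-entry f f′
      ... | e , e∈ , g∈ , h∈ = cong proj₁ (unique-map⁻ (proj₂ (proj₂ (proj₂ (sound-entry {t} e∈)))) g∈ h∈ refl)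

      forced-functional : ∀ {u i j} → Forcedₜ u i → Forcedₜ u j → i ≡ j
      forced-functional f f′ with forced-entry f f′
      ... | e , e∈ , g∈ , h∈ = cong proj₂ (unique-map⁻ (proj₁ (proj₂ (proj₂ (sound-entry {t} e∈)))) g∈ h∈ refl)

      forced-label< : ∀ {u i} → Forcedₜ u i → i < 2 ^ suc n
      forced-label< f with forced-entry f f
      ... | e , e∈ , g∈ , _ = proj₂ (All.lookup (proj₁ (proj₂ (sound-entry {t} e∈))) g∈)

      forced-unique : ∀ {G : Labels em} → All (λ g → Forcedₜ (proj₁ g) (proj₂ g)) G →
                      Unique (map proj₁ G) → Unique (map proj₂ G)
      forced-unique {[]}    []       []       = []
      forced-unique {g ∷ G} (f ∷ fs) (g∉ ∷ u) = All.tabulate differ ∷ forced-unique fs u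
        where
        differ : ∀ {j} → j ∈ map proj₂ G → proj₂ g ≢ j
        differ j∈ refl with ∈-map⁻ proj₂ j∈
        ... | h , h∈ , eq = All.lookup g∉ (∈-map⁺ proj₁ h∈)
          (forced-injective f (subst (Forcedₜ (proj₁ h)) (sym eq) (All.lookup fs h∈)))

      forced-labels : ∀ {us} → All (λ u → ∃ (Forcedₜ u)) us →
        ∃ λ (G : Labels em) → map proj₁ G ≡ us × All (λ g → Forcedₜ (proj₁ g) (proj₂ g)) G
      forced-labels []             = [] , refl , []
      forced-labels ((i , f) ∷ fs) with forced-labels fs
      ... | G , refl , all = (_ , i) ∷ G , refl , f ∷ all

    above-mono : ∀ {s t y} → s ≤ t → Any (Above y) (accepted c s) → Any (Above y) (accepted c t)
    above-mono s≤t any with find any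
    ... | e , e∈ , y⊑e = lose (accepted-mono c s≤t e∈) y⊑e

    -- `full` is the form in which the maximality of `m` is used: `m` strings with `K ≤ n` at a node
    -- above `y` leave none out. `U` shows that the size `m` is attained at `z`.
    module _ {y z : String} (y⊑z : Prefix _≡_ y z) {U : List String} (U-unique : Unique U)
      (U≤n : All (λ w → K w z ≤ n) U) (lenU : length U ≡ m) (m≤ : m ≤ 2 ^ suc n)
      (full : ∀ {ws w z′} → Prefix _≡_ y z′ → Unique ws → All (λ w → K w z′ ≤ n) ws → length ws ≡ m →
              K w z′ ≤ n → w ∈ ws) where
      private
        -- Used to choose `T` so late that no prefix of `z` gets its first entry above it
        -- afterwards. Labels forced later are then forced at `T` already, and a labelling fixed at
        -- `T` remains acceptable.
        First : String → ℕ → Set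
        First y′ t = (∃ λ s → Any (Above y′) (accepted c s)) → Any (Above y′) (accepted c t)

        opaque
          first : ∃ λ t → All (λ y′ → First y′ t) (prefixes z)
          first = common em First (λ s≤t f ex → above-mono s≤t (f ex)) (prefixes z) (All.tabulate λ {y′} _ → some y′)
            where
            some : ∀ y′ → ∃ (First y′)
            some y′ with em {∃ λ s → Any (Above y′) (accepted c s)}
            ... | yes (s , any) = s , λ _ → any
            ... | no ¬ex        = 0 , λ ex → contradiction ex ¬ex

        opaque
          settled : ∃ λ t → All (λ w → approx t w z ≤ n) U
          settled = common em (λ w t → approx t w z ≤ n)
            (λ s≤t ≤n → ≤-trans (approx-antitone upperSemicomputable _ z s≤t) ≤n) U
            (All.map (λ {w} ≤n → proj₁ (limit w z) , ≤-trans (≤-reflexive (proj₂ (limit w z) _ ≤-refl)) ≤n) U≤n)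

        T : ℕ
        T = proj₁ first ⊔ proj₁ settled

        ForcedT = Forced (accepted c T) z

        opaque
          -- Strings of `U` with a forced label keep it; forced labels of different strings differ
          -- because both occur in one entry. The other strings take free labels, and
          -- `m ≤ 2 ^ suc n` leaves enough of them.
          labelling : ∃ λ (G : Labels em) → length G ≡ m × Unique (map proj₁ G) × Unique (map proj₂ G) ×
            All (λ g → proj₂ g < 2 ^ suc n) G ×
            (∀ {g} → g ∈ G → proj₁ g ∈ U × (∀ {j} → ForcedT (proj₁ g) j → proj₂ g ≡ j))
          labelling with split-unique U-unique (All.tabulate {xs = U} λ {w} _ → choose w)
            where
            choose : ∀ w → ∃ (ForcedT w) ⊎ ¬ ∃ (ForcedT w)
            choose w with em {∃ (ForcedT w)}
            ... | yes f = inj₁ f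
            ... | no ¬f = inj₂ ¬f
          ... | ys , zs , (uy , fy) , (uz , ¬fz) , len , sub with forced-labels T fy
          ... | G₀ , refl , forced with extend-labels em G₀ zs uy (forced-unique T forced uy)
                (All.map (forced-label< T) forced) uz
                (All.tabulate λ z∈ z∈G → All.lookup ¬fz z∈ (All.lookup fy z∈G))
                (≤-trans (≤-reflexive total) m≤)
              where
              total : length G₀ + length zs ≡ m
              total = trans (cong (_+ length zs) (sym (length-map proj₁ G₀))) (trans len lenU)
          ... | G , lenG , u₁ , u₂ , G< , from = G ,
            trans lenG (trans (cong (_+ length zs) (sym (length-map proj₁ G₀))) (trans len lenU)) , u₁ , u₂ , G< ,
            λ g∈ → case from g∈ of λ where
              (inj₁ g∈₀) → All.lookup (proj₁ (sub (All.tabulate λ w∈ → w∈))) (∈-map⁺ proj₁ g∈₀) ,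
                           forced-functional T (All.lookup forced g∈₀)
              (inj₂ g∈z) → All.lookup (proj₂ (sub (All.tabulate λ w∈ → w∈))) g∈z ,
                           λ f → contradiction (_ , f) (All.lookup ¬fz g∈z)

        G = proj₁ labelling

        G-sound : ∀ {g} → g ∈ G → proj₁ g ∈ U × (∀ {j} → ForcedT (proj₁ g) j → proj₂ g ≡ j)
        G-sound = proj₂ (proj₂ (proj₂ (proj₂ (proj₂ labelling))))

        module _ {t} (T≤t : T ≤ t) where
          -- Coherence at time `t` gives a common label. It was common at `T` as well, when there
          -- were no more entries but already one above `y′`; so it was forced, and `G` respects it.
          agree : ∀ {y′ g} → Prefix _≡_ y′ z → g ∈ G → Covers (accepted c t) y′ (proj₁ g) →
                  Has (accepted c t) y′ g
          agree {y′} {x , i} y′⊑z g∈ covers with em {Any (Above y′) (accepted c t)}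
          ... | no ¬above = All.tabulate λ e∈ y′⊑e → contradiction (lose e∈ y′⊑e) ¬above
          ... | yes above with proj₂ (invariant t) y′ x above covers
          ... | i₁ , has = subst (λ i → Has (accepted c t) y′ (x , i)) (sym i≡i₁) has
            where
            aboveT : Any (Above y′) (accepted c T)
            aboveT = above-mono (m≤m⊔n (proj₁ first) (proj₁ settled)) (All.lookup (proj₂ first) (∈-prefixes y′⊑z) (t , above))
            i≡i₁ : i ≡ i₁
            i≡i₁ = proj₂ (G-sound g∈) (y′ , y′⊑z , aboveT ,
              All.tabulate λ e∈ → All.lookup has (accepted-mono c T≤t e∈))

          -- By `full`, the `m` strings of `G` are all strings with `K ≤ n` at `z`, so `x` is one of
          -- them. `agree` carries its label in `G` over to `e`, where `x` has only one label.
          inherit : ∀ {y′ e g} → Prefix _≡_ y′ z → e ∈ accepted c t → Above y′ e → g ∈ proj₂ e →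
                    approx t (proj₁ g) y′ ≤ n → Has (accepted c t) y′ g → g ∈ G
          inherit {y′} {e} {x , i} y′⊑z e∈ y′⊑e g∈e ≤n has with ∈-map⁻ proj₁ (full {map proj₁ G} y⊑z
            (proj₁ (proj₂ (proj₂ labelling)))
            (All.tabulate λ w∈ → case ∈-map⁻ proj₁ w∈ of λ where
              (g , g∈ , refl) → All.lookup U≤n (proj₁ (G-sound g∈)))
            (trans (length-map proj₁ G) (proj₁ (proj₂ labelling)))
            (≤-trans (prefix-antitone monotone x y′⊑z) (≤-trans (K≤approx upperSemicomputable t x y′) ≤n)))
          ... | (_ , j) , h∈ , refl = subst (λ i → (x , i) ∈ G) (sym i≡j) h∈
            where
            has′ : Has (accepted c t) y′ (x , j)
            has′ = agree y′⊑z h∈ (All.map (λ has y⊑e → ∈-map⁺ proj₁ (has y⊑e)) has)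
            i≡j : i ≡ j
            i≡j = cong proj₂ (unique-map⁻ (proj₁ (proj₂ (proj₂ (sound-entry {t} e∈)))) g∈e (All.lookup has′ e∈ y′⊑e) refl)

          acceptable : Ok c t (accepted c t) (z , G)
          acceptable = proj₁ (proj₂ labelling) ,
            All.tabulate (λ {g} g∈ →
              ≤-trans (approx-antitone upperSemicomputable (proj₁ g) z (≤-trans (m≤n⊔m _ _) T≤t))
                      (All.lookup (proj₂ settled) (proj₁ (G-sound g∈))) ,
              All.lookup (proj₁ (proj₂ (proj₂ (proj₂ (proj₂ labelling))))) g∈) ,
            proj₁ (proj₂ (proj₂ labelling)) , proj₁ (proj₂ (proj₂ (proj₂ labelling))) ,
            All.tabulate (λ y′∈ → All.tabulate λ g∈ → agree (prefixes-∈ z y′∈) g∈) ,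
            All.tabulate (λ y′∈ → All.tabulate λ e∈ y′⊑e → All.tabulate λ g∈e →
              inherit (prefixes-∈ z y′∈) e∈ y′⊑e g∈e)

      -- Once `(z , G)` is accepted, an entry lies above `y`. Every entry above `y` lists `m`
      -- strings, hence by `full` also `x`, and coherence supplies the label.
      maximal-coloured : ∀ {x} → K x y ≤ n → ∃ λ t → ∃ λ i → Coloured c t y (x , i)
      maximal-coloured {x} K≤n with eventually c (z , G) T (λ t → acceptable)
      ... | s , e∈ = t , proj₁ label-x , ≤-trans (≤-reflexive (proj₂ (limit x y) t (m≤m⊔n _ s))) K≤n , above , proj₂ label-x
        where
        t = proj₁ (limit x y) ⊔ s
        above : Any (Above y) (accepted c t)
        above = lose (accepted-mono c (m≤n⊔m (proj₁ (limit x y)) s) e∈) y⊑z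
        covers : Covers (accepted c t) y x
        covers = All.tabulate λ {e} e∈ y⊑e → case sound-entry {t} e∈ of λ where
          (len , small , u₁ , _) → full y⊑e u₁
            (All.tabulate λ w∈ → case ∈-map⁻ proj₁ w∈ of λ { (g , g∈ , refl) → proj₁ (All.lookup small g∈) })
            (trans (length-map proj₁ (proj₂ e)) len)
            (≤-trans (prefix-antitone monotone x y⊑e) K≤n)
        label-x : ∃ λ i → Has (accepted c t) y (x , i)
        label-x = proj₂ (invariant t) y x above covers

  opaque
    coloured-complete : ∀ {n x y} → K x y ≤ n → ∃ λ m → m ≤ 2 ^ suc n × ∃ λ t → ∃ λ i → Coloured (n , m) t y (x , i)
    coloured-complete {n} {x} {y} K≤n with greatest em Size (2 ^ suc n) bound {0} (y , prefix-refl y , [] , [] , [] , refl)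
      where
      Size : ℕ → Set
      Size m = ∃ λ z → Prefix _≡_ y z × ∃ λ ws → Unique ws × All (λ w → K w z ≤ n) ws × length ws ≡ m
      bound : ∀ m → Size m → m ≤ 2 ^ suc n
      bound m (z , _ , ws , u , small , refl) = few z (suc n) ws u (All.map s≤s small)
    ... | m , (z , y⊑z , U , uU , U≤n , lenU) , m-max =
      m , subst (_≤ 2 ^ suc n) lenU (few z (suc n) U uU (All.map s≤s U≤n)) ,
      maximal-coloured (n , m) y⊑z uU U≤n lenU (subst (_≤ 2 ^ suc n) lenU (few z (suc n) U uU (All.map s≤s U≤n))) full K≤n
      where
      full : ∀ {ws w z′} → Prefix _≡_ y z′ → Unique ws → All (λ w → K w z′ ≤ n) ws → length ws ≡ m →
             K w z′ ≤ n → w ∈ ws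
      full {ws} {w} {z′} y⊑z′ u small len w≤n with em {w ∈ ws}
      ... | yes w∈ = w∈
      ... | no w∉  = contradiction
        (m-max (suc m) (z′ , y⊑z′ , w ∷ ws , All.tabulate (λ { v∈ refl → w∉ v∈ }) ∷ u , w≤n ∷ small , cong suc len))
        (<⇒≱ ≤-refl)

  private
    Witness : Ty
    Witness = nat ⊗ nat ⊗ nat ⊗ nat ⊗ str

  -- The colouring is evaluated at some prefix `v` of the condition, which makes the relation closed
  -- under extension of the condition.
  Match : ⟦ Witness ⟧ → String → String → String → Set
  Match ((((n , m) , i) , t) , v) p y x =
    m ≤ 2 ^ suc n × code p ≡ colour n m i × Prefix _≡_ v y × Coloured (n , m) t v (x , i)

  private
    opaque
      matchᵈ : Dc (nat ⊗ str ⊗ str ⊗ str) (λ (((u , p) , y) , x) → Match (dec Witness u) p y x)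
      matchᵈ = ≤ᵈ m (app 2^ᶜ (app sucᶜ n)) ×ᵈ
        ≡ᵈ {τ = nat} (app encᶜ p) (colourᶜ n m i) ×ᵈ
        strPrefixᵈ v y ×ᵈ colouredᵈ (n ,ᶜ m) t v (x ,ᶜ i)
        where
        Env′ : Ty
        Env′ = nat ⊗ str ⊗ str ⊗ str
        u : Comp Env′ Witness (λ q → dec Witness (proj₁ (proj₁ (proj₁ q))))
        u = app decᶜ (app fst (app fst fst))
        p : Comp Env′ str (λ q → proj₂ (proj₁ (proj₁ q)))
        p = app snd (app fst fst)
        y : Comp Env′ str (λ q → proj₂ (proj₁ q))
        y = app snd fst
        x : Comp Env′ str proj₂
        x = snd
        v : Comp Env′ str (λ q → proj₂ (dec Witness (proj₁ (proj₁ (proj₁ q)))))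
        v = app snd u
        t : Comp Env′ nat (λ q → proj₂ (proj₁ (dec Witness (proj₁ (proj₁ (proj₁ q))))))
        t = app snd (app fst u)
        i : Comp Env′ nat (λ q → proj₂ (proj₁ (proj₁ (dec Witness (proj₁ (proj₁ (proj₁ q)))))))
        i = app snd (app fst (app fst u))
        m : Comp Env′ nat (λ q → proj₂ (proj₁ (proj₁ (proj₁ (dec Witness (proj₁ (proj₁ (proj₁ q))))))))
        m = app snd (app fst (app fst (app fst u)))
        n : Comp Env′ nat (λ q → proj₁ (proj₁ (proj₁ (proj₁ (dec Witness (proj₁ (proj₁ (proj₁ q))))))))
        n = app fst (app fst (app fst (app fst u)))

  -- The colour determines `n`, `m` and the label; `v` and `v′` are prefixes of one condition, hence
  -- comparable.
  match-functional : ∀ u u′ {p y x w} → Match u p y x → Match u′ p y w → x ≡ w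
  match-functional ((((n , m) , i) , t) , v) ((((n′ , m′) , i′) , t′) , v′) (m≤ , eq , v⊑y , col) (m′≤ , eq′ , v′⊑y , col′)
    with colour-injective {n} {m} {i} {n′} {m′} {i′} m≤ (coloured-label< (n , m) {t} col)
           m′≤ (coloured-label< (n′ , m′) {t′} col′) (trans (sym eq) eq′)
  ... | refl , refl , refl with ≤-total (length v) (length v′)
  ... | inj₁ v≤v′ = coloured-functional (n , m) {t} col {t′} col′ (prefix-comparable v⊑y v′⊑y v≤v′)
  ... | inj₂ v′≤v = sym (coloured-functional (n , m) {t′} col′ {t} col (prefix-comparable v′⊑y v⊑y v′≤v))

  match-extensible : ∀ u {p y z x} → Match u p y x → Prefix _≡_ y z → Match u p z x
  match-extensible ((((n , m) , i) , t) , v) (m≤ , eq , v⊑y , col) y⊑z = m≤ , eq , prefix-trans v⊑y y⊑z , col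

  colouring : DescriptionMode
  colouring = record
    { Describes  = λ p y x → ∃ λ u → Match (dec Witness u) p y x
    ; enumerable = dc-enumerable matchᵈ
    ; functional = λ {p} {y} (u , match) (u′ , match′) →
        match-functional (dec Witness u) (dec Witness u′) {p} {y} match match′
    ; extensible = λ {p} (u , match) y⊑y′ → u , match-extensible (dec Witness u) {p} match y⊑y′
    }

  match-describes : ∀ w {p y x} → Match w p y x → Describes colouring p y x
  match-describes w {p} {y} {x} match =
    enc Witness w , subst (λ w → Match w p y x) (sym (dec-enc Witness w)) match

  colour-describes : ∀ {n m t i x y} → m ≤ 2 ^ suc n → Coloured (n , m) t y (x , i) →
                     ∃ λ p → Describes colouring p y x × length p ≤ 5 + 2 * n
  colour-describes {n} {m} {t} {i} {x} {y} m≤ col = p ,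
    match-describes ((((n , m) , i) , t) , y) {p} (m≤ , enc-dec str (colour n m i) , prefix-refl y , col) ,
    length-dec (5 + 2 * n) (colour-upper {n} {m} {i} m≤ (coloured-label< (n , m) {t} col))
    where
    p : String
    p = dec str (colour n m i)

  colouring-short : ∀ x y → ∃ λ p → Describes colouring p y x × length p ≤ 5 + 2 * K x y
  colouring-short x y = short (coloured-complete ≤-refl)
    where
    short : (∃ λ m → m ≤ 2 ^ suc (K x y) × ∃ λ t → ∃ λ i → Coloured (K x y , m) t y (x , i)) →
            ∃ λ p → Describes colouring p y x × length p ≤ 5 + 2 * K x y
    short (m , m≤ , t , i , col) = colour-describes {K x y} {m} {t} m≤ col

  C≤2K : ∀ D (opt : Optimal D) → ∃ λ c → ∀ x y → C D opt x y ≤ 2 * K x y + c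
  C≤2K D opt with optimal-bound D opt em colouring
  ... | c , bound = 5 + c , λ x y → case colouring-short x y of λ where
    (p , d , short) → ≤-trans (bound p x y d) (≤-trans (+-monoˡ-≤ c short)
      (≤-reflexive (trans (cong (_+ c) (+-comm 5 (2 * K x y))) (+-assoc (2 * K x y) 5 c))))

-- Functions of the class as minima of estimates

unique-length : ∀ {A : Set} {xs zs : List A} → Unique xs → (∀ {x} → x ∈ xs → x ∈ zs) → length xs ≤ length zs
unique-length {xs = xs} {zs} u sub = injective⇒≤ {f = λ i → Any.index (sub (∈-lookup i))} λ {i} {j} eq →
  unique-lookup u i j (trans (lookup-index (sub (∈-lookup i)))
    (trans (cong (lookup zs) eq) (sym (lookup-index (sub (∈-lookup j))))))

run-value : ∀ {n} {f : Rec n} {xs y t} → f ⟨ xs ⟩↦ y → proj₁ (run ⌜ f ⌝ (encVec xs) t) ≡ [] →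
            proj₂ (run ⌜ f ⌝ (encVec xs) t) ≡ y
run-value {f = f} {xs} {t = t} d stopped with run-complete d
... | s , eq = cong proj₂ (trans (sym (run-stays ⌜ f ⌝ (encVec xs) (m≤m⊔n t s) stopped)) (eq (t ⊔ s) (m≤n⊔m t s)))

opaque
  filterᶜ : ∀ {P : ⟦ σ ⟧ → ⟦ τ ⟧ → Set} {xs : ⟦ σ ⟧ → List ⟦ τ ⟧} (P? : Dc (σ ⊗ τ) (λ q → P (proj₁ q) (proj₂ q))) →
    Comp σ (list τ) xs → Comp σ (list τ) (λ a → filter (λ x → decide P? (a , x)) (xs a))
  filterᶜ {σ} {τ} {P} {xs} P? xsᶜ = Comp-cong (λ a → lemma a (xs a))
    (foldrᶜ {f = f} nil (ifᶜ (Dc-∘ P? fst) (app₂ consᶜ (app snd fst) snd) snd) xsᶜ)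
    where
    f : ⟦ σ ⟧ → ⟦ τ ⟧ → List ⟦ τ ⟧ → List ⟦ τ ⟧
    f a x r = if does (decide P? (a , x)) then x ∷ r else r
    lemma : ∀ a ys → foldr (f a) [] ys ≡ filter (λ x → decide P? (a , x)) ys
    lemma a []       = refl
    lemma a (y ∷ ys) with does (decide P? (a , y))
    ... | true  = cong (y ∷_) (lemma a ys)
    ... | false = lemma a ys

-- The common scheme of the minimal and the separating function: the least weight of a fact that
-- applies, capped by a default depending on `x` alone. Facts persist when the condition is
-- extended, which gives monotonicity; the default makes every value finite.
module Estimates (Index : Ty) (Applies : ⟦ Index ⟧ → String → String → Set)
  (appliesᵈ : Dc (Index ⊗ str ⊗ str) (λ ((k , x) , y) → Applies k x y))
  (applies-∷ʳ : ∀ k {x y b} → Applies k x y → Applies k x (y ∷ʳ b))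
  {weight : ⟦ Index ⟧ → ℕ} (weightᶜ : Comp Index nat weight)
  {default : String → ℕ} (defaultᶜ : Comp str nat default)
  (em : ExcludedMiddle 0ℓ) where

  private
    estimate : ⟦ Index ⟧ → String → String → ℕ
    -- The cap `⊓ default x` serves monotonicity: a fact that starts to apply at an extension must
    -- not raise the estimate.
    estimate k x y = if does (decide appliesᵈ ((k , x) , y)) then weight k ⊓ default x else default x

    opaque
      estimateᶜ : Comp (nat ⊗ str ⊗ str) nat (λ ((u , x) , y) → estimate (dec Index u) x y)
      estimateᶜ = ifᶜ (Dc-∘ appliesᵈ ((k ,ᶜ app snd fst) ,ᶜ snd))
        (app₂ ⊓ᶜ (app weightᶜ k) (app defaultᶜ (app snd fst))) (app defaultᶜ (app snd fst))
        where
        k : Comp (nat ⊗ str ⊗ str) Index (λ q → dec Index (proj₁ (proj₁ q)))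
        k = app decᶜ (app fst fst)

    estimate-≤-weight : ∀ k {x y} → Applies k x y → estimate k x y ≤ weight k
    estimate-≤-weight k {x} {y} a with decide appliesᵈ ((k , x) , y)
    ... | yes _ = m⊓n≤m (weight k) _
    ... | no ¬a = contradiction a ¬a

    estimate-≤-default : ∀ k x y → estimate k x y ≤ default x
    estimate-≤-default k x y with does (decide appliesᵈ ((k , x) , y))
    ... | true  = m⊓n≤n (weight k) _
    ... | false = ≤-refl

    estimate-< : ∀ k {x y m} → estimate k x y < m → default x < m ⊎ Applies k x y × weight k < m
    estimate-< k {x} {y} {m} lt with decide appliesᵈ ((k , x) , y)
    ... | no _  = inj₁ lt
    ... | yes a with ⊓-sel (weight k) (default x)
    ... | inj₁ eq = inj₂ (a , subst (_< m) eq lt)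
    ... | inj₂ eq = inj₁ (subst (_< m) eq lt)

    estimate-mono : ∀ k x y b → estimate k x (y ∷ʳ b) ≤ estimate k x y
    estimate-mono k x y b with decide appliesᵈ ((k , x) , y) | decide appliesᵈ ((k , x) , y ∷ʳ b)
    ... | yes _ | yes _  = ≤-refl
    ... | yes a | no ¬a′ = contradiction (applies-∷ʳ k a) ¬a′
    ... | no _  | yes _  = m⊓n≤n (weight k) _
    ... | no _  | no _   = ≤-refl

  value : String → String → ℕ
  value = infimum em (λ u → estimate (dec Index u))

  private
    isMin : IsMin (λ u → estimate (dec Index u)) value
    isMin = infimum-isMin em (λ u → estimate (dec Index u))

  value-≤-weight : ∀ k {x y} → Applies k x y → value x y ≤ weight k
  value-≤-weight k {x} {y} a = ≤-trans (proj₁ (isMin x y) (enc Index k))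
    (subst (λ k′ → estimate k′ x y ≤ weight k) (sym (dec-enc Index k)) (estimate-≤-weight k a))

  value-≤-default : ∀ x y → value x y ≤ default x
  value-≤-default x y = ≤-trans (proj₁ (isMin x y) 0) (estimate-≤-default (dec Index 0) x y)

  value-< : ∀ {x y m} → value x y < m → default x < m ⊎ ∃ λ k → Applies k x y × weight k < m
  value-< {x} {y} {m} lt with proj₂ (isMin x y)
  ... | u , eq with estimate-< (dec Index u) (subst (_< m) (sym eq) lt)
  ... | inj₁ short = inj₁ short
  ... | inj₂ a     = inj₂ (dec Index u , a)

  value∈𝒦 : (∀ y m → AtMost (2 ^ m) (λ x → default x < m ⊎ ∃ λ k → Applies k x y × weight k < m)) → 𝒦 value
  value∈𝒦 few = record
    { upperSemicomputable = min-upperSemicomputable estimateᶜ isMin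
    ; few      = λ y m → atMost-mono ≤-refl value-< (few y m)
    ; monotone = isMin-mono isMin (λ u → estimate-mono (dec Index u))
    }

-- A minimal function

module Universal (em : ExcludedMiddle 0ℓ) where

  -- An event (x , y , n , s) in the process of the program i claims K x y ≤ n, because i halts
  -- on (s , x , y) with a value not exceeding n.

  event : Ty
  event = str ⊗ str ⊗ nat ⊗ nat

  object condition : ⟦ event ⟧ → String
  object    (((x , _) , _) , _) = x
  condition (((_ , y) , _) , _) = y

  bound : ⟦ event ⟧ → ℕ
  bound ((_ , n) , _) = n

  Relevant : String → ℕ → ⟦ event ⟧ → Set
  Relevant y n e = Prefix _≡_ (condition e) y × bound e ≤ n

  relevantᵈ : Dc (str ⊗ nat ⊗ event) (λ ((y , n) , e) → Relevant y n e)
  relevantᵈ = strPrefixᵈ (app snd (app fst (app fst snd))) (app fst fst) ×ᵈ ≤ᵈ (app snd (app fst snd)) (app snd fst)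

  objects : List ⟦ event ⟧ → String → ℕ → List String
  objects es y n = dedup {τ = str} (map object (filter (λ e → decide relevantᵈ ((y , n) , e)) es))

  -- The counting condition reduced to finitely many tests, at conditions and bounds of events. The
  -- exponent is `suc (bound b)` because an event claims a value at most its bound, whereas the
  -- class counts values strictly below.
  Consistent : List ⟦ event ⟧ → Set
  Consistent es = All (λ a → All (λ b → length (objects es (condition a) (bound b)) ≤ 2 ^ suc (bound b)) es) es

  ∈-objects : ∀ {es y n e} → e ∈ es → Relevant y n e → object e ∈ objects es y n
  ∈-objects {es} {y} {n} e∈ rel = ∈-dedup _ (∈-map⁺ object (∈-filter⁺ (λ e → decide relevantᵈ ((y , n) , e)) e∈ rel))

  objects-∈ : ∀ {es y n x} → x ∈ objects es y n → ∃ λ e → e ∈ es × Relevant y n e × x ≡ object e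
  objects-∈ {es} {y} {n} x∈ with ∈-map⁻ object (dedup-∈ _ x∈)
  ... | e , e∈ , eq with ∈-filter⁻ (λ e → decide relevantᵈ ((y , n) , e)) {xs = es} e∈
  ... | e∈es , rel = e , e∈es , rel , eq

  Ok : ℕ → ℕ → List ⟦ event ⟧ → ⟦ event ⟧ → Set
  Ok i t es e@(((x , y) , n) , s) =
    proj₁ (run i (enc₃ s x y) t) ≡ [] × proj₂ (run i (enc₃ s x y) t) ≤ n × Consistent (e ∷ es)

  private
    Env : Ty
    Env = nat ⊗ nat ⊗ list event ⊗ event

    opaque
      okᵈ : Dc Env (λ (((i , t) , es) , e) → Ok i t es e)
      okᵈ = ≡ᵈ (app fst runs) nil ×ᵈ ≤ᵈ (app snd runs) n ×ᵈ
        Allᵈ (Allᵈ (≤ᵈ (app lengthᶜ (app dedupᶜ (mapᶜ object′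
            (filterᶜ (Dc-∘ relevantᵈ ((wk (app snd (app fst (app fst (app snd fst)))) ,ᶜ wk (app snd (app fst snd))) ,ᶜ snd))
               (wk (wk es))))))
          (app 2^ᶜ (app sucᶜ (app snd (app fst snd))))) (wk es)) es
        where
        object′ : Comp event str object
        object′ = app fst (app fst fst)
        x : Comp Env str (λ q → object (proj₂ q))
        x = app fst (app fst (app fst snd))
        y : Comp Env str (λ q → condition (proj₂ q))
        y = app snd (app fst (app fst snd))
        n : Comp Env nat (λ q → bound (proj₂ q))
        n = app snd (app fst snd)
        s : Comp Env nat (λ q → proj₂ (proj₂ q))
        s = app snd snd
        runs : Comp Env State (λ (((i , t) , es) , (((x , y) , n) , s)) → run i (enc₃ s x y) t)
        runs = app runᶜ ((app fst (app fst fst) ,ᶜ enc₃ᶜ s x y) ,ᶜ app snd (app fst fst))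
        es : Comp Env (list event) (λ (((i , t) , es) , e) → e ∷ es)
        es = app₂ consᶜ snd (app snd fst)

  open Process nat event Ok okᵈ

  Fact : List ⟦ event ⟧ → String → ℕ → String → Set
  Fact es y m x = ∃ λ e → e ∈ es × object e ≡ x × Prefix _≡_ (condition e) y × bound e < m

  maximiser : ∀ {A : Set} (Q : A → Set) (f : A → ℕ) {xs} → (∃ λ a → a ∈ xs × Q a) →
              ∃ λ a → a ∈ xs × Q a × ∀ {b} → b ∈ xs → Q b → f b ≤ f a
  maximiser Q f {x ∷ xs} some with em {∃ λ a → a ∈ xs × Q a}
  maximiser Q f {x ∷ xs} (a , here refl , qa) | no none =
    a , here refl , qa , λ { (here refl) _ → ≤-refl ; (there b∈) qb → contradiction (_ , b∈ , qb) none }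
  maximiser Q f {x ∷ xs} (a , there a∈ , qa)  | no none = contradiction (a , a∈ , qa) none
  maximiser Q f {x ∷ xs} some | yes rest with maximiser Q f rest | em {Q x}
  ... | a , a∈ , qa , max | no ¬qx =
    a , there a∈ , qa , λ { (here refl) qb → contradiction qb ¬qx ; (there b∈) qb → max b∈ qb }
  ... | a , a∈ , qa , max | yes qx with ≤-total (f x) (f a)
  ... | inj₁ fx≤fa = a , there a∈ , qa , λ { (here refl) _ → fx≤fa ; (there b∈) qb → max b∈ qb }
  ... | inj₂ fa≤fx = x , here refl , qx , λ { (here refl) _ → ≤-refl ; (there b∈) qb → ≤-trans (max b∈ qb) fa≤fx }

  -- Take the longest condition and the largest bound among the events concerned. All their
  -- conditions are prefixes of `y`, hence of the longest one, so a single test of `Consistent`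
  -- counts all the strings.
  consistent-few : ∀ {es} → Consistent es → ∀ y m → AtMost (2 ^ m) (Fact es y m)
  consistent-few {es} consistent y m []       _ _   = z≤n
  consistent-few {es} consistent y m xs@(_ ∷ _) u facts@((e , e∈ , refl , p , <m) ∷ _)
    with maximiser Q (λ e → length (condition e)) (e , e∈ , p , <m) | maximiser Q bound (e , e∈ , p , <m)
    where
    Q : ⟦ event ⟧ → Set
    Q e = Prefix _≡_ (condition e) y × bound e < m
  ... | a , a∈ , (a⊑y , _) , longest | b , b∈ , (_ , b<m) , highest = ≤-trans
    (unique-length u λ x∈ → case All.lookup facts x∈ of λ where
      (e , e∈ , refl , e⊑y , e<m) →
        ∈-objects e∈ (prefix-comparable e⊑y a⊑y (longest e∈ (e⊑y , e<m)) , highest e∈ (e⊑y , e<m)))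
    (≤-trans (All.lookup (All.lookup consistent a∈) b∈) (^-monoʳ-≤ 2 b<m))

  opaque
    accepted-consistent : ∀ i t → Consistent (accepted i t)
    accepted-consistent i = accepted-induction i (λ _ → Consistent) [] (λ _ _ c → c) (λ _ _ _ _ (_ , _ , c) → c)

  Known : ℕ → String → ℕ → String → Set
  Known i y m x = ∃ λ t → Fact (accepted i t) y m x

  known-few : ∀ i y m → AtMost (2 ^ m) (Known i y m)
  known-few i y m xs u known with common em (λ x t → Fact (accepted i t) y m x)
    (λ s≤t (e , e∈ , rest) → e , accepted-mono i s≤t e∈ , rest) xs known
  ... | t , facts = consistent-few (accepted-consistent i t) y m xs u facts

  -- 2 ^ d + 2 ^ (d - 1) + ... + 2 ≤ 2 ^ (1 + d).
  all-known-few : ∀ y d i → AtMost (2 ^ suc d) (λ x → ∃ λ j → j < d × Known (i + j) y (d ∸ j) x)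
  all-known-few y zero    i []      _ _                 = z≤n
  all-known-few y zero    i (_ ∷ _) _ ((_ , () , _) ∷ _)
  all-known-few y (suc d) i = atMost-mono
    (≤-reflexive (cong (2 ^ suc d +_) (sym (+-identityʳ (2 ^ suc d)))))
    (λ {x} → λ where
      (zero  , _ , known)      → inj₁ (subst (λ i → Known i y (suc d) x) (+-identityʳ i) known)
      (suc j , s≤s j<d , known) → inj₂ (j , j<d , subst (λ i → Known i y (d ∸ j) x) (+-suc i j) known))
    (atMost-⊎ (known-few i y (suc d)) (all-known-few y d (suc i)))

  private
    Index : Ty
    Index = nat ⊗ nat ⊗ event

  Applies : ⟦ Index ⟧ → String → String → Set
  Applies ((i , t) , e) x y = e ∈ accepted i t × object e ≡ x × Prefix _≡_ (condition e) y

  private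
    opaque
      appliesᵈ : Dc (Index ⊗ str ⊗ str) (λ ((k , x) , y) → Applies k x y)
      appliesᵈ = ∈ᵈ e (app₂ acceptedᶜ (app fst (app fst k)) (app snd (app fst k))) ×ᵈ
        ≡ᵈ (app fst (app fst (app fst e))) (app snd fst) ×ᵈ strPrefixᵈ (app snd (app fst (app fst e))) snd
        where
        k : Comp (Index ⊗ str ⊗ str) Index (λ q → proj₁ (proj₁ q))
        k = app fst fst
        e : Comp (Index ⊗ str ⊗ str) event (λ q → proj₂ (proj₁ (proj₁ q)))
        e = app snd k

  applies-∷ʳ : ∀ k {x y b} → Applies k x y → Applies k x (y ∷ʳ b)
  applies-∷ʳ _ (e∈ , eq , p) = e∈ , eq , prefix-∷ʳ p

  -- With the offset `2 + i`, program `i` puts at most 2 ^ (m - 2 - i) strings below `m`. Together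
  -- these are at most 2 ^ (m - 1); fewer than 2 ^ (m - 1) strings have a default `1 + length x`
  -- below `m`.
  weight : ⟦ Index ⟧ → ℕ
  weight ((i , _) , e) = bound e + (2 + i)

  private
    module Estimate = Estimates Index Applies appliesᵈ
      applies-∷ʳ {weight}
      (app₂ +ᶜ (app snd (app fst snd)) (app sucᶜ (app sucᶜ (app fst fst))))
      (app sucᶜ strLengthᶜ) em

  optimum : String → String → ℕ
  optimum = Estimate.value

  optimum-few : ∀ y m → AtMost (2 ^ m) (λ x → suc (length x) < m ⊎ ∃ λ k → Applies k x y × weight k < m)
  optimum-few y m = few m
    where
    Small : ℕ → String → Set
    Small m x = suc (length x) < m ⊎ ∃ λ k → Applies k x y × weight k < m
    few : ∀ m → AtMost (2 ^ m) (Small m)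
    few zero          []      _ _ = z≤n
    few zero          (_ ∷ _) _ (inj₁ () ∷ _)
    few zero          (_ ∷ _) _ (inj₂ (_ , _ , ()) ∷ _)
    few (suc zero)    []      _ _ = z≤n
    few (suc zero)    (_ ∷ _) _ (inj₁ (s≤s ()) ∷ _)
    few (suc zero)    (_ ∷ _) _ (inj₂ (((i , _) , e) , _ , lt) ∷ _) =
      contradiction (≤-trans (s≤s (s≤s z≤n)) (≤-trans (m≤n+m (2 + i) (bound e)) (s≤s⁻¹ lt))) λ ()
    few (suc (suc d)) = atMost-mono
      (+-monoʳ-≤ (2 ^ suc d) (≤-trans pred[n]≤n (≤-reflexive (sym (+-identityʳ (2 ^ suc d))))))
      (λ where
        (inj₁ (s≤s short)) → inj₂ short
        (inj₂ (((i , t) , e) , (e∈ , eq , p) , lt)) → inj₁ (i , index< lt , t , e , e∈ , eq , p , rest< lt))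
      (atMost-⊎ (all-known-few y d 0) short-few)
      where
      index+ : ∀ {n i} → n + (2 + i) < 2 + d → n + i < d
      index+ {n} {i} lt = s≤s⁻¹ (s≤s⁻¹ (subst (_< 2 + d) (trans (+-suc n (suc i)) (cong suc (+-suc n i))) lt))
      index< : ∀ {n i} → n + (2 + i) < 2 + d → i < d
      index< {n} {i} lt = ≤-<-trans (m≤n+m i n) (index+ lt)
      rest< : ∀ {n i} → n + (2 + i) < 2 + d → n < d ∸ i
      rest< {n} {i} lt = m+n≤o⇒m≤o∸n (suc n) (index+ {n} {i} lt)
      short-few : AtMost (pred (2 ^ suc d)) (λ (x : String) → length x < suc d)
      short-few = atMost-index (λ x k → code x ≡ k) (λ {x} lt → code x , short-code x lt , refl)
        (λ eq eq′ → code-injective _ _ (trans eq (sym eq′)))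

  module _ {K : String → String → ℕ} (K∈𝒦 : 𝒦 K) where
    open 𝒦 K∈𝒦
    open UpperSemicomputable upperSemicomputable using (approx; limit)
      renaming (program to approximator; computes to approximates)
    private
      i : ℕ
      i = ⌜ approximator ⌝

    True : ⟦ event ⟧ → Set
    True e = K (object e) (condition e) ≤ bound e

    -- Claims that are true of a `K` in `𝒦` pass the test because `K` itself satisfies the counting
    -- condition. So a program for such a `K` is never hampered by what was accepted before.
    true-consistent : ∀ {es} → All True es → Consistent es
    true-consistent {es} all = All.tabulate λ {a} _ → All.tabulate λ {b} _ →
      few (condition a) (suc (bound b)) (objects es (condition a) (bound b))
        (dedup-unique {str} (map object (filter (λ e → decide relevantᵈ ((condition a , bound b) , e)) es)))
        (All.tabulate λ x∈ → case objects-∈ {es} x∈ of λ where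
          (e , e∈ , (e⊑a , e≤b) , refl) →
            s≤s (≤-trans (prefix-antitone monotone (object e) e⊑a) (≤-trans (All.lookup all e∈) e≤b)))

    accepted-true : ∀ t → All True (accepted i t)
    accepted-true = accepted-induction i (λ _ → All True) [] (λ _ _ all → all)
      λ { t es (((x , y) , n) , s) all (stopped , ≤n , _) →
            ≤-trans (K≤approx upperSemicomputable s x y)
              (subst (_≤ n) (run-value {t = t} (approximates s x y) stopped) ≤n) ∷ all }

    eventually-known : ∀ x y → ∃ λ t → ∃ λ s → (((x , y) , K x y) , s) ∈ accepted i t
    eventually-known x y = known (run-complete (approximates N x y))
      where
      N : ℕ
      N = proj₁ (limit x y)
      known : (∃ λ s → ∀ t → s ≤ t → run i (enc₃ N x y) t ≡ ([] , approx N x y)) →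
              ∃ λ t → ∃ λ s → (((x , y) , K x y) , s) ∈ accepted i t
      known (s , halts) with eventually i (((x , y) , K x y) , N) s (λ t s≤t →
          cong proj₁ (halts t s≤t) ,
          ≤-reflexive (trans (cong proj₂ (halts t s≤t)) (proj₂ (limit x y) N ≤-refl)) ,
          true-consistent (≤-refl ∷ accepted-true t))
      ... | t , e∈ = t , N , e∈

    optimum≤ : ∀ x y → optimum x y ≤ K x y + (2 + i)
    optimum≤ x y = below (eventually-known x y)
      where
      below : (∃ λ t → ∃ λ s → (((x , y) , K x y) , s) ∈ accepted i t) → optimum x y ≤ K x y + (2 + i)
      below (t , s , e∈) =
        Estimate.value-≤-weight ((i , t) , (((x , y) , K x y) , s)) {x} {y} (e∈ , refl , prefix-refl y)

  optimum-minimal : Minimal optimum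
  optimum-minimal = Estimate.value∈𝒦 optimum-few , λ K K∈𝒦 → 2 + ⌜ UpperSemicomputable.program (𝒦.upperSemicomputable K∈𝒦) ⌝ , optimum≤ K∈𝒦

blocks-injective : ∀ v w → blocks v ≡ blocks w → v ≡ w
blocks-injective []            []            _  = refl
blocks-injective []            (zero ∷ w)    ()
blocks-injective []            (suc j ∷ w)   ()
blocks-injective (zero ∷ v)    []            ()
blocks-injective (suc i ∷ v)   []            ()
blocks-injective (i ∷ v)       (j ∷ w)       eq with go i j eq
  where
  go : ∀ i j {s t} → block i s ≡ block j t → i ≡ j × s ≡ t
  go zero    zero    refl = refl , refl
  go (suc i) (suc j) eq with go i j (cong (λ { [] → [] ; (_ ∷ s) → s }) eq)
  ... | refl , eq′ = refl , eq′
  go zero    (suc j) ()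
  go (suc i) zero    ()
... | refl , eq′ = cong (i ∷_) (blocks-injective v w eq′)

prefix-length : ∀ {A : Set} {xs ys : List A} → Prefix _≡_ xs ys → length xs ≤ length ys
prefix-length []      = z≤n
prefix-length (_ ∷ p) = s≤s (prefix-length p)

prefix-equal : ∀ {A : Set} {xs ys zs : List A} → Prefix _≡_ xs zs → Prefix _≡_ ys zs →
               length xs ≡ length ys → xs ≡ ys
prefix-equal []         []         _  = refl
prefix-equal (refl ∷ p) (refl ∷ q) eq = cong (_ ∷_) (prefix-equal p q (suc-injective eq))

-- The game against a description mode

module Adversary (em : ExcludedMiddle 0ℓ) (D : DescriptionMode) where

  -- A request ((v , l) , C) puts the string named by the node l at the node v; the list C
  -- contains descriptions of that string which were forced at nodes between v and l.
  node request : Ty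
  node    = list nat
  request = node ⊗ node ⊗ list str

  position target : ⟦ request ⟧ → List ℕ
  position ((v , _) , _) = v
  target   ((_ , l) , _) = l

  colours : ⟦ request ⟧ → List String
  colours (_ , C) = C

  height : ⟦ request ⟧ → ℕ
  height e = length (colours e)

  -- Serves both as the condition at a node and as the string named by a node. The leading block `a`
  -- keeps the games for different `a` at incomparable conditions.
  string : ℕ → List ℕ → String
  string a v = blocks (a ∷ v)

  Child : List ℕ → List ℕ → Set
  Child v w = Prefix _≡_ v w × length w ≡ suc (length v)

  Answered : ℕ → ℕ → ⟦ request ⟧ → String → Set
  Answered a t e p = Seen D t p (string a (position e)) (string a (target e))

  -- The leaves of the first tree are at level 2 ^ a; those of a later tree are 2 ^ a levels above
  -- the target of a request of full height, the winner of the previous round. `Inner` admits one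
  -- request for each node and height.
  Leaf Inner : ℕ → ℕ → List ⟦ request ⟧ → ⟦ request ⟧ → Set
  Leaf a t es ((v , l) , C) = C ≡ [] × v ≡ l ×
    (length l ≡ 2 ^ a ⊎
     Any (λ e → height e ≡ 2 ^ a × Prefix _≡_ (target e) l × length l ≡ length (target e) + 2 ^ a) es)
  Inner a t es ((v , l) , C) = length C ≤ 2 ^ a ×
    All (λ e → position e ≡ v → height e ≢ length C) es ×
    Any (λ e → target e ≡ l × Child v (position e) ×
      Any (λ e′ → Child v (position e′) × position e ≢ position e′ ×
        -- The new description is looked for in the finite list `C`, whose head it is; this keeps
        -- the test decidable.
        Any (λ c → C ≡ c ∷ colours e × length c < 2 * a × Answered a t e c × Answered a t e′ c) C) es) es

  -- The bound on the target ends the game after 2 ^ a rounds of height 2 ^ a.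
  Ok : ℕ → ℕ → List ⟦ request ⟧ → ⟦ request ⟧ → Set
  Ok a t es e = length (target e) ≤ 2 ^ a * 2 ^ a × (Leaf a t es e ⊎ Inner a t es e)

  private
    Env : Ty
    Env = nat ⊗ nat ⊗ list request ⊗ request

    positionᶜ : ∀ {e : ⟦ σ ⟧ → ⟦ request ⟧} → Comp σ request e → Comp σ node (λ a → position (e a))
    positionᶜ e = app fst (app fst e)

    targetᶜ : ∀ {e : ⟦ σ ⟧ → ⟦ request ⟧} → Comp σ request e → Comp σ node (λ a → target (e a))
    targetᶜ e = app snd (app fst e)

    heightᶜ : ∀ {e : ⟦ σ ⟧ → ⟦ request ⟧} → Comp σ request e → Comp σ nat (λ a → height (e a))
    heightᶜ e = app lengthᶜ (app snd e)

    stringᶜ : ∀ {a : ⟦ σ ⟧ → ℕ} {v} → Comp σ nat a → Comp σ node v → Comp σ str (λ q → string (a q) (v q))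
    stringᶜ a v = app blocksᶜ (app₂ consᶜ a v)

    childᵈ : ∀ {v w : ⟦ σ ⟧ → List ℕ} → Comp σ node v → Comp σ node w → Dc σ (λ a → Child (v a) (w a))
    childᵈ v w = Prefixᵈ v w ×ᵈ ≡ᵈ {τ = nat} (app lengthᶜ w) (app sucᶜ (app lengthᶜ v))

    answeredᵈ : ∀ {a t : ⟦ σ ⟧ → ℕ} {e p} → Comp σ nat a → Comp σ nat t → Comp σ request e → Comp σ str p →
                Dc σ (λ q → Answered (a q) (t q) (e q) (p q))
    answeredᵈ a t e p = seenᵈ D t p (stringᶜ a (positionᶜ e)) (stringᶜ a (targetᶜ e))

    opaque
      okᵈ : Dc Env (λ (((a , t) , es) , e) → Ok a t es e)
      okᵈ = ≤ᵈ (app lengthᶜ l) (app₂ *ᶜ A A) ×ᵈ (leafᵈ ⊎ᵈ innerᵈ)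
        where
        a : Comp Env nat (λ q → proj₁ (proj₁ (proj₁ q)))
        a = app fst (app fst fst)
        A : Comp Env nat (λ q → 2 ^ proj₁ (proj₁ (proj₁ q)))
        A = app 2^ᶜ a
        t : Comp Env nat (λ q → proj₂ (proj₁ (proj₁ q)))
        t = app snd (app fst fst)
        es : Comp Env (list request) (λ q → proj₂ (proj₁ q))
        es = app snd fst
        v : Comp Env node (λ q → position (proj₂ q))
        v = positionᶜ snd
        l : Comp Env node (λ q → target (proj₂ q))
        l = targetᶜ snd
        C′ : Comp Env (list str) (λ q → colours (proj₂ q))
        C′ = app snd snd
        leafᵈ : Dc Env (λ (((a , t) , es) , e) → Leaf a t es e)
        leafᵈ = ≡ᵈ {τ = list str} C′ nil ×ᵈ ≡ᵈ {τ = node} v l ×ᵈ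
          (≡ᵈ {τ = nat} (app lengthᶜ l) A ⊎ᵈ
           Anyᵈ (≡ᵈ {τ = nat} (heightᶜ snd) (wk A) ×ᵈ Prefixᵈ (targetᶜ snd) (wk l) ×ᵈ
             ≡ᵈ {τ = nat} (app lengthᶜ (wk l)) (app₂ +ᶜ (app lengthᶜ (targetᶜ snd)) (wk A))) es)
        innerᵈ : Dc Env (λ (((a , t) , es) , e) → Inner a t es e)
        innerᵈ = ≤ᵈ (app lengthᶜ C′) A ×ᵈ
          Allᵈ (≡ᵈ {τ = node} (positionᶜ snd) (wk v) →ᵈ ¬ᵈ (≡ᵈ {τ = nat} (heightᶜ snd) (app lengthᶜ (wk C′)))) es ×ᵈ
          Anyᵈ (≡ᵈ {τ = node} (targetᶜ snd) (wk l) ×ᵈ childᵈ (wk v) (positionᶜ snd) ×ᵈ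
            Anyᵈ (childᵈ (wk (wk v)) (positionᶜ snd) ×ᵈ
                ¬ᵈ (≡ᵈ {τ = node} (positionᶜ (app snd fst)) (positionᶜ snd)) ×ᵈ
              Anyᵈ (≡ᵈ {τ = list str} (wk (wk (wk C′))) (app₂ consᶜ snd (app snd (app snd (app fst fst)))) ×ᵈ
                  ≤ᵈ (app sucᶜ (app strLengthᶜ snd)) (app₂ *ᶜ (const 2) (wk (wk (wk a)))) ×ᵈ
                  answeredᵈ (wk (wk (wk a))) (wk (wk (wk t))) (app snd (app fst fst)) snd ×ᵈ
                  answeredᵈ (wk (wk (wk a))) (wk (wk (wk t))) (app snd fst) snd)
                (wk (wk C′)))
              (wk es))
            es

  open Process nat request Ok okᵈ public

  module _ (a : ℕ) where
    private
      A = 2 ^ a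

    record Valid (es : List ⟦ request ⟧) (e : ⟦ request ⟧) : Set where
      field
        ascent   : Prefix _≡_ (position e) (target e)
        level    : length (position e) + height e ≡ length (target e)
        bounded  : length (target e) ≤ A * A
        height≤  : height e ≤ A
        round    : ℕ
        length≡  : length (target e) ≡ suc round * A
        previous : round ≡ 0 ⊎ ∃ λ e₀ → e₀ ∈ es × height e₀ ≡ A × Prefix _≡_ (target e₀) (target e) ×
                   length (target e₀) ≡ round * A
        -- Every node on the way up to the target has been requested for this target; with `single`,
        -- any such node and its height determine the target.
        path     : ∀ w → Prefix _≡_ (position e) w → Prefix _≡_ w (target e) →
                   ∃ λ C → ((w , target e) , C) ∈ es
        -- A colour describes the target at its own leaf and another string at a node `w` above the
        -- position. The latter bars it from describing the target at the position.
        used     : All (λ c → length c < 2 * a × Describes D c (string a (target e)) (string a (target e)) ×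
                     ∃ λ w → Prefix _≡_ (position e) w × ∃ λ l → l ≢ target e ×
                       Describes D c (string a w) (string a l)) (colours e)
        distinct : Unique (colours e)
        single   : ∀ {e′} → e′ ∈ es → position e ≡ position e′ → height e ≡ height e′ → target e ≡ target e′

    open Valid

    AllValid : List ⟦ request ⟧ → Set
    AllValid es = ∀ {e} → e ∈ es → Valid es e

    string-mono : ∀ {v w} → Prefix _≡_ v w → Prefix _≡_ (string a v) (string a w)
    string-mono p = blocks-mono (refl ∷ p)

    string-injective : ∀ {v w} → string a v ≡ string a w → v ≡ w
    string-injective {v} {w} eq = cong (λ { [] → [] ; (_ ∷ s) → s }) (blocks-injective (a ∷ v) (a ∷ w) eq)

    weaken : ∀ {es e e′} → Valid es e →
             (position e ≡ position e′ → height e ≡ height e′ → target e ≡ target e′) → Valid (e′ ∷ es) e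
    weaken {es} {e} {e′} valid new = record
      { ascent   = ascent valid
      ; level    = level valid
      ; bounded  = bounded valid
      ; height≤  = height≤ valid
      ; round    = round valid
      ; length≡  = length≡ valid
      ; previous = case previous valid of λ where
          (inj₁ eq)               → inj₁ eq
          (inj₂ (e₀ , e₀∈ , rest)) → inj₂ (e₀ , there e₀∈ , rest)
      ; path     = λ w p q → case path valid w p q of λ { (C , ∈es) → C , there ∈es }
      ; used     = used valid
      ; distinct = distinct valid
      ; single   = λ { (here refl) → new ; (there e″∈) → single valid e″∈ }
      }

    prefix-antisym : ∀ {v w : List ℕ} → Prefix _≡_ v w → Prefix _≡_ w v → v ≡ w
    prefix-antisym p q = prefix-equal p (prefix-refl _) (≤-antisym (prefix-length p) (prefix-length q))

    leaf-valid : ∀ {t es e} → AllValid es → length (target e) ≤ A * A → Leaf a t es e → Valid (e ∷ es) e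
    leaf-valid {t} {es} {(v , .v) , .[]} valid v≤ (refl , refl , start) = record
      { ascent   = prefix-refl v
      ; level    = +-identityʳ (length v)
      ; bounded  = v≤
      ; height≤  = z≤n
      ; round    = proj₁ (rounds start)
      ; length≡  = proj₁ (proj₂ (rounds start))
      ; previous = proj₂ (proj₂ (rounds start))
      ; path     = λ w p q → [] , here (cong (λ w → (w , v) , []) (prefix-antisym q p))
      ; used     = []
      ; distinct = []
      ; single   = λ where
          (here refl) _ _ → refl
          (there {x = _} e′∈) refl eq → single-leaf (valid e′∈) (sym eq)
      }
      where
      Start : Set
      Start = length v ≡ A ⊎
        Any (λ e → height e ≡ A × Prefix _≡_ (target e) v × length v ≡ length (target e) + A) es
      rounds : Start → ∃ λ r → length v ≡ suc r * A × (r ≡ 0 ⊎ ∃ λ e₀ → e₀ ∈ (((v , v) , []) ∷ es) ×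
                height e₀ ≡ A × Prefix _≡_ (target e₀) v × length (target e₀) ≡ r * A)
      rounds (inj₁ eq) = 0 , trans eq (sym (+-identityʳ A)) , inj₁ refl
      rounds (inj₂ some) with find some
      ... | e₀ , e₀∈ , h , p , eq = suc (round (valid e₀∈)) ,
        trans eq (trans (cong (_+ A) (length≡ (valid e₀∈))) (+-comm _ A)) ,
        inj₂ (e₀ , there e₀∈ , h , p , length≡ (valid e₀∈))
      single-leaf : ∀ {e} → Valid es e → height e ≡ 0 → position e ≡ target e
      single-leaf {e} val h≡0 = prefix-equal (ascent val) (prefix-refl _)
        (trans (sym (+-identityʳ _)) (trans (cong (length (position e) +_) (sym h≡0)) (level val)))

    inner-valid : ∀ {t es e} → AllValid es → length (target e) ≤ A * A → Inner a t es e → Valid (e ∷ es) e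
    inner-valid {t} {es} {(v , l) , C} valid l≤ (C≤ , none , some) with find some
    ... | e₁ , e₁∈ , refl , (v⊑v₁ , len₁) , some₂ with find some₂
    ... | e₂ , e₂∈ , (v⊑v₂ , len₂) , v₁≢v₂ , some₃ with find some₃
    ... | c , _ , refl , c< , seen₁ , seen₂ = record
      { ascent   = prefix-trans v⊑v₁ (ascent val₁)
      ; level    = trans (+-suc (length v) (height e₁)) (trans (cong (_+ height e₁) (sym len₁)) (level val₁))
      ; bounded  = l≤
      ; height≤  = C≤
      ; round    = round val₁
      ; length≡  = length≡ val₁
      ; previous = case previous val₁ of λ where
          (inj₁ eq)               → inj₁ eq
          (inj₂ (e₀ , e₀∈ , rest)) → inj₂ (e₀ , there e₀∈ , rest)
      ; path     = path′
      ; used     = (c< , extensible D d₁ (string-mono (ascent val₁)) , position e₂ , v⊑v₂ , target e₂ , l₂≢l₁ , d₂) ∷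
                   All.map (λ (c< , d , w , p , rest) → c< , d , w , prefix-trans v⊑v₁ p , rest) (used val₁)
      ; distinct = All.map fresh′ (used val₁) ∷ distinct val₁
      ; single   = λ where
          (here refl) _ _ → refl
          (there e′∈) eq eq′ → contradiction (sym eq′) (All.lookup none e′∈ (sym eq))
      }
      where
      val₁ : Valid es e₁
      val₁ = valid e₁∈
      d₁ : Describes D c (string a (position e₁)) (string a (target e₁))
      d₁ = seen-sound D {t} {c} seen₁
      d₂ : Describes D c (string a (position e₂)) (string a (target e₂))
      d₂ = seen-sound D {t} {c} seen₂
      -- Targets extend their positions, and different children of `v` have no common extension.
      l₂≢l₁ : target e₂ ≢ target e₁
      l₂≢l₁ eq = v₁≢v₂ (prefix-equal (ascent val₁) (subst (Prefix _≡_ (position e₂)) eq (ascent (valid e₂∈)))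
        (trans len₁ (sym len₂)))
      -- The old colour describes another string at `w` above `e₁`, whereas `c` describes the target
      -- there by extension.
      fresh′ : ∀ {c′} → _ × _ × (∃ λ w → Prefix _≡_ (position e₁) w × ∃ λ l → l ≢ target e₁ ×
                 Describes D c′ (string a w) (string a l)) → c ≢ c′
      fresh′ (_ , _ , w , p , l , l≢ , d) refl =
        l≢ (string-injective (functional D d (extensible D d₁ (string-mono p))))
      path′ : ∀ w → Prefix _≡_ v w → Prefix _≡_ w (target e₁) →
              ∃ λ C → ((w , target e₁) , C) ∈ (((v , target e₁) , c ∷ colours e₁) ∷ es)
      path′ w p q with length w ≟ length v
      ... | yes eq = c ∷ colours e₁ , here (cong (λ w → (w , target e₁) , c ∷ colours e₁)
        (prefix-equal q (prefix-trans v⊑v₁ (ascent val₁)) eq))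
      ... | no neq = case path val₁ w (prefix-comparable (ascent val₁) q
                (subst (_≤ length w) (sym len₁) (≤∧≢⇒< (prefix-length p) (λ eq → neq (sym eq))))) q of λ where
              (C , ∈es) → C , there ∈es

    opaque
      accepted-valid : ∀ t → AllValid (accepted a t)
      accepted-valid = accepted-induction a (λ _ → AllValid) (λ ()) (λ _ _ valid → valid) extend
        where
        extend : ∀ t es e → AllValid es → Ok a t es e → AllValid (e ∷ es)
        extend t es e valid (l≤ , kind) = all
          where
          new : Valid (e ∷ es) e
          new = case kind of λ where
            (inj₁ leaf)  → leaf-valid {t} valid l≤ leaf
            (inj₂ inner) → inner-valid {t} valid l≤ inner
          all : AllValid (e ∷ es)
          all (here refl) = new
          all (there e′∈) = weaken (valid e′∈) λ eq eq′ → sym (single new (there e′∈) (sym eq) (sym eq′))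

    A>0 : 0 < A
    A>0 = m^n>0 2 a

    private
      instance
        A≢0 : NonZero A
        A≢0 = >-nonZero A>0

    Requested : List ⟦ request ⟧ → String → List ℕ → Set
    Requested es y l = ∃ λ e → e ∈ es × target e ≡ l × Prefix _≡_ (string a (position e)) y

    module _ {es : List ⟦ request ⟧} (valid : AllValid es) where

      -- The winner of an earlier round lies on the path to every later request.
      earlier-winner : ∀ k s {e} → e ∈ es → length (target e) ≡ suc (k + suc s) * A →
        ∃ λ e₀ → e₀ ∈ es × height e₀ ≡ A × Prefix _≡_ (target e₀) (target e) × length (target e₀) ≡ suc s * A
      earlier-winner k s {e} e∈ eq with previous (valid e∈)
           | *-cancelʳ-≡ (suc (round (valid e∈))) (suc (k + suc s)) A (trans (sym (length≡ (valid e∈))) eq)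
      earlier-winner zero    s e∈ eq | inj₁ r≡0 | r≡ with () ← trans (sym r≡0) (suc-injective r≡)
      earlier-winner (suc k) s e∈ eq | inj₁ r≡0 | r≡ with () ← trans (sym r≡0) (suc-injective r≡)
      earlier-winner zero    s e∈ eq | inj₂ (e₀ , e₀∈ , h , p , len) | r≡ =
        e₀ , e₀∈ , h , p , trans len (cong (_* A) (suc-injective r≡))
      earlier-winner (suc k) s e∈ eq | inj₂ (e₀ , e₀∈ , h , p , len) | r≡
        with earlier-winner k s e₀∈ (trans len (cong (_* A) (suc-injective r≡)))
      ... | e₁ , e₁∈ , h₁ , p₁ , len₁ = e₁ , e₁∈ , h₁ , prefix-trans p₁ p , len₁

      blocks-prefix : ∀ {y v w} → Prefix _≡_ (string a v) y → Prefix _≡_ (string a w) y →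
                      length v ≤ length w → Prefix _≡_ v w
      blocks-prefix {v = v} {w} p q v≤w with blocks-comparable (a ∷ v) (a ∷ w) p q (s≤s v≤w)
      ... | _ ∷ r = r

      -- The winner of round `s` has its target on the path to `e*`, hence below `y`. The position
      -- of `e` lies between position and target of this winner, so `e` requests the same string:
      -- below later requests an earlier round counts only through its winner.
      earlier-target : ∀ {y e e*} s s* → s < s* → e ∈ es → e* ∈ es →
        Prefix _≡_ (string a (position e)) y → Prefix _≡_ (string a (position e*)) y →
        length (target e) ≡ suc s * A → length (target e*) ≡ suc s* * A →
        Prefix _≡_ (string a (target e)) y
      earlier-target {y} {e} {e*} s s* s<s* e∈ e*∈ p p* eq eq*
        with earlier-winner (s* ∸ suc s) s e*∈ (trans eq* (cong (λ k → suc k * A) (sym (m∸n+n≡m s<s*))))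
      ... | e₀ , e₀∈ , h₀ , l₀⊑l* , len₀ = subst (λ l → Prefix _≡_ (string a l) y) (sym same) l₀⊑y
        where
        val = valid e∈
        val₀ = valid e₀∈
        val* = valid e*∈
        l₀⊑v* : Prefix _≡_ (target e₀) (position e*)
        l₀⊑v* = prefix-comparable l₀⊑l* (ascent val*) (≤-trans (≤-reflexive len₀) (+-cancelʳ-≤ (height e*) _ _
          (≤-trans (≤-trans (+-monoʳ-≤ (suc s * A) (height≤ val*)) (≤-trans (≤-reflexive (+-comm (suc s * A) A))
            (*-monoˡ-≤ A (s≤s s<s*)))) (≤-reflexive (trans (sym eq*) (sym (level val*)))))))
        l₀⊑y : Prefix _≡_ (string a (target e₀)) y
        l₀⊑y = prefix-trans (string-mono l₀⊑v*) p*
        same-length : length (target e) ≡ length (target e₀)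
        same-length = trans eq (sym len₀)
        v⊑l₀ : Prefix _≡_ (position e) (target e₀)
        v⊑l₀ = blocks-prefix p l₀⊑y (≤-trans (prefix-length (ascent val)) (≤-reflexive same-length))
        v₀⊑v : Prefix _≡_ (position e₀) (position e)
        v₀⊑v = prefix-comparable (ascent val₀) v⊑l₀ (+-cancelʳ-≤ (height e) _ _
          (≤-trans (+-monoʳ-≤ (length (position e₀)) (≤-trans (height≤ val) (≤-reflexive (sym h₀))))
                   (≤-reflexive (trans (level val₀) (trans (sym same-length) (sym (level val)))))))
        same : target e ≡ target e₀
        same with path val₀ (position e) v₀⊑v v⊑l₀
        ... | C , ∈es = single val ∈es refl (+-cancelˡ-≡ (length (position e)) _ _
          (trans (level val) (trans same-length (sym (level (valid ∈es))))))

      -- Let `s*` be the last round met on the way to `y`. Each earlier round contributes only its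
      -- winner, with index `s`, and round `s*` one target for each height from 0 to `A`, with index
      -- `s* + height`. As `s* < A`, all indices are below `2 * A`.
      requested-few : ∀ y → AtMost (2 * A) (Requested es y)
      requested-few y []       _ _ = z≤n
      requested-few y ls@(_ ∷ _) u requested@((e , e∈ , _ , p) ∷ _)
        with greatest em InRound A round< {round (valid e∈)} (e , e∈ , p , length≡ (valid e∈))
        where
        InRound : ℕ → Set
        InRound s = ∃ λ e → e ∈ es × Prefix _≡_ (string a (position e)) y × length (target e) ≡ suc s * A
        round< : ∀ s → InRound s → s ≤ A
        round< s (e , e∈ , _ , eq) = <⇒≤ (*-cancelʳ-≤ (suc s) A A (subst (_≤ A * A) eq (bounded (valid e∈))))
      ... | s* , (e* , e*∈ , p* , eq*) , last = atMost-index Index index injective ls u requested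
        where
        Index : List ℕ → ℕ → Set
        Index l i = ∃ λ e → e ∈ es × target e ≡ l × Prefix _≡_ (string a (position e)) y × ∃ λ s →
          length l ≡ suc s * A × (s < s* × i ≡ s ⊎ s ≡ s* × i ≡ s* + height e)
        s*<A : s* < A
        s*<A = *-cancelʳ-≤ (suc s*) A A (subst (_≤ A * A) eq* (bounded (valid e*∈)))
        index : ∀ {l} → Requested es y l → ∃ λ i → i < 2 * A × Index l i
        index (e , e∈ , refl , p) with round (valid e∈) ≟ s*
        ... | yes refl = s* + height e , +-mono-<-≤ s*<A (≤-trans (height≤ (valid e∈)) (m≤m+n A 0)) ,
          e , e∈ , refl , p , s* , length≡ (valid e∈) , inj₂ (refl , refl)
        ... | no s≢s* with ≤∧≢⇒< (last (round (valid e∈)) (e , e∈ , p , length≡ (valid e∈))) s≢s*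
        ... | s<s* = round (valid e∈) , ≤-trans (<-trans s<s* s*<A) (m≤m+n A (A + 0)) ,
          e , e∈ , refl , p , round (valid e∈) , length≡ (valid e∈) , inj₁ (s<s* , refl)
        injective : ∀ {l l′ i} → Index l i → Index l′ i → l ≡ l′
        injective (e , e∈ , refl , p , s , eq , inj₁ (s<s* , refl)) (e′ , e′∈ , refl , p′ , .s , eq′ , inj₁ (_ , refl)) =
          prefix-antisym
            (blocks-prefix (later e∈ p eq) (later e′∈ p′ eq′) (≤-reflexive (trans eq (sym eq′))))
            (blocks-prefix (later e′∈ p′ eq′) (later e∈ p eq) (≤-reflexive (trans eq′ (sym eq))))
          where
          later : ∀ {e} → e ∈ es → Prefix _≡_ (string a (position e)) y → length (target e) ≡ suc s * A →
                  Prefix _≡_ (string a (target e)) y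
          later e∈ p eq = earlier-target s s* s<s* e∈ e*∈ p p* eq eq*
        injective (_ , _ , _ , _ , s , _ , inj₁ (s<s* , refl)) (e′ , _ , _ , _ , _ , _ , inj₂ (_ , eq)) =
          contradiction (≤-trans (m≤m+n s* (height e′)) (≤-reflexive (sym eq))) (<⇒≱ s<s*)
        injective (e , _ , _ , _ , _ , _ , inj₂ (_ , eq)) (_ , _ , _ , _ , s , _ , inj₁ (s<s* , refl)) =
          contradiction (≤-trans (m≤m+n s* (height e)) (≤-reflexive (sym eq))) (<⇒≱ s<s*)
        injective (e , e∈ , refl , p , _ , eq , inj₂ (refl , h)) (e′ , e′∈ , refl , p′ , _ , eq′ , inj₂ (refl , h′)) =
          single (valid e∈) e′∈ (prefix-antisym (blocks-prefix p p′ (≤-reflexive lengths))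
            (blocks-prefix p′ p (≤-reflexive (sym lengths)))) heights
          where
          heights : height e ≡ height e′
          heights = +-cancelˡ-≡ s* _ _ (trans (sym h) h′)
          lengths : length (position e) ≡ length (position e′)
          lengths = +-cancelʳ-≡ (height e) _ _ (trans (level (valid e∈)) (trans eq (trans (sym eq′)
            (trans (sym (level (valid e′∈))) (cong (length (position e′) +_) (sym heights))))))

    -- If every request were answered by a short description, the colours of A rounds would
    -- outnumber the short descriptions.

    Answer : String → String → Set
    Answer x y = ∃ λ p → length p < 2 * a × Describes D p y x

    module _ (answered : ∀ t e → e ∈ accepted a t → Answer (string a (target e)) (string a (position e))) where

      -- The possible roots of a round: the empty node at first, then the target of a winner.
      Active : List ℕ → Set
      Active l = l ≡ [] ⊎ ∃ λ t → ∃ λ e → e ∈ accepted a t × target e ≡ l × height e ≡ A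

      Reached : ℕ → List ℕ → Set
      Reached h v = ∃ λ t → ∃ λ e → e ∈ accepted a t × position e ≡ v × height e ≡ h

      Replied : ℕ → List ℕ → Set
      Replied h v = ∃ λ t → ∃ λ e → e ∈ accepted a t × position e ≡ v × height e ≡ h ×
        ∃ λ p → length p < 2 * a × Describes D p (string a (position e)) (string a (target e))

      replied : ∀ {h v} → Reached h v → Replied h v
      replied (t , e , e∈ , eq , h) with answered t e e∈
      ... | p , short , d = t , e , e∈ , eq , h , p , short , d

      -- Among 1 + 2 ^ (2 * a) children two have the same short answer. The resulting request at `v`
      -- is acceptable from some time on, since `¬reached` says that its height is never taken at
      -- `v`.
      reach-inner : ∀ {h v} → suc h ≤ A → (∀ j → Reached h (v ∷ʳ j)) → Reached (suc h) v
      reach-inner {h} {v} h<A children with em {Reached (suc h) v}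
      ... | yes reached = reached
      ... | no ¬reached = choose (pigeonhole ≤-refl (λ (j : Fin (suc (2 ^ (2 * a)))) → fromℕ< (reply< (toℕ j))))
        where
        reply : ∀ j → Replied h (v ∷ʳ j)
        reply j = replied (children j)
        answer : ℕ → String
        answer j = proj₁ (proj₂ (proj₂ (proj₂ (proj₂ (proj₂ (reply j))))))
        reply< : ∀ j → code (answer j) < 2 ^ (2 * a)
        reply< j = <-≤-trans (short-code (answer j) (proj₁ (proj₂ (proj₂ (proj₂ (proj₂ (proj₂ (proj₂ (reply j)))))))))
                             pred[n]≤n
        child : ∀ j → Child v (v ∷ʳ j)
        child j = prefix-++ v (j ∷ []) , trans (length-++ v) (+-comm (length v) 1)

        accept-inner : ∀ {i j} → i ≢ j → (ri : Replied h (v ∷ʳ i)) (rj : Replied h (v ∷ʳ j)) →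
          proj₁ (proj₂ (proj₂ (proj₂ (proj₂ (proj₂ ri))))) ≡ proj₁ (proj₂ (proj₂ (proj₂ (proj₂ (proj₂ rj))))) →
          Reached (suc h) v
        accept-inner {i} {j} i≢j (t₁ , e₁ , e₁∈ , eq₁ , h₁ , c , short , d₁) (t₂ , e₂ , e₂∈ , eq₂ , h₂ , .c , _ , d₂) refl =
          finish (seen-complete D d₁) (seen-complete D d₂)
          where
          new : ⟦ request ⟧
          new = (v , target e₁) , c ∷ colours e₁
          finish : (∃ λ s → ∀ t → s ≤ t → Answered a t e₁ c) → (∃ λ s → ∀ t → s ≤ t → Answered a t e₂ c) →
                   Reached (suc h) v
          finish (s₁ , seen₁) (s₂ , seen₂) with eventually a new (t₁ ⊔ t₂ ⊔ (s₁ ⊔ s₂)) ok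
            where
            ok : ∀ t → t₁ ⊔ t₂ ⊔ (s₁ ⊔ s₂) ≤ t → Ok a t (accepted a t) new
            ok t T≤t = bounded (accepted-valid t₁ e₁∈) , inj₂
              ( subst (λ k → suc k ≤ A) (sym h₁) h<A
              , All.tabulate (λ e∈ eq h≡ → ¬reached (t , _ , e∈ , eq , trans h≡ (cong suc h₁)))
              , lose (accepted-mono a (m⊔n≤o⇒m≤o t₁ t₂ ts≤t) e₁∈)
                  (refl , subst (Child v) (sym eq₁) (child i) ,
                   lose (accepted-mono a (m⊔n≤o⇒n≤o t₁ t₂ ts≤t) e₂∈)
                     (subst (Child v) (sym eq₂) (child j) ,
                      (λ eq → i≢j (∷ʳ-injectiveʳ v v (trans (sym eq₁) (trans eq eq₂)))) ,
                      here (refl , short , seen₁ t (m⊔n≤o⇒m≤o s₁ s₂ ss≤t) , seen₂ t (m⊔n≤o⇒n≤o s₁ s₂ ss≤t)))))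
              where
              ts≤t : t₁ ⊔ t₂ ≤ t
              ts≤t = m⊔n≤o⇒m≤o (t₁ ⊔ t₂) (s₁ ⊔ s₂) T≤t
              ss≤t : s₁ ⊔ s₂ ≤ t
              ss≤t = m⊔n≤o⇒n≤o (t₁ ⊔ t₂) (s₁ ⊔ s₂) T≤t
          ... | t , e∈ = t , new , e∈ , refl , cong suc h₁

        choose : (∃ λ i → ∃ λ j → i Fin.< j × fromℕ< (reply< (toℕ i)) ≡ fromℕ< (reply< (toℕ j))) → Reached (suc h) v
        choose (i , j , i<j , same) = accept-inner (<⇒≢ i<j) (reply (toℕ i)) (reply (toℕ j))
          (code-injective (answer (toℕ i)) (answer (toℕ j)) (fromℕ<-injective _ _ (reply< (toℕ i)) (reply< (toℕ j)) same))

      module _ {l₀ : List ℕ} (active : Active l₀) (room : length l₀ + A ≤ A * A) where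

        reach-leaf : ∀ {v} → Prefix _≡_ l₀ v → length v ≡ length l₀ + A → Reached 0 v
        reach-leaf {v} p eq = finish (start active)
          where
          Start : ℕ → Set
          Start t = length v ≡ A ⊎ Any (λ e → height e ≡ A × Prefix _≡_ (target e) v × length v ≡ length (target e) + A) (accepted a t)
          start : Active l₀ → ∃ λ T → ∀ t → T ≤ t → Start t
          start (inj₁ refl) = 0 , λ _ _ → inj₁ eq
          start (inj₂ (s , e , e∈ , refl , h)) = s , λ t s≤t → inj₂ (lose (accepted-mono a s≤t e∈) (h , p , eq))
          finish : (∃ λ T → ∀ t → T ≤ t → Start t) → Reached 0 v
          finish (T , started) with eventually a ((v , v) , []) T
            (λ t T≤t → subst (_≤ A * A) (sym eq) room , inj₁ (refl , refl , started t T≤t))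
          ... | t , e∈ = t , _ , e∈ , refl , refl

        reach : ∀ h {v} → h ≤ A → Prefix _≡_ l₀ v → length v + h ≡ length l₀ + A → Reached h v
        reach zero    h≤ p eq = reach-leaf p (trans (sym (+-identityʳ _)) eq)
        reach (suc h) {v} h≤ p eq = reach-inner h≤ λ j → reach h (<⇒≤ h≤) (prefix-∷ʳ p)
          (trans (cong (_+ h) (length-++ v)) (trans (+-assoc (length v) 1 h) eq))

      Palette : List ℕ → String → Set
      Palette l c = length c < 2 * a × ∃ λ l′ → Prefix _≡_ l′ l × Describes D c (string a l) (string a l′)

      -- Each round adds `A` colours, and by extension all collected colours describe strings at the
      -- current leaf. An old one describes a string whose name is a prefix of the root of the
      -- round, a new one the target, whose name is longer; so no colour occurs twice.
      rounds : ∀ r → r ≤ A → ∃ λ l → length l ≡ r * A × Active l ×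
               ∃ λ cs → Unique cs × length cs ≡ r * A × All (Palette l) cs
      rounds zero    _   = [] , refl , inj₁ refl , [] , [] , refl , []
      rounds (suc r) r<A with rounds r (<⇒≤ r<A)
      ... | l , len , active , cs , u , lenC , palette = next (reach active room A ≤-refl (prefix-refl l) refl)
        where
        room : length l + A ≤ A * A
        room = ≤-trans (≤-reflexive (trans (cong (_+ A) len) (+-comm (r * A) A))) (*-monoˡ-≤ A r<A)
        next : Reached A l → ∃ λ l → length l ≡ suc r * A × Active l ×
               ∃ λ cs → Unique cs × length cs ≡ suc r * A × All (Palette l) cs
        next (t , e , e∈ , refl , h) =
          target e , length-target , inj₂ (t , e , e∈ , refl , h) ,
          colours e ++ cs , ++⁺ (distinct val) u disjoint ,
          trans (length-++ (colours e)) (cong₂ _+_ h lenC) ,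
          AllProps.++⁺ (All.map (λ (c< , d , _) → c< , target e , prefix-refl _ , d) (used val))
            (All.map (λ (c< , l′ , p , d) → c< , l′ , prefix-trans p (ascent val) ,
              extensible D d (string-mono (ascent val))) palette)
          where
          val = accepted-valid t e∈
          length-target : length (target e) ≡ suc r * A
          length-target = trans (sym (level val)) (trans (cong₂ _+_ len h) (+-comm (r * A) A))
          disjoint : ∀ {c} → ¬ (c ∈ colours e × c ∈ cs)
          disjoint (c∈ , c∈cs) with All.lookup (used val) c∈ | All.lookup palette c∈cs
          ... | _ , d , _ | _ , l′ , p , d′ = contradiction
            (prefix-length (subst (λ l → Prefix _≡_ l (position e))
              (string-injective {l′} {target e} (functional D (extensible D d′ (string-mono (ascent val))) d)) p))
            (<⇒≱ (subst₂ _<_ (sym len) (sym length-target) (m<n+m (r * A) A>0)))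

      -- After `A` rounds there are 2 ^ (2 * a) different descriptions shorter than `2 * a`, one
      -- more than there are such strings.
      answered-impossible : ⊥
      answered-impossible with rounds A ≤-refl
      ... | _ , _ , _ , cs , u , len , palette = <⇒≱ many
        (unique-short (All.map proj₁ palette))
        where
        many : pred (2 ^ (2 * a)) < length cs
        many = ≤-reflexive (trans (suc-pred (2 ^ (2 * a)) {{>-nonZero (m^n>0 2 (2 * a))}})
          (trans (trans (cong (λ k → 2 ^ (a + k)) (+-identityʳ a)) (^-distribˡ-+-* 2 a a)) (sym len)))
        unique-short : All (λ c → length c < 2 * a) cs → length cs ≤ pred (2 ^ (2 * a))
        unique-short = atMost-index (λ c i → code c ≡ i) (λ {c} short → code c , short-code c short , refl)
          (λ eq eq′ → code-injective _ _ (trans eq (sym eq′))) cs u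

    unanswered : ∃ λ t → ∃ λ e → e ∈ accepted a t × ¬ Answer (string a (target e)) (string a (position e))
    unanswered with em {∃ λ t → ∃ λ e → e ∈ accepted a t × ¬ Answer (string a (target e)) (string a (position e))}
    ... | yes found = found
    ... | no none = ⊥-elim (answered-impossible λ t e e∈ → answer t e e∈)
      where
      answer : ∀ t e → e ∈ accepted a t → Answer (string a (target e)) (string a (position e))
      answer t e e∈ with em {Answer (string a (target e)) (string a (position e))}
      ... | yes p = p
      ... | no ¬p = contradiction (t , e , e∈ , ¬p) none

-- The function separating the class from the complexity

atMost-image : ∀ {A B : Set} {P : A → Set} {b} (f : A → B) → AtMost b P → AtMost b (λ y → ∃ λ x → f x ≡ y × P x)
atMost-image {P = P} {b} f most ys u all with preimages all
  where
  preimages : ∀ {ys} → All (λ y → ∃ λ x → f x ≡ y × P x) ys → ∃ λ xs → map f xs ≡ ys × All P xs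
  preimages []                      = [] , refl , []
  preimages ((x , refl , p) ∷ all) with preimages all
  ... | xs , refl , ps = x ∷ xs , refl , p ∷ ps
... | xs , refl , ps = subst (_≤ b) (sym (length-map f xs))
  (most xs (map⁻ u) ps)

module Separation (em : ExcludedMiddle 0ℓ) (D : DescriptionMode) where
  open Adversary em D

  private
    Index : Ty
    Index = nat ⊗ nat ⊗ request

  Applies : ⟦ Index ⟧ → String → String → Set
  Applies ((a , t) , e) x y = e ∈ accepted a t × string a (target e) ≡ x × Prefix _≡_ (string a (position e)) y

  private
    opaque
      appliesᵈ : Dc (Index ⊗ str ⊗ str) (λ ((k , x) , y) → Applies k x y)
      appliesᵈ = ∈ᵈ e (app₂ acceptedᶜ a (app snd (app fst k))) ×ᵈ
        ≡ᵈ (app blocksᶜ (app₂ consᶜ a (app snd (app fst e)))) (app snd fst) ×ᵈ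
        strPrefixᵈ (app blocksᶜ (app₂ consᶜ a (app fst (app fst e)))) snd
        where
        k : Comp (Index ⊗ str ⊗ str) Index (λ q → proj₁ (proj₁ q))
        k = app fst fst
        a : Comp (Index ⊗ str ⊗ str) nat (λ q → proj₁ (proj₁ (proj₁ (proj₁ q))))
        a = app fst (app fst k)
        e : Comp (Index ⊗ str ⊗ str) request (λ q → proj₂ (proj₁ (proj₁ q)))
        e = app snd k

  applies-∷ʳ : ∀ k {x y b} → Applies k x y → Applies k x (y ∷ʳ b)
  applies-∷ʳ _ (e∈ , eq , p) = e∈ , eq , prefix-∷ʳ p

  -- Matches the at most 2 ^ (a + 1) strings that the game for `a` requests along a path.
  weight : ⟦ Index ⟧ → ℕ
  weight ((a , _) , _) = suc a

  -- Some string needs the value 0, because the claim includes n = 0.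
  default : String → ℕ
  default x = length x + length x ⊓ 1

  open Estimates Index Applies appliesᵈ applies-∷ʳ
    {weight} (app sucᶜ (app fst fst)) {default} (app₂ +ᶜ strLengthᶜ (app₂ ⊓ᶜ strLengthᶜ (const 1))) em public

  default-few : ∀ m → AtMost (2 ^ m) (λ x → default x < suc m)
  default-few m = atMost-index (λ x i → code x ≡ i) (λ {x} small → code x , code< x small , refl)
    (λ {x} {x′} eq eq′ → code-injective x x′ (trans eq (sym eq′)))
    where
    code< : ∀ x → default x < suc m → code x < 2 ^ m
    code< []          _     = m^n>0 2 m
    code< x@(_ ∷ s) small = <-≤-trans
      (short-code x (s≤s⁻¹ (subst (_< suc m)
        (trans (cong (λ k → suc (length s) + suc k) (⊓-zeroʳ (length s))) (+-comm (suc (length s)) 1)) small)))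
      pred[n]≤n

  -- Of the 2 ^ (m + 1) places, half go to default values and half to a game. Only one game is
  -- played along `y`, because its number `a` is the first block of `y`; its 2 ^ (a + 1) strings fit
  -- in, as a weight below `suc m` means `a < m`.
  separation-few : ∀ y m → AtMost (2 ^ m) (λ x → default x < m ⊎ ∃ λ k → Applies k x y × weight k < m)
  separation-few y zero    []      _ _ = z≤n
  separation-few y zero    (_ ∷ _) _ (inj₁ () ∷ _)
  separation-few y zero    (_ ∷ _) _ (inj₂ (_ , _ , ()) ∷ _)
  separation-few y (suc m) with em {∃ λ a → a < m × Prefix _≡_ (blocks (a ∷ [])) y}
  ... | no none = atMost-mono (m≤m+n (2 ^ m) _)
    (λ where
      (inj₁ small) → small
      (inj₂ (((a , t) , e) , (_ , _ , p) , a<)) →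
        contradiction (a , s≤s⁻¹ a< , prefix-trans (blocks-mono {a ∷ []} {a ∷ position e} (refl ∷ [])) p) none)
    (default-few m)
  ... | yes (a , a<m , p) = atMost-mono (+-monoʳ-≤ (2 ^ m) (≤-trans (^-monoʳ-≤ 2 a<m) (m≤m+n (2 ^ m) 0)))
    (λ where
      (inj₁ small) → inj₁ small
      (inj₂ (((a′ , t) , e) , (e∈ , eq , p′) , _)) → inj₂ (case blocks-comparable (a ∷ []) (a′ ∷ position e) p p′ (s≤s z≤n) of λ where
        (refl ∷ []) → target e , eq , t , e , e∈ , refl , p′))
    (atMost-⊎ (default-few m) (atMost-image (string a) game-few))
    where
    game-few : AtMost (2 ^ suc a) (λ l → ∃ λ t → Requested a (accepted a t) y l)
    game-few ls u all with common em (λ l t → Requested a (accepted a t) y l)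
      (λ s≤t (e , e∈ , rest) → e , accepted-mono a s≤t e∈ , rest) ls all
    ... | t , requested = requested-few a (accepted-valid a t) y ls u requested

  separation∈𝒦 : 𝒦 value
  separation∈𝒦 = value∈𝒦 separation-few

  module _ (opt : Optimal D) where

    witness : ∀ n → ∃ λ x → ∃ λ y → value x y ≤ n × 2 * n ≤ C D opt x y + 2
    -- The default of the empty string is 0.
    witness zero    = [] , [] , value-≤-default [] [] , z≤n
    -- The unanswered string of the game for `a` has value at most `a + 1` and complexity at least
    -- `2 * a`; the shift by one costs the constant 2.
    witness (suc a) = far (unanswered a)
      where
      far : (∃ λ t → ∃ λ e → e ∈ accepted a t × ¬ Answer a (string a (target e)) (string a (position e))) →
            ∃ λ x → ∃ λ y → value x y ≤ suc a × 2 * suc a ≤ C D opt x y + 2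
      far (t , e , e∈ , ¬answer) = string a (target e) , string a (position e) ,
        value-≤-weight ((a , t) , e) (e∈ , refl , prefix-refl _) , bound (C-describes D opt _ _)
        where
        bound : (∃ λ p → Describes D p (string a (position e)) (string a (target e)) ×
                  length p ≡ C D opt (string a (target e)) (string a (position e))) →
                2 * suc a ≤ C D opt (string a (target e)) (string a (position e)) + 2
        bound (p , d , eq) = ≤-trans (≤-reflexive (trans (*-distribˡ-+ 2 1 a) (+-comm 2 (2 * a))))
          (+-monoˡ-≤ 2 (≤-trans (≮⇒≥ λ short → ¬answer (p , short , d)) (≤-reflexive eq)))

    not-minimal : ¬ Minimal (C D opt)
    not-minimal (_ , minimal) with minimal value separation∈𝒦
    ... | c , C≤ = absurd (witness (suc (c + 2)))
      where
      n : ℕ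
      -- The least `n` with `n + c + 2 < 2 * n`.
      n = suc (c + 2)
      absurd : (∃ λ x → ∃ λ y → value x y ≤ n × 2 * n ≤ C D opt x y + 2) → ⊥
      absurd (x , y , K≤ , ≤C) = <⇒≱ {n + (c + 2)} {2 * n} (+-monoʳ-< n (m≤m+n n 0))
        (≤-trans ≤C (≤-trans (+-monoˡ-≤ 2 (≤-trans (C≤ x y) (+-monoˡ-≤ c K≤))) (≤-reflexive (+-assoc n c 2))))

theorem9 : ExcludedMiddle 0ℓ →
    (∀ D (opt : Optimal D) → 𝒦 (C D opt)) ×
    (∃ λ K₀ → Minimal K₀) ×
    (∀ D (opt : Optimal D) →
      ¬ Minimal (C D opt) ×
      (∃ λ K → 𝒦 K ×
        (∃ λ (x : ℕ → String) → ∃ λ (y : ℕ → String) →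
          (∀ n → K (x n) (y n) ≤ n) ×
          (∃ λ c → ∀ n → 2 * n ≤ C D opt (x n) (y n) + c)))) ×
    (∀ D (opt : Optimal D) → ∀ K → 𝒦 K →
      ∃ λ c → ∀ x y → C D opt x y ≤ 2 * K x y + c)
theorem9 em =
  (λ D opt → C∈𝒦 D opt em) ,
  (Universal.optimum em , Universal.optimum-minimal em) ,
  (λ D opt → let open Separation em D in
    not-minimal opt , value , separation∈𝒦 ,
    (λ n → proj₁ (witness opt n)) , (λ n → proj₁ (proj₂ (witness opt n))) ,
    (λ n → proj₁ (proj₂ (proj₂ (witness opt n)))) , 2 , (λ n → proj₂ (proj₂ (proj₂ (witness opt n))))) ,
  (λ D opt K K∈𝒦 → Colouring.C≤2K em K K∈𝒦 D opt)
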